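{- Let $n\geq 1$ and $d$ be integers with $|d|\geq 2$. Define the $d$-sequence of $n$: $n_0=n$, $d_i=\gcd(n_i,|d|)$, $n_{i+1}=n_i/d_i$, and let $k\geq 0$ be the smallest integer with $d_k=1$ (so $n_k=n_{k+1}$); put $m=n_k$, so $n=d_0\cdots d_{k-1}m$ and $\gcd(m,d)=1$. The map $v\mapsto dv$ permutes $\mathbb{Z}_m$; for $v\in\mathbb{Z}_m$ let $o(v)$ be the size of its orbit $\{v,dv,d^2v,\dots\}$. Let $\mathcal{V}$ be a set of representatives of the orbits other than $\{0\}$, chosen so that for every prime $p\mid m$ all numbers $m/p^j$ ($1\leq j\leq \nu_p(m)$) lie in $\mathcal{V}$. For a prime $p\mid m$ let $\pi_p(m)$ be the largest power of $p$ dividing $m$, and for $v\in\mathcal V$ define $c(v)=\pi_p(m)$ if $v=m/\pi_p(m)$ for a prime $p\mid m$ and ($p\neq 2$ or $d\equiv 1 \pmod 4$ or $4\nmid m$); $c(v)=\pi_2(m)/2$ if $v=m/\pi_2(m)$, $d\equiv 3\pmod 4$ and $4\mid m$; $c(v)=2$ if $v=m/2$, $4\mid m$ and $d\equiv 3\pmod 4$; and $c(v)=1$ otherwise. Then the sandpile group of the generalized de Bruijn graph $\mathrm{DB}(n,d)$ (if $d\geq 2$), respectively of the generalized Kautz graph $\mathrm{Ktz}(n,|d|)$ (if $d\leq -2$), is isomorphic to $S(n,d)$, and $$\Sigma(n,d)\cong \Big[\bigoplus_{i=0}^{k-1}\mathbb{Z}_{|d|^{i+1}}^{\,n_i-2n_{i+1}+n_{i+2}}\Big]\oplus\Big[\bigoplus_{v\in\mathcal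 V}\mathbb{Z}_{|d^{o(v)}-1|}\Big],$$ $$S(n,d)\cong \Big[\bigoplus_{i=0}^{k-1}\Big(\mathbb{Z}_{|d|^{i+1}/d_i}\oplus\mathbb{Z}_{|d|^{i+1}}^{\,n_i-2n_{i+1}+n_{i+2}-1}\Big)\Big]\oplus\Big[\bigoplus_{v\in\mathcal V}\mathbb{Z}_{|d^{o(v)}-1|/c(v)}\Big].$$
   Context: For integers $n\ge1$, $d\ge0$: the generalized de Bruijn graph $\mathrm{DB}(n,d)$ has vertex set $\mathbb{Z}_n$ and arcs $v\to dv+i$ ($0\le i\le d-1$) for each $v$; the generalized Kautz graph $\mathrm{Ktz}(n,d)$ has vertex set $\mathbb{Z}_n$ and arcs $v\to -d(v+1)+i$ ($0\le i\le d-1$) (multiple arcs and loops allowed). The Laplacian of a digraph is $\Delta=D-A$, where $A_{v,w}$ is the number of arcs $v\to w$ and $D$ is diagonal with the out-degrees; these digraphs are Eulerian, and the sandpile group is the torsion subgroup of $\mathbb{Z}^{n-1}/\mathbb{Z}^{n-1}\Delta_v$ for the reduced Laplacian $\Delta_v$ (delete row and column $v$), independent of $v$. In the ring $\mathbb{Q}[x]/(x^n-1)$ (where $x^a$ for any integer $a$ depends only on $a \bmod n$) put $e_v=x^v-1$ and $\epsilon_v=d\,e_v-e_{dv}$ for $v\in\mathbb{Z}_n$. Let $\mathcal Z_n$ be the $\mathbb{Z}$-span of $e_1,\dots,e_{n-1}$, $\mathcal E_{n,d}$ the $\mathbb{Z}$-span of $\epsilon_1,\dots,\epsilon_{n-1}$,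 and $\Sigma(n,d)=\mathcal Z_n/\mathcal E_{n,d}$ (the sand dune group). Let $f_v=d\,x^v-x^{dv}(x^d-1)/(x-1)$, i.e. $f_v=dx^v-\sum_{i=0}^{d-1}x^{dv+i}$ if $d\ge2$ and $f_v=dx^v+\sum_{i=0}^{|d|-1}x^{d(v+1)+i}$ if $d\le-2$, and $S(n,d)=\mathcal Z_n/\langle f_1,\dots,f_{n-1}\rangle_{\mathbb{Z}}$. $\nu_p(m)$ is the exponent of $p$ in $m$. -}

module Defs where

open import Data.Nat as ℕ using (ℕ; zero; suc; _≤_; _<_)
open import Data.Nat.Divisibility as ℕD using (_∣?_)
open import Data.Nat.GCD using (gcd)
open import Data.Nat.Primality using (Prime; prime?)
open import Data.Integer as ℤ using (ℤ; +_; ∣_∣)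
open import Data.Integer.Divisibility as ℤD using ()
open import Data.Fin using (Fin; toℕ; punchIn)
open import Data.Bool using (Bool; true; false; if_then_else_; _∧_; _∨_; not)
open import Data.List using (List; []; _∷_; map; upTo; applyUpTo; concat; replicate; _++_; length)
open import Data.List.Membership.Propositional using (_∈_)
open import Data.List.Relation.Unary.All using (All)
open import Data.List.Relation.Unary.AllPairs using (AllPairs)
open import Data.Maybe using (Maybe; just; nothing; maybe)
open import Data.Product using (Σ; ∃; _×_; _,_)
open import Relation.Nullary using (¬_; ⌊_⌋)
open import Relation.Binary.PropositionalEquality using (_≡_; _≢_)

-- exact / truncated natural division, with a ÷ 0 := 0 (only ever used
-- with nonzero divisors dividing the dividend)
_div_ : ℕ → ℕ → ℕ
a div zero    = 0
a div (suc b) = a ℕ./ suc b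

_∣ᵇ_ : ℕ → ℕ → Bool
a ∣ᵇ b = ⌊ a ∣? b ⌋

congᵇ : ℕ → ℤ → ℤ → Bool
congᵇ n a b = n ∣ᵇ ∣ a ℤ.- b ∣

Vecℤ : ℕ → Set
Vecℤ N = Fin N → ℤ

_⊕_ : ∀ {N} → Vecℤ N → Vecℤ N → Vecℤ N
(x ⊕ y) j = x j ℤ.+ y j

_⊖_ : ∀ {N} → Vecℤ N → Vecℤ N → Vecℤ N
(x ⊖ y) j = x j ℤ.- y j

_·_ : ∀ {N} → ℤ → Vecℤ N → Vecℤ N
(c · x) j = c ℤ.* x j

zeroV : ∀ {N} → Vecℤ N
zeroV j = + 0

sumFin : ∀ {N} (r : ℕ) → (Fin r → Vecℤ N) → Vecℤ N
sumFin zero    g = zeroV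
sumFin (suc r) g = g Fin.zero ⊕ sumFin r (λ i → g (Fin.suc i))

sumList : ∀ {N} → List (Vecℤ N) → Vecℤ N
sumList []       = zeroV
sumList (x ∷ xs) = x ⊕ sumList xs

InSpan : ∀ {N} (r : ℕ) → (Fin r → Vecℤ N) → Vecℤ N → Set
InSpan {N} r g x = Σ (Fin r → ℤ) λ c → ∀ j → x j ≡ sumFin r (λ i → c i · g i) j

-- Subquotients A/B of ℤ^N (A, B subgroups, B ⊆ A) and group isomorphism

record SubQuot : Set₁ where
  field
    dim : ℕ
    inA : Vecℤ dim → Set
    inB : Vecℤ dim → Set

record _≅_ (G H : SubQuot) : Set where
  private
    module G = SubQuot G
    module H = SubQuot H
  field
    φ     : (x : Vecℤ G.dim) → G.inA x → Vecℤ H.dim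
    into  : ∀ x (p : G.inA x) → H.inA (φ x p)
    wd    : ∀ x y (p : G.inA x) (q : G.inA y) → G.inB (x ⊖ y) → H.inB (φ x p ⊖ φ y q)
    hom   : ∀ x y (p : G.inA x) (q : G.inA y) (r : G.inA (x ⊕ y)) →
            H.inB (φ (x ⊕ y) r ⊖ (φ x p ⊕ φ y q))
    inj   : ∀ x y (p : G.inA x) (q : G.inA y) → H.inB (φ x p ⊖ φ y q) → G.inB (x ⊖ y)
    surj  : ∀ y → H.inA y → Σ (Vecℤ G.dim) λ x → Σ (G.inA x) λ p → H.inB (φ x p ⊖ y)

-- ⊕_i ℤ_{m_i} for a list of moduli m_i  (ℤ_1 = 0, ℤ_0 = ℤ)
CyclicSum : List ℕ → SubQuot
CyclicSum ms = record
  { dim = length ms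
  ; inA = λ _ → Data.Unit.⊤
  ; inB = λ x → ∀ i → lookup ms i ℕD.∣ ∣ x i ∣
  }
  where open import Data.List using (lookup)
        import Data.Unit

-- The ring ℤ[x]/(x^n - 1) ⊆ ℚ[x]/(x^n - 1): coefficient vectors Fin n → ℤ

mono : (n : ℕ) → ℤ → Vecℤ n
mono n a j = if congᵇ n a (+ toℕ j) then + 1 else + 0

eV : (n : ℕ) → ℤ → Vecℤ n
eV n v = mono n v ⊖ mono n (+ 0)

εV : (n : ℕ) → ℤ → ℤ → Vecℤ n
εV n d v = (d · eV n v) ⊖ eV n (d ℤ.* v)

-- f_v = d x^v - x^{dv}(x^d - 1)/(x - 1), written out as in the paper
fV : (n : ℕ) → ℤ → ℤ → Vecℤ n
fV n (+ D)      v = ((+ D) · mono n v) ⊖ sumList (applyUpTo (λ i → mono n (+ D ℤ.* v ℤ.+ + i)) D)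
fV n d@(ℤ.-[1+ D' ]) v =
  (d · mono n v) ⊕ sumList (applyUpTo (λ i → mono n (d ℤ.* (v ℤ.+ + 1) ℤ.+ + i)) (suc D'))

idx : ∀ {n} → Fin (n ℕ.∸ 1) → ℤ
idx i = + suc (toℕ i)

InZ : (n : ℕ) → Vecℤ n → Set
InZ n = InSpan (n ℕ.∸ 1) (λ i → eV n (idx {n} i))

SandDune : ℕ → ℤ → SubQuot
SandDune n d = record
  { dim = n ; inA = InZ n ; inB = InSpan (n ℕ.∸ 1) (λ i → εV n d (idx {n} i)) }

SGroup : ℕ → ℤ → SubQuot
SGroup n d = record
  { dim = n ; inA = InZ n ; inB = InSpan (n ℕ.∸ 1) (λ i → fV n d (idx {n} i)) }

-- Digraphs on ℤ_n given by their out-arc lists (targets as integers mod n)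

Digraph : ℕ → Set
Digraph n = Fin n → List ℤ

DB : (n d : ℕ) → Digraph n
DB n d v = applyUpTo (λ i → + d ℤ.* + toℕ v ℤ.+ + i) d

Ktz : (n d : ℕ) → Digraph n
Ktz n d v = applyUpTo (λ i → ℤ.- (+ d) ℤ.* (+ toℕ v ℤ.+ + 1) ℤ.+ + i) d

Laplacian : ∀ {n} → Digraph n → Fin n → Fin n → ℤ
Laplacian {n} G v w =
  (+ length (G v) ℤ.* mono n (+ toℕ v) w) ℤ.- sumList (map (mono n) (G v)) w

-- sandpile group: torsion subgroup of ℤ^{n-1} / ℤ^{n-1} Δ_v
Sandpile : (n : ℕ) → Digraph n → Fin n → SubQuot
Sandpile (suc n') G v = record
  { dim = n'
  ; inA = λ x → Σ ℕ λ c → (1 ≤ c) × Rows ((+ c) · x)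
  ; inB = Rows
  }
  where
    Δv : Fin n' → Fin n' → ℤ
    Δv i j = Laplacian G (punchIn v i) (punchIn v j)
    Rows : Vecℤ n' → Set
    Rows = InSpan n' Δv

nSeq : ℕ → ℕ → ℕ → ℕ
dSeq : ℕ → ℕ → ℕ → ℕ
nSeq n D zero    = n
nSeq n D (suc i) = nSeq n D i div dSeq n D i
dSeq n D i = gcd (nSeq n D i) D

SameOrbit : ℕ → ℤ → ℕ → ℕ → Set
SameOrbit m d v w = Σ ℕ λ t → (+ m) ℤD.∣ ((d ℤ.^ t) ℤ.* + v ℤ.- + w)

IsOrbitSize : ℕ → ℤ → ℕ → ℕ → Set
IsOrbitSize m d v o =
  (1 ≤ o) × ((+ m) ℤD.∣ ((d ℤ.^ o) ℤ.* + v ℤ.- + v)) ×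
  (∀ t → 1 ≤ t → t < o → ¬ ((+ m) ℤD.∣ ((d ℤ.^ t) ℤ.* + v ℤ.- + v)))

IsRepSet : ℕ → ℤ → List ℕ → Set
IsRepSet m d 𝒱 =
  All (λ v → (1 ≤ v) × (v < m)) 𝒱 ×
  (∀ w → 1 ≤ w → w < m → Σ ℕ λ v → (v ∈ 𝒱) × SameOrbit m d v w) ×
  AllPairs (λ v w → ¬ SameOrbit m d v w) 𝒱 ×
  (∀ p j → Prime p → p ℕD.∣ m → 1 ≤ j → (p ℕ.^ j) ℕD.∣ m →
     Σ ℕ λ v → (v ∈ 𝒱) × (v ℕ.* (p ℕ.^ j) ≡ m))

-- largest power of p dividing m (m ≥ 1, p ≥ 2): gcd(m, p^m), as ν_p(m) ≤ m
πp : ℕ → ℕ → ℕ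
πp p m = gcd m (p ℕ.^ m)

d≡1mod4 : ℤ → Bool
d≡1mod4 d = congᵇ 4 d (+ 1)

d≡3mod4 : ℤ → Bool
d≡3mod4 d = congᵇ 4 d (+ 3)

-- search for a prime p ∣ m with v = m / π_p(m) (such p is unique)
primeCase : ℕ → ℤ → ℕ → List ℕ → Maybe ℕ
primeCase m d v [] = nothing
primeCase m d v (p ∷ ps) =
  if ⌊ prime? p ⌋ ∧ (p ∣ᵇ m) ∧ ⌊ v ℕ.* πp p m ℕ.≟ m ⌋
  then (if not ⌊ p ℕ.≟ 2 ⌋ ∨ d≡1mod4 d ∨ not (4 ∣ᵇ m) then just (πp p m)
        else if d≡3mod4 d ∧ (4 ∣ᵇ m) then just (πp 2 m div 2)
        else nothing)
  else primeCase m d v ps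

cOf : ℕ → ℤ → ℕ → ℕ
cOf m d v =
  maybe (λ c → c)
        (if ⌊ v ℕ.* 2 ℕ.≟ m ⌋ ∧ (4 ∣ᵇ m) ∧ d≡3mod4 d then 2 else 1)
        (primeCase m d v (upTo (suc m)))

ΣModuli : (n : ℕ) (d : ℤ) (k : ℕ) (o : ℕ → ℕ) (𝒱 : List ℕ) → List ℕ
ΣModuli n d k o 𝒱 =
  concat (applyUpTo (λ i → replicate (nSeq n D i ℕ.+ nSeq n D (suc (suc i)) ℕ.∸ 2 ℕ.* nSeq n D (suc i))
                                     (D ℕ.^ suc i)) k)
  ++ map (λ v → ∣ d ℤ.^ o v ℤ.- + 1 ∣) 𝒱
  where D = ∣ d ∣

SModuli : (n : ℕ) (d : ℤ) (k : ℕ) (o : ℕ → ℕ) (𝒱 : List ℕ) → List ℕ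
SModuli n d k o 𝒱 =
  concat (applyUpTo (λ i → (D ℕ.^ suc i) div dSeq n D i ∷
            replicate (nSeq n D i ℕ.+ nSeq n D (suc (suc i)) ℕ.∸ (2 ℕ.* nSeq n D (suc i) ℕ.+ 1))
                      (D ℕ.^ suc i)) k)
  ++ map (λ v → ∣ d ℤ.^ o v ℤ.- + 1 ∣ div cOf (nSeq n D k) d v) 𝒱
  where D = ∣ d ∣

{-# OPTIONS --safe #-}
-- Σ(n,d) is presented by generators e_v (v ∈ ℤ, period n) with e_0 = 0 and d e_v = e_{dv}. Multiplication by x - 1
-- identifies S(n,d) with the kernel of ψ : Σ(n,d) → ℤ_n, e_v ↦ v, and the reduced Laplacian rows are the f_v up to sign.
--
-- Read all these presentations on the same formal combinations of symbols e_v. Then d y = 0 in Σ(n,d) iff y = 0 in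
-- Σ(n₁,d), and the d-torsion of Σ(n,d) is generated modulo d Σ(n,d) by differences e_w - e_{r(w)}, where w runs over the
-- residues outside dℤ_n except one in each class modulo n₁ that misses dℤ_n. So a basis for Σ(n₁,d) becomes one for
-- Σ(n,d) when the orders of its d-primary members are multiplied by d and these differences, of order d, are added.
-- They can be corrected so that ψ vanishes on all but one of them, X_i with ψ(X_i) = n_{i+1}; then d_i X_i - X_{i-1},
-- of order |d|^{i+1}/d_i, replace the X_i in ker ψ.
--
-- For gcd(m,d) = 1 the e_v with v ∈ 𝒱 form a basis with orders d^{o(v)} - 1. By lifting the exponent, every e_v can be
-- corrected by multiples of the e_{m/π_p(m)} to have ψ = 0 without changing its order, unless p = 2, 4 ∣ m,
-- d ≡ 3 (mod 4), where e_{m/2} is needed as well.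

module Submission where

open import Defs
open import Data.Bool using (Bool; true; false; if_then_else_; _∧_; _∨_; not)
open import Data.Empty using (⊥; ⊥-elim)
open import Data.Fin as Fin using (Fin; toℕ; fromℕ<; punchIn; punchOut)
open import Data.Fin.Patterns using (0F; 1F; 2F; 3F)
open import Data.Fin.Properties using (toℕ<n; toℕ-fromℕ<; toℕ-injective; punchIn-injective; punchInᵢ≢i; punchIn-punchOut)
open import Data.Integer as ℤ using (ℤ; +_; -[1+_]; _+_; _*_; _-_; -_; ∣_∣; _^_)
open import Data.Integer.DivMod using (_%ℕ_; _/ℕ_; n%ℕd<d; a≡a%ℕn+[a/ℕn]*n)
open import Data.Integer.Divisibility.Signed
import Data.Integer.Properties as ℤP
open import Data.Integer.Tactic.RingSolver using (solve-∀)
open import Data.List as List using (List; upTo; applyUpTo; filter; length; concat; replicate; _++_)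
open import Data.List.Membership.Propositional using (_∈_)
open import Data.List.Membership.Propositional.Properties using (∈-upTo⁺; ∈-upTo⁻; ∈-filter⁺; ∈-filter⁻; ∈-map⁺; ∈-map⁻; ∈-++⁺ˡ; ∈-++⁺ʳ; ∈-++⁻; ∈-lookup)
open import Data.List.Membership.Propositional.Properties.WithK using (unique∧set⇒bag)
open import Data.List.Properties using (length-++; length-map; length-upTo; length-applyUpTo; map-applyUpTo; tabulate-lookup; map-tabulate; tabulate-cong)
open import Data.List.Relation.Binary.BagAndSetEquality using (∼bag⇒↭)
open import Data.List.Relation.Binary.Permutation.Propositional.Properties using (↭-length)
open import Data.List.Relation.Unary.All as All using (All)
open import Data.List.Relation.Unary.AllPairs as AllPairs using ([]; _∷_)
open import Data.List.Relation.Unary.Any using (here; there; index)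
open import Data.List.Relation.Unary.Any.Properties using (lookup-index)
open import Data.List.Relation.Unary.Unique.Propositional using (Unique)
import Data.List.Relation.Unary.Unique.Propositional.Properties as Uniqueₚ
open import Data.Maybe using (Maybe; just; nothing; maybe)
open import Data.Nat as ℕ using (ℕ; zero; suc; _≤_; _<_)
import Data.Nat.DivMod as ℕM
import Data.Nat.Divisibility as ℕD
open import Data.Nat.GCD using (gcd; gcd-greatest; gcd-GCD; gcd[m,n]∣m; gcd[m,n]∣n; module Bézout)
open import Data.Nat.Primality using (Prime; prime?; prime[2]; prime⇒irreducible; prime⇒nonTrivial; prime⇒nonZero; euclidsLemma)
open import Data.Nat.Primality.Factorisation using (factorise; module PrimeFactorisation)
import Data.Nat.Properties as ℕP
open import Data.Product using (Σ; _×_; _,_; proj₁; proj₂)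
open import Data.Sum using (_⊎_; inj₁; inj₂; [_,_])
open import Data.Unit using (⊤; tt)
open import Data.Vec using (lookup; []; _∷_)
open import Function using (_∘_; id)
open import Function.Bundles using (mk⇔)
open import Relation.Binary using (Setoid)
open import Relation.Binary.Definitions using (tri<; tri≈; tri>)
open import Relation.Binary.PropositionalEquality hiding ([_])
import Relation.Binary.Reasoning.Setoid as SetoidReasoning
open import Relation.Nullary using (¬_; Dec; yes; no; ¬?; _×-dec_; ⌊_⌋)

-- Equalities in these presentations are derived from the relations; inequalities are certified by
-- functionals, integer values on the symbols `e v` that respect the relations modulo some M. Three
-- kinds suffice: the indicator of a residue outside dℤ_n, modulo d; the position in an orbit,
-- modulo d^o - 1; and the coordinates in a basis of Σ(n₁,d), which lift to Σ(n,d) with the modulus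
-- multiplied by d. The last kind is why d y = 0 in Σ(n,d) forces y = 0 in Σ(n₁,d). A basis passes
-- to ker ψ by multiplying each member by the least factor that kills its weight, which is
-- legitimate only if the weights are independent. The corrections achieve this unless 4 ∣ m and d ≡
-- 3 (mod 4): then e_{m/2} and π_2(m)/2 times e_{m/π_2(m)} both have weight m/2. Adding an odd
-- multiple of the former to the latter kills one of these weights modulo m, and only the other
-- member has to be doubled. Hence the exponents π_2(m)/2 and 2 instead of π_2(m) and 1.

∣-resp : ∀ {m a b} → a ≡ b → m ∣ a → m ∣ b
∣-resp refl p = p

∣-zero : ∀ {m} → m ∣ + 0
∣-zero = divides (+ 0) refl

-- Formal combinations and finite sums

infixr 6 _⊞_
infixr 7 _•_

data Tm (A : Set) : Set where
  e   : A → Tm A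
  𝟘   : Tm A
  _⊞_ : Tm A → Tm A → Tm A
  _•_ : ℤ → Tm A → Tm A

infixl 6 _⊟_
_⊟_ : ∀ {A} → Tm A → Tm A → Tm A
x ⊟ y = x ⊞ (- + 1) • y

ev : ∀ {A} → (A → ℤ) → Tm A → ℤ
ev f (e v)   = f v
ev f 𝟘       = + 0
ev f (x ⊞ y) = ev f x + ev f y
ev f (a • x) = a * ev f x

bind : ∀ {A B} → (A → Tm B) → Tm A → Tm B
bind ρ (e v)   = ρ v
bind ρ 𝟘       = 𝟘
bind ρ (x ⊞ y) = bind ρ x ⊞ bind ρ y
bind ρ (a • x) = a • bind ρ x

infixr 5 _⊎ᵤ_
-- Bases of towers are indexed by nested disjoint unions. With this universe of index types a sum
-- over a disjoint union splits by definition, and positions in a single list are needed only when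
-- the moduli are compared with those of the statement.
data U : Set where
  fin  : ℕ → U
  _⊎ᵤ_ : U → U → U

⟦_⟧ : U → Set
⟦ fin n ⟧  = Fin n
⟦ u ⊎ᵤ w ⟧ = ⟦ u ⟧ ⊎ ⟦ w ⟧

sumU : (u : U) → (⟦ u ⟧ → ℤ) → ℤ
sumU (fin zero)    f = + 0
sumU (fin (suc n)) f = f Fin.zero + sumU (fin n) (f ∘ Fin.suc)
sumU (u ⊎ᵤ w)      f = sumU u (f ∘ inj₁) + sumU w (f ∘ inj₂)

lin : ∀ {A} (u : U) → (⟦ u ⟧ → ℤ) → (⟦ u ⟧ → Tm A) → Tm A
lin (fin zero)    a g = 𝟘
lin (fin (suc n)) a g = a Fin.zero • g Fin.zero ⊞ lin (fin n) (a ∘ Fin.suc) (g ∘ Fin.suc)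
lin (u ⊎ᵤ w)      a g = lin u (a ∘ inj₁) (g ∘ inj₁) ⊞ lin w (a ∘ inj₂) (g ∘ inj₂)

ev-lin : ∀ {A} (f : A → ℤ) u a g → ev f (lin u a g) ≡ sumU u (λ i → a i * ev f (g i))
ev-lin f (fin zero)    a g = refl
ev-lin f (fin (suc n)) a g = cong (λ s → a Fin.zero * ev f (g Fin.zero) + s) (ev-lin f (fin n) _ _)
ev-lin f (u ⊎ᵤ w)      a g = cong₂ _+_ (ev-lin f u _ _) (ev-lin f w _ _)

_≟ᵤ_ : ∀ {u} (i j : ⟦ u ⟧) → Dec (i ≡ j)
_≟ᵤ_ {fin n} i j = i Fin.≟ j
_≟ᵤ_ {u ⊎ᵤ w} (inj₁ i) (inj₁ j) with i ≟ᵤ j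
... | yes refl = yes refl
... | no ¬p = no λ where refl → ¬p refl
_≟ᵤ_ {u ⊎ᵤ w} (inj₁ i) (inj₂ j) = no λ ()
_≟ᵤ_ {u ⊎ᵤ w} (inj₂ i) (inj₁ j) = no λ ()
_≟ᵤ_ {u ⊎ᵤ w} (inj₂ i) (inj₂ j) with i ≟ᵤ j
... | yes refl = yes refl
... | no ¬p = no λ where refl → ¬p refl

sumU-∣ : ∀ u {m} f → (∀ i → m ∣ f i) → m ∣ sumU u f
sumU-∣ (fin zero)    f p = ∣-zero
sumU-∣ (fin (suc n)) f p = ∣m∣n⇒∣m+n (p Fin.zero) (sumU-∣ (fin n) _ (p ∘ Fin.suc))
sumU-∣ (u ⊎ᵤ w)      f p = ∣m∣n⇒∣m+n (sumU-∣ u _ (p ∘ inj₁)) (sumU-∣ w _ (p ∘ inj₂))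

private
  shuffleˡ : ∀ a b c → (a + b) - c ≡ (a - c) + b
  shuffleˡ = solve-∀
  shuffleʳ : ∀ a b c → (a + b) - c ≡ a + (b - c)
  shuffleʳ = solve-∀
  +-cancel : ∀ a b → (a + b) - a ≡ b
  +-cancel = solve-∀

-- The modulus lets one statement serve congruences and, with m = 0, equalities.
sumU-single : ∀ u {m} f (j : ⟦ u ⟧) → (∀ i → i ≢ j → m ∣ f i) → m ∣ sumU u f - f j
sumU-single (fin (suc n)) f Fin.zero p =
  ∣-resp (sym (+-cancel (f Fin.zero) _)) (sumU-∣ (fin n) _ λ i → p (Fin.suc i) λ ())
sumU-single (fin (suc n)) f (Fin.suc j) p =
  ∣-resp (sym (shuffleʳ (f Fin.zero) _ _))
    (∣m∣n⇒∣m+n (p Fin.zero λ ()) (sumU-single (fin n) _ j λ i i≢j → p (Fin.suc i) λ where refl → i≢j refl))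
sumU-single (u ⊎ᵤ w) f (inj₁ j) p =
  ∣-resp (sym (shuffleˡ (sumU u _) _ _))
    (∣m∣n⇒∣m+n (sumU-single u _ j λ i i≢j → p (inj₁ i) λ where refl → i≢j refl) (sumU-∣ w _ λ i → p (inj₂ i) λ ()))
sumU-single (u ⊎ᵤ w) f (inj₂ j) p =
  ∣-resp (sym (shuffleʳ (sumU u _) _ _))
    (∣m∣n⇒∣m+n (sumU-∣ u _ λ i → p (inj₁ i) λ ()) (sumU-single w _ j λ i i≢j → p (inj₂ i) λ where refl → i≢j refl))

δ : ∀ {u} → ⟦ u ⟧ → ⟦ u ⟧ → ℤ
δ j i with i ≟ᵤ j
... | yes _ = + 1
... | no  _ = + 0

-- The field `ext` stands in for function extensionality: vectors are functions and are compared
-- pointwise.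
record Subgroup (J : Set) : Set₁ where
  field
    Mem   : (J → ℤ) → Set
    ext   : ∀ {x y} → (∀ j → x j ≡ y j) → Mem x → Mem y
    zero∈ : Mem (λ _ → + 0)
    add∈  : ∀ {x y} → Mem x → Mem y → Mem (λ j → x j + y j)
    scale∈ : ∀ a {x} → Mem x → Mem (λ j → a * x j)

multiplesOf : ℤ → Subgroup ⊤
multiplesOf m = record
  { Mem    = λ x → m ∣ x tt
  ; ext    = λ eq → ∣-resp (eq tt)
  ; zero∈  = ∣-zero
  ; add∈   = ∣m∣n⇒∣m+n
  ; scale∈ = λ a → ∣n⇒∣m*n a
  }

-- The presentation of Σ(n,d) and its homomorphisms

T : Set
T = Tm ℤ

module Dune (d : ℤ) where

  infix 4 _⊢_≈_
  data _⊢_≈_ (n : ℕ) : T → T → Set where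
    ≈refl  : ∀ {x} → n ⊢ x ≈ x
    ≈sym   : ∀ {x y} → n ⊢ x ≈ y → n ⊢ y ≈ x
    ≈trans : ∀ {x y z} → n ⊢ x ≈ y → n ⊢ y ≈ z → n ⊢ x ≈ z
    ⊞-cong : ∀ {x x′ y y′} → n ⊢ x ≈ x′ → n ⊢ y ≈ y′ → n ⊢ x ⊞ y ≈ x′ ⊞ y′
    •-cong : ∀ {x y} a → n ⊢ x ≈ y → n ⊢ a • x ≈ a • y
    ⊞-assoc : ∀ x y z → n ⊢ (x ⊞ y) ⊞ z ≈ x ⊞ (y ⊞ z)
    ⊞-comm  : ∀ x y → n ⊢ x ⊞ y ≈ y ⊞ x
    ⊞-idˡ   : ∀ x → n ⊢ 𝟘 ⊞ x ≈ x
    •-distribˡ : ∀ a x y → n ⊢ a • (x ⊞ y) ≈ a • x ⊞ a • y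
    •-distribʳ : ∀ a b x → n ⊢ (a + b) • x ≈ a • x ⊞ b • x
    •-assoc : ∀ a b x → n ⊢ (a * b) • x ≈ a • b • x
    •-one   : ∀ x → n ⊢ (+ 1) • x ≈ x
    •-zero  : ∀ x → n ⊢ (+ 0) • x ≈ 𝟘
    periodic : ∀ v w → + n ∣ v - w → n ⊢ e v ≈ e w
    e-zero   : n ⊢ e (+ 0) ≈ 𝟘
    e-scale  : ∀ v → n ⊢ d • e v ≈ e (d * v)

  ≈-setoid : ℕ → Setoid _ _
  ≈-setoid n = record
    { Carrier = T ; _≈_ = n ⊢_≈_
    ; isEquivalence = record { refl = ≈refl ; sym = ≈sym ; trans = ≈trans } }

  module ≈-Reasoning (n : ℕ) = SetoidReasoning (≈-setoid n)

  ≡⇒≈ : ∀ {n x y} → x ≡ y → n ⊢ x ≈ y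
  ≡⇒≈ refl = ≈refl

  -- The universal property of the presentation: values `F v` that satisfy the three relations on
  -- symbols modulo `B` define a homomorphism on Σ(n,d). Every conclusion about integers that is
  -- drawn from a derivation of `≈` passes through it.
  module Evaluate {J : Set} (B : Subgroup J) (n : ℕ) (F : ℤ → J → ℤ) where
    open Subgroup B
    module _
      (F-periodic : ∀ v w → + n ∣ v - w → Mem (λ j → F v j - F w j))
      (F-zero     : Mem (F (+ 0)))
      (F-scale    : ∀ v → Mem (λ j → d * F v j - F (d * v) j)) where
      private
        E : T → J → ℤ
        E x j = ev (λ v → F v j) x
        by : ∀ {x} → (∀ j → x j ≡ + 0) → Mem x
        by p = ext (sym ∘ p) zero∈
      ev-cong : ∀ {x y} → n ⊢ x ≈ y → Mem (λ j → E x j - E y j)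
      ev-cong {x} ≈refl = by λ j → ℤP.+-inverseʳ (E x j)
      ev-cong {x} {y} (≈sym p) = ext (λ j → lem (E x j) (E y j)) (scale∈ (- + 1) (ev-cong p))
        where lem : ∀ a b → (- + 1) * (b - a) ≡ a - b
              lem = solve-∀
      ev-cong {x} {z} (≈trans {y = y} p q) = ext (λ j → lem (E x j) (E y j) (E z j)) (add∈ (ev-cong p) (ev-cong q))
        where lem : ∀ a b c → (a - b) + (b - c) ≡ a - c
              lem = solve-∀
      ev-cong (⊞-cong {x} {x′} {y} {y′} p q) =
        ext (λ j → lem (E x j) (E x′ j) (E y j) (E y′ j)) (add∈ (ev-cong p) (ev-cong q))
        where lem : ∀ a b c f → (a - b) + (c - f) ≡ (a + c) - (b + f)
              lem = solve-∀
      ev-cong (•-cong {x} {y} a p) = ext (λ j → lem a (E x j) (E y j)) (scale∈ a (ev-cong p))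
        where lem : ∀ a b c → a * (b - c) ≡ a * b - a * c
              lem = solve-∀
      ev-cong (⊞-assoc x y z) = by λ j → lem (E x j) (E y j) (E z j)
        where lem : ∀ a b c → ((a + b) + c) - (a + (b + c)) ≡ + 0
              lem = solve-∀
      ev-cong (⊞-comm x y) = by λ j → lem (E x j) (E y j)
        where lem : ∀ a b → (a + b) - (b + a) ≡ + 0
              lem = solve-∀
      ev-cong (⊞-idˡ x) = by λ j → lem (E x j)
        where lem : ∀ a → (+ 0 + a) - a ≡ + 0
              lem = solve-∀
      ev-cong (•-distribˡ a x y) = by λ j → lem a (E x j) (E y j)
        where lem : ∀ a b c → a * (b + c) - (a * b + a * c) ≡ + 0
              lem = solve-∀
      ev-cong (•-distribʳ a b x) = by λ j → lem a b (E x j)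
        where lem : ∀ a b c → (a + b) * c - (a * c + b * c) ≡ + 0
              lem = solve-∀
      ev-cong (•-assoc a b x) = by λ j → lem a b (E x j)
        where lem : ∀ a b c → a * b * c - a * (b * c) ≡ + 0
              lem = solve-∀
      ev-cong (•-one x) = by λ j → lem (E x j)
        where lem : ∀ a → + 1 * a - a ≡ + 0
              lem = solve-∀
      ev-cong (•-zero x) = by λ j → lem (E x j)
        where lem : ∀ a → + 0 * a - + 0 ≡ + 0
              lem = solve-∀
      ev-cong (periodic v w p) = F-periodic v w p
      ev-cong e-zero = ext (λ j → sym (ℤP.+-identityʳ _)) F-zero
      ev-cong (e-scale v) = F-scale v

  module ModuleSolver (n : ℕ) where
    open ≈-Reasoning n

    ⊞-idʳ : ∀ x → n ⊢ x ⊞ 𝟘 ≈ x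
    ⊞-idʳ x = ≈trans (⊞-comm x 𝟘) (⊞-idˡ x)

    •-𝟘 : ∀ a → n ⊢ a • 𝟘 ≈ 𝟘
    •-𝟘 a = begin
      a • 𝟘           ≈⟨ •-cong a (•-zero 𝟘) ⟨
      a • (+ 0) • 𝟘   ≈⟨ •-assoc a (+ 0) 𝟘 ⟨
      (a * + 0) • 𝟘   ≡⟨ cong (_• 𝟘) (ℤP.*-zeroʳ a) ⟩
      (+ 0) • 𝟘       ≈⟨ •-zero 𝟘 ⟩
      𝟘 ∎

    ⊞-interchange : ∀ a b c f → n ⊢ (a ⊞ b) ⊞ (c ⊞ f) ≈ (a ⊞ c) ⊞ (b ⊞ f)
    ⊞-interchange a b c f = begin
      (a ⊞ b) ⊞ (c ⊞ f)   ≈⟨ ⊞-assoc a b (c ⊞ f) ⟩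
      a ⊞ (b ⊞ (c ⊞ f))   ≈⟨ ⊞-cong ≈refl (⊞-assoc b c f) ⟨
      a ⊞ ((b ⊞ c) ⊞ f)   ≈⟨ ⊞-cong ≈refl (⊞-cong (⊞-comm b c) ≈refl) ⟩
      a ⊞ ((c ⊞ b) ⊞ f)   ≈⟨ ⊞-cong ≈refl (⊞-assoc c b f) ⟩
      a ⊞ (c ⊞ (b ⊞ f))   ≈⟨ ⊞-assoc a c (b ⊞ f) ⟨
      (a ⊞ c) ⊞ (b ⊞ f) ∎

    lin-coeff : ∀ u {a b} g → (∀ i → a i ≡ b i) → n ⊢ lin u a g ≈ lin u b g
    lin-coeff (fin zero)    g p = ≈refl
    lin-coeff (fin (suc k)) g p = ⊞-cong (≡⇒≈ (cong (_• g Fin.zero) (p Fin.zero))) (lin-coeff (fin k) _ (p ∘ Fin.suc))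
    lin-coeff (u ⊎ᵤ w)      g p = ⊞-cong (lin-coeff u _ (p ∘ inj₁)) (lin-coeff w _ (p ∘ inj₂))

    lin-cong : ∀ u a {g h} → (∀ i → n ⊢ g i ≈ h i) → n ⊢ lin u a g ≈ lin u a h
    lin-cong (fin zero)    a p = ≈refl
    lin-cong (fin (suc k)) a p = ⊞-cong (•-cong _ (p Fin.zero)) (lin-cong (fin k) _ (p ∘ Fin.suc))
    lin-cong (u ⊎ᵤ w)      a p = ⊞-cong (lin-cong u _ (p ∘ inj₁)) (lin-cong w _ (p ∘ inj₂))

    lin-zero : ∀ u a g → (∀ i → n ⊢ a i • g i ≈ 𝟘) → n ⊢ lin u a g ≈ 𝟘
    lin-zero (fin zero)    a g p = ≈refl
    lin-zero (fin (suc k)) a g p = ≈trans (⊞-cong (p Fin.zero) (lin-zero (fin k) _ _ (p ∘ Fin.suc))) (⊞-idˡ 𝟘)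
    lin-zero (u ⊎ᵤ w)      a g p = ≈trans (⊞-cong (lin-zero u _ _ (p ∘ inj₁)) (lin-zero w _ _ (p ∘ inj₂))) (⊞-idˡ 𝟘)

    lin-add : ∀ u a b g → n ⊢ lin u (λ i → a i + b i) g ≈ lin u a g ⊞ lin u b g
    lin-add (fin zero)    a b g = ≈sym (⊞-idˡ 𝟘)
    lin-add (fin (suc k)) a b g =
      ≈trans (⊞-cong (•-distribʳ _ _ _) (lin-add (fin k) _ _ _)) (⊞-interchange _ _ _ _)
    lin-add (u ⊎ᵤ w)      a b g = ≈trans (⊞-cong (lin-add u _ _ _) (lin-add w _ _ _)) (⊞-interchange _ _ _ _)

    lin-scale : ∀ u c a g → n ⊢ lin u (λ i → c * a i) g ≈ c • lin u a g
    lin-scale (fin zero)    c a g = ≈sym (•-𝟘 c)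
    lin-scale (fin (suc k)) c a g =
      ≈trans (⊞-cong (•-assoc _ _ _) (lin-scale (fin k) c _ _)) (≈sym (•-distribˡ _ _ _))
    lin-scale (u ⊎ᵤ w)      c a g = ≈trans (⊞-cong (lin-scale u c _ _) (lin-scale w c _ _)) (≈sym (•-distribˡ _ _ _))

    lin-δ : ∀ u j g → n ⊢ lin u (δ j) g ≈ g j
    lin-δ (fin (suc k)) Fin.zero g = begin
      (+ 1) • g Fin.zero ⊞ lin (fin k) (λ i → + 0) (g ∘ Fin.suc)
        ≈⟨ ⊞-cong (•-one _) (lin-zero (fin k) _ _ λ i → •-zero _) ⟩
      g Fin.zero ⊞ 𝟘 ≈⟨ ⊞-idʳ _ ⟩
      g Fin.zero ∎
    lin-δ (fin (suc k)) (Fin.suc j) g = begin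
      (+ 0) • g Fin.zero ⊞ lin (fin k) (λ i → δ {fin (suc k)} (Fin.suc j) (Fin.suc i)) (g ∘ Fin.suc)
        ≈⟨ ⊞-cong (•-zero _) (≈trans (lin-coeff (fin k) _ shift) (lin-δ (fin k) j _)) ⟩
      𝟘 ⊞ g (Fin.suc j) ≈⟨ ⊞-idˡ _ ⟩
      g (Fin.suc j) ∎
      where
      shift : ∀ i → δ {fin (suc k)} (Fin.suc j) (Fin.suc i) ≡ δ {fin k} j i
      shift i with i Fin.≟ j
      ... | yes _ = refl
      ... | no  _ = refl
    lin-δ (u ⊎ᵤ w) (inj₁ j) g = begin
      lin u (λ i → δ {u ⊎ᵤ w} (inj₁ j) (inj₁ i)) (g ∘ inj₁) ⊞ lin w (λ i → + 0) (g ∘ inj₂)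
        ≈⟨ ⊞-cong (≈trans (lin-coeff u _ shift) (lin-δ u j _)) (lin-zero w _ _ λ i → •-zero _) ⟩
      g (inj₁ j) ⊞ 𝟘 ≈⟨ ⊞-idʳ _ ⟩
      g (inj₁ j) ∎
      where
      shift : ∀ i → δ {u ⊎ᵤ w} (inj₁ j) (inj₁ i) ≡ δ j i
      shift i with i ≟ᵤ j
      ... | yes refl = refl
      ... | no  _ = refl
    lin-δ (u ⊎ᵤ w) (inj₂ j) g = begin
      lin u (λ i → + 0) (g ∘ inj₁) ⊞ lin w (λ i → δ {u ⊎ᵤ w} (inj₂ j) (inj₂ i)) (g ∘ inj₂)
        ≈⟨ ⊞-cong (lin-zero u _ _ λ i → •-zero _) (≈trans (lin-coeff w _ shift) (lin-δ w j _)) ⟩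
      𝟘 ⊞ g (inj₂ j) ≈⟨ ⊞-idˡ _ ⟩
      g (inj₂ j) ∎
      where
      shift : ∀ i → δ {u ⊎ᵤ w} (inj₂ j) (inj₂ i) ≡ δ j i
      shift i with i ≟ᵤ j
      ... | yes refl = refl
      ... | no  _ = refl

    bind-normal : ∀ {k} (ρ : Fin k → T) (t : Tm (Fin k)) → n ⊢ bind ρ t ≈ lin (fin k) (λ i → ev (δ {fin k} i) t) ρ
    bind-normal ρ (e v) = ≈sym (≈trans (lin-coeff (fin _) ρ swap) (lin-δ (fin _) v ρ))
      where
      swap : ∀ i → δ {fin _} i v ≡ δ {fin _} v i
      swap i with v Fin.≟ i | i Fin.≟ v
      ... | yes _ | yes _ = refl
      ... | no  _ | no  _ = refl
      ... | yes refl | no ¬p with () ← ¬p refl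
      ... | no ¬p | yes refl with () ← ¬p refl
    bind-normal ρ 𝟘 = ≈sym (lin-zero (fin _) _ ρ λ i → •-zero _)
    bind-normal ρ (s ⊞ t) =
      ≈trans (⊞-cong (bind-normal ρ s) (bind-normal ρ t)) (≈sym (lin-add (fin _) _ _ ρ))
    bind-normal ρ (a • t) = ≈trans (•-cong a (bind-normal ρ t)) (≈sym (lin-scale (fin _) a _ ρ))

    -- A module identity holds formally once it holds with integers in place of the generators:
    -- `bind-normal` recovers the coefficient of the i-th generator as the value at the i-th unit
    -- vector. What remains is a ring identity for the solver.
    solveT : ∀ k (s t : Tm (Fin k)) (ρ : Fin k → T) →
             (∀ f → ev f s ≡ ev f t) → n ⊢ bind ρ s ≈ bind ρ t
    solveT k s t ρ p =
      ≈trans (bind-normal ρ s) (≈trans (lin-coeff (fin k) ρ (λ i → p _)) (≈sym (bind-normal ρ t)))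

    lin-lin : ∀ u w b (A : ⟦ w ⟧ → ⟦ u ⟧ → ℤ) g →
              n ⊢ lin w b (λ i → lin u (A i) g) ≈ lin u (λ j → sumU w (λ i → b i * A i j)) g
    lin-lin u (fin zero)    b A g = ≈sym (lin-zero u _ g λ i → •-zero _)
    lin-lin u (fin (suc k)) b A g =
      ≈trans (⊞-cong (≈sym (lin-scale u _ _ g)) (lin-lin u (fin k) _ _ g)) (≈sym (lin-add u _ _ g))
    lin-lin u (w ⊎ᵤ w′)     b A g =
      ≈trans (⊞-cong (lin-lin u w _ _ g) (lin-lin u w′ _ _ g)) (≈sym (lin-add u _ _ g))

    lin-⊞ : ∀ u a g h → n ⊢ lin u a (λ i → g i ⊞ h i) ≈ lin u a g ⊞ lin u a h
    lin-⊞ (fin zero)    a g h = ≈sym (⊞-idˡ 𝟘)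
    lin-⊞ (fin (suc k)) a g h =
      ≈trans (⊞-cong (•-distribˡ _ _ _) (lin-⊞ (fin k) _ _ _)) (⊞-interchange _ _ _ _)
    lin-⊞ (u ⊎ᵤ w)      a g h = ≈trans (⊞-cong (lin-⊞ u _ _ _) (lin-⊞ w _ _ _)) (⊞-interchange _ _ _ _)

    lin-• : ∀ u a (c : ⟦ u ⟧ → ℤ) g → n ⊢ lin u a (λ i → c i • g i) ≈ lin u (λ i → a i * c i) g
    lin-• (fin zero)    a c g = ≈refl
    lin-• (fin (suc k)) a c g = ⊞-cong (≈sym (•-assoc _ _ _)) (lin-• (fin k) _ _ _)
    lin-• (u ⊎ᵤ w)      a c g = ⊞-cong (lin-• u _ _ _) (lin-• w _ _ _)

ψ : T → ℤ
ψ = ev id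

sumU-zero : ∀ u f → (∀ i → f i ≡ + 0) → sumU u f ≡ + 0
sumU-zero (fin zero)    f p = refl
sumU-zero (fin (suc n)) f p = cong₂ _+_ (p Fin.zero) (sumU-zero (fin n) _ (p ∘ Fin.suc))
sumU-zero (u ⊎ᵤ w)      f p = cong₂ _+_ (sumU-zero u _ (p ∘ inj₁)) (sumU-zero w _ (p ∘ inj₂))

private
  interchange : ∀ a b c f → (a + b) + (c + f) ≡ (a + c) + (b + f)
  interchange = solve-∀

sumU-add : ∀ u f g → sumU u (λ i → f i + g i) ≡ sumU u f + sumU u g
sumU-add (fin zero)    f g = refl
sumU-add (fin (suc n)) f g = trans (cong (λ s → f Fin.zero + g Fin.zero + s) (sumU-add (fin n) _ _)) (interchange (f Fin.zero) _ _ _)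
sumU-add (u ⊎ᵤ w)      f g = trans (cong₂ _+_ (sumU-add u _ _) (sumU-add w _ _)) (interchange (sumU u _) _ _ _)

sumU-cong : ∀ u {f g} → (∀ i → f i ≡ g i) → sumU u f ≡ sumU u g
sumU-cong (fin zero)    p = refl
sumU-cong (fin (suc n)) p = cong₂ _+_ (p Fin.zero) (sumU-cong (fin n) (p ∘ Fin.suc))
sumU-cong (u ⊎ᵤ w)      p = cong₂ _+_ (sumU-cong u (p ∘ inj₁)) (sumU-cong w (p ∘ inj₂))

sumU-scale : ∀ u c f → sumU u (λ i → c * f i) ≡ c * sumU u f
sumU-scale (fin zero)    c f = sym (ℤP.*-zeroʳ c)
sumU-scale (fin (suc n)) c f =
  trans (cong (λ s → c * f Fin.zero + s) (sumU-scale (fin n) c _)) (sym (ℤP.*-distribˡ-+ c (f Fin.zero) _))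
sumU-scale (u ⊎ᵤ w)      c f =
  trans (cong₂ _+_ (sumU-scale u c _) (sumU-scale w c _)) (sym (ℤP.*-distribˡ-+ c (sumU u _) (sumU w _)))

∣-diff : ∀ {m a b} → m ∣ a - b → m ∣ b → m ∣ a
∣-diff {m} {a} {b} p q = ∣-resp (lem a b) (∣m∣n⇒∣m+n p q)
  where lem : ∀ a b → (a - b) + b ≡ a
        lem = solve-∀

∣-diff′ : ∀ {m a b} → m ∣ a - b → m ∣ a → m ∣ b
∣-diff′ {m} {a} {b} p q = ∣-resp (lem a b) (∣m∣n⇒∣m-n q p)
  where lem : ∀ a b → a - (a - b) ≡ b
        lem = solve-∀

-- Bases of the groups ℤ_{m₁} ⊕ ... ⊕ ℤ_{m_r} and their subgroups cut out by ψ

module Bases (d : ℤ) where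
  open Dune d

  ψ-cong : ∀ {n x y} → n ⊢ x ≈ y → + n ∣ ψ x - ψ y
  ψ-cong {n} = Evaluate.ev-cong (multiplesOf (+ n)) n (λ v _ → v)
    (λ v w p → p) ∣-zero (λ v → ∣-resp (sym (ℤP.+-inverseʳ (d * v))) ∣-zero)

  -- A decomposition into cyclic groups of the subgroup of Σ(n,d) on which N divides ψ: N = 1 gives
  -- all of Σ(n,d) and N = n gives ker ψ. The orders `M i` are integers up to sign, as d may be
  -- negative.
  record Basis (n : ℕ) (N : ℤ) (u : U) (g : ⟦ u ⟧ → T) (M : ⟦ u ⟧ → ℤ) : Set where
    field
      mem : ∀ i → N ∣ ψ (g i)
      ord : ∀ i → n ⊢ M i • g i ≈ 𝟘
      gen : ∀ y → N ∣ ψ y → Σ (⟦ u ⟧ → ℤ) λ a → n ⊢ y ≈ lin u a g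
      ind : ∀ a → n ⊢ lin u a g ≈ 𝟘 → ∀ i → M i ∣ a i

  ψ-lin-∣ : ∀ {N} u a g → (∀ i → N ∣ ψ (g i)) → N ∣ ψ (lin u a g)
  ψ-lin-∣ u a g p = ∣-resp (sym (ev-lin id u a g)) (sumU-∣ u _ λ i → ∣n⇒∣m*n (a i) (p i))

  -- Replacing g i by g i - Σ_j A i j g j is unimodular because two-step forces A² = 0.
  module _ {n N u} {g : ⟦ u ⟧ → T} {M : ⟦ u ⟧ → ℤ} (B : Basis n N u g M) (A : ⟦ u ⟧ → ⟦ u ⟧ → ℤ)
           (two-step : ∀ j → (∀ i → A i j ≡ + 0) ⊎ (∀ l → A j l ≡ + 0))
           (order : ∀ i j → M j ∣ M i * A i j) where
    open Basis B
    open ModuleSolver n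
    open ≈-Reasoning n

    changed : ⟦ u ⟧ → T
    changed i = g i ⊟ lin u (A i) g

    private
      S : (⟦ u ⟧ → ℤ) → ⟦ u ⟧ → ℤ
      S b j = sumU u (λ i → b i * A i j)

      lin-changed : ∀ b → n ⊢ lin u b changed ≈ lin u (λ j → b j + (- + 1) * S b j) g
      lin-changed b = begin
        lin u b changed
          ≈⟨ lin-⊞ u b g (λ i → (- + 1) • lin u (A i) g) ⟩
        lin u b g ⊞ lin u b (λ i → (- + 1) • lin u (A i) g)
          ≈⟨ ⊞-cong ≈refl (lin-cong u b (λ i → lin-scale u (- + 1) (A i) g)) ⟨
        lin u b g ⊞ lin u b (λ i → lin u (λ j → (- + 1) * A i j) g)
          ≈⟨ ⊞-cong ≈refl (lin-lin u u b (λ i j → (- + 1) * A i j) g) ⟩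
        lin u b g ⊞ lin u (λ j → sumU u (λ i → b i * ((- + 1) * A i j))) g
          ≈⟨ lin-add u b _ g ⟨
        lin u (λ j → b j + sumU u (λ i → b i * ((- + 1) * A i j))) g
          ≈⟨ lin-coeff u g (λ j → cong (λ s → b j + s)
               (trans (sumU-cong u (λ i → lem (b i) (A i j))) (sumU-scale u (- + 1) _))) ⟩
        lin u (λ j → b j + (- + 1) * S b j) g ∎
        where lem : ∀ b a → b * ((- + 1) * a) ≡ (- + 1) * (b * a)
              lem = solve-∀

      S-S : ∀ a j → S (S a) j ≡ + 0
      S-S a j = sumU-zero u _ each
        where
        each : ∀ i → S a i * A i j ≡ + 0
        each i with two-step i
        ... | inj₁ p = cong (_* A i j) (sumU-zero u _ λ l → trans (cong (a l *_) (p l)) (ℤP.*-zeroʳ (a l)))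
        ... | inj₂ p = trans (cong (S a i *_) (p j)) (ℤP.*-zeroʳ (S a i))

    changeBasis : (∀ i → N ∣ ψ (changed i)) → Basis n N u changed M
    changeBasis mem′ = record
      { mem = mem′
      ; ord = λ i → begin
          M i • changed i
            ≈⟨ solveT 2 (M i • (e 0F ⊟ e 1F)) (M i • e 0F ⊞ (- + 1) • M i • e 1F) (lookup (g i ∷ lin u (A i) g ∷ []))
                 (λ f → lem₁ (M i) (f 0F) (f 1F)) ⟩
          M i • g i ⊞ (- + 1) • M i • lin u (A i) g
            ≈⟨ ⊞-cong (ord i) (•-cong (- + 1) (≈trans (≈sym (lin-scale u (M i) (A i) g)) (lin-zero u _ g (kill i)))) ⟩
          𝟘 ⊞ (- + 1) • 𝟘  ≈⟨ ⊞-idˡ _ ⟩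
          (- + 1) • 𝟘      ≈⟨ •-𝟘 _ ⟩
          𝟘 ∎
      -- As A² = 0, the inverse of 1 - A is 1 + A.
      ; gen = λ y p → let (a , eq) = gen y p in
          (λ j → a j + S a j) , ≈trans eq (≈sym (≈trans (lin-changed _) (lin-coeff u g (λ j → undo a j))))
      ; ind = ind′
      }
      where
      lem₁ : ∀ m x y → m * (x + (- + 1) * y) ≡ m * x + (- + 1) * (m * y)
      lem₁ = solve-∀
      kill : ∀ i j → n ⊢ (M i * A i j) • g j ≈ 𝟘
      kill i j with order i j
      ... | divides q eq = begin
        (M i * A i j) • g j  ≡⟨ cong (_• g j) eq ⟩
        (q * M j) • g j      ≈⟨ •-assoc q (M j) (g j) ⟩
        q • M j • g j        ≈⟨ •-cong q (ord j) ⟩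
        q • 𝟘                ≈⟨ •-𝟘 q ⟩
        𝟘 ∎
      undo : ∀ a j → (a j + S a j) + (- + 1) * S (λ l → a l + S a l) j ≡ a j
      undo a j = trans (cong (λ s → (a j + S a j) + (- + 1) * s) split) (lem (a j) (S a j))
        where
        split : S (λ l → a l + S a l) j ≡ S a j + + 0
        split = trans (sumU-cong u (λ i → ℤP.*-distribʳ-+ (A i j) (a i) (S a i)))
                  (trans (sumU-add u _ _) (cong (λ s → S a j + s) (S-S a j)))
        lem : ∀ a s → (a + s) + (- + 1) * (s + + 0) ≡ a
        lem = solve-∀
      ind′ : ∀ a → n ⊢ lin u a changed ≈ 𝟘 → ∀ i → M i ∣ a i
      ind′ a eq = all
        where
        coeff : ∀ j → M j ∣ a j + (- + 1) * S a j
        coeff = ind _ (≈trans (≈sym (lin-changed a)) eq)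
        -- An index with zero column keeps its coefficient. An index whose column is nonzero has a
        -- zero row and contributes nothing to `S a`, so these divisibilities bound every term of
        -- `S a j`.
        column-zero : ∀ j → (∀ i → A i j ≡ + 0) → M j ∣ a j
        column-zero j p = ∣-resp (trans (cong (λ s → a j + (- + 1) * s)
          (sumU-zero u _ (λ i → trans (cong (a i *_) (p i)) (ℤP.*-zeroʳ (a i))))) (ℤP.+-identityʳ (a j))) (coeff j)
        row : ∀ j i → M j ∣ a i * A i j
        row j i with two-step i
        ... | inj₂ p = ∣-resp (sym (trans (cong (a i *_) (p j)) (ℤP.*-zeroʳ (a i)))) ∣-zero
        ... | inj₁ p with column-zero i p
        ...   | divides q eq′ = ∣-resp (sym (trans (cong (_* A i j) eq′) (ℤP.*-assoc q (M i) (A i j)))) (∣n⇒∣m*n q (order i j))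
        all : ∀ j → M j ∣ a j
        all j = ∣-resp (lem (a j) (S a j)) (∣m∣n⇒∣m+n (coeff j) (sumU-∣ u _ (row j)))
          where lem : ∀ a s → (a + (- + 1) * s) + s ≡ a
                lem = solve-∀

  module _ {n N N′ u} {g : ⟦ u ⟧ → T} {M : ⟦ u ⟧ → ℤ} (B : Basis n N u g M) (c M′ : ⟦ u ⟧ → ℤ) (split : ∀ i → M i ≡ c i * M′ i)
           (c≢0 : ∀ i → ℤ.NonZero (c i)) (N∣n : N′ ∣ + n) (N∣N′ : N ∣ N′)
           (mem′ : ∀ i → N′ ∣ c i * ψ (g i))
           (critical : ∀ (a : ⟦ u ⟧ → ℤ) → N′ ∣ sumU u (λ i → a i * ψ (g i)) → ∀ i → c i ∣ a i) where
    open Basis B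
    open ModuleSolver n
    open ≈-Reasoning n

    -- The premise `critical` expresses independence of the weights: a combination lies in the
    -- smaller subgroup only if each coefficient is a multiple of its `c i`. The subgroup is then
    -- the direct sum of the cyclic groups of the `c i • g i`.
    restrictBasis : Basis n N′ u (λ i → c i • g i) M′
    restrictBasis = record
      { mem = mem′
      ; ord = λ i → begin
          M′ i • c i • g i    ≈⟨ •-assoc (M′ i) (c i) (g i) ⟨
          (M′ i * c i) • g i  ≡⟨ cong (_• g i) (trans (ℤP.*-comm (M′ i) (c i)) (sym (split i))) ⟩
          M i • g i           ≈⟨ ord i ⟩
          𝟘 ∎
      ; gen = gen′
      ; ind = λ a eq i →
          let p = ind (λ i → a i * c i) (≈trans (≈sym (lin-• u a c g)) eq) i
          in *-cancelˡ-∣ (c i) {{c≢0 i}} (subst₂ _∣_ (split i) (ℤP.*-comm (a i) (c i)) p)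
      }
      where
      gen′ : ∀ y → N′ ∣ ψ y → Σ (⟦ u ⟧ → ℤ) λ a → n ⊢ y ≈ lin u a (λ i → c i • g i)
      gen′ y p = (λ i → quotient (c∣a i)) , (begin
          y                                                   ≈⟨ eq ⟩
          lin u a g                                           ≈⟨ lin-coeff u g (λ i → _∣_.equality (c∣a i)) ⟩
          lin u (λ i → quotient (c∣a i) * c i) g              ≈⟨ lin-• u _ c g ⟨
          lin u (λ i → quotient (c∣a i)) (λ i → c i • g i) ∎)
        where
        a = proj₁ (gen y (∣-trans N∣N′ p))
        eq = proj₂ (gen y (∣-trans N∣N′ p))
        c∣a : ∀ i → c i ∣ a i
        c∣a = critical a (∣-resp (ev-lin id u a g) (∣-diff′ (∣-trans N∣n (ψ-cong eq)) p))

-- Maps between the groups for different n, and functionals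

mulExp : ℤ → T → T
mulExp s = bind (λ v → e (s * v))

mulExp-lin : ∀ s u a g → mulExp s (lin u a g) ≡ lin u a (mulExp s ∘ g)
mulExp-lin s (fin zero)    a g = refl
mulExp-lin s (fin (suc k)) a g = cong (λ t → a Fin.zero • mulExp s (g Fin.zero) ⊞ t) (mulExp-lin s (fin k) _ _)
mulExp-lin s (u ⊎ᵤ w)      a g = cong₂ _⊞_ (mulExp-lin s u _ _) (mulExp-lin s w _ _)

ψ-mulExp : ∀ s x → ψ (mulExp s x) ≡ s * ψ x
ψ-mulExp s (e v) = refl
ψ-mulExp s 𝟘 = sym (ℤP.*-zeroʳ s)
ψ-mulExp s (x ⊞ y) = trans (cong₂ _+_ (ψ-mulExp s x) (ψ-mulExp s y)) (sym (ℤP.*-distribˡ-+ s (ψ x) (ψ y)))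
ψ-mulExp s (a • x) = trans (cong (a *_) (ψ-mulExp s x)) (lem a s (ψ x))
  where lem : ∀ a s x → a * (s * x) ≡ s * (a * x)
        lem = solve-∀

∣-by : ∀ {k z} q → z ≡ q * k → k ∣ z
∣-by = divides

1∣ : ∀ z → + 1 ∣ z
1∣ z = divides z (sym (ℤP.*-identityʳ z))

*-mono-∣ : ∀ c {a b} → a ∣ b → c * a ∣ c * b
*-mono-∣ c {a} (divides q eq) = divides q (trans (cong (c *_) eq) (lem c q a))
  where lem : ∀ c q a → c * (q * a) ≡ q * (c * a)
        lem = solve-∀

∣-flip : ∀ {m} a b → m ∣ a - b → m ∣ b - a
∣-flip a b p = ∣-resp (lem a b) (∣m⇒∣-m p)
  where lem : ∀ a b → - (a - b) ≡ b - a
        lem = solve-∀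

∣-chain : ∀ {m} a b c → m ∣ a - b → m ∣ b - c → m ∣ a - c
∣-chain a b c p q = ∣-resp (lem a b c) (∣m∣n⇒∣m+n p q)
  where lem : ∀ a b c → (a - b) + (b - c) ≡ a - c
        lem = solve-∀

residue-unique : ∀ {n r s} → r < n → s < n → + n ∣ + r - + s → r ≡ s
residue-unique {n} {r} {s} r<n s<n p = ℤP.+-injective (ℤP.i-j≡0⇒i≡j (+ r) (+ s) (ℤP.∣i∣≡0⇒i≡0 absurd-unless-zero))
  where
  small : ∣ + r - + s ∣ < n
  small = ℕP.≤-<-trans (subst (λ z → ∣ z ∣ ≤ r ℕ.⊔ s) (sym (ℤP.m-n≡m⊖n r s)) (ℤP.∣m⊝n∣≤m⊔n r s)) (ℕP.⊔-lub r<n s<n)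
  absurd-unless-zero : ∣ + r - + s ∣ ≡ 0
  absurd-unless-zero with ∣ + r - + s ∣ | small | ∣⇒∣ᵤ p
  ... | zero  | _ | _ = refl
  ... | suc k | lt | q = ⊥-elim (ℕP.<⇒≱ lt (ℕD.∣⇒≤ q))

module _ (n : ℕ) .{{_ : ℕ.NonZero n}} where
  residue-∣ : ∀ v → + n ∣ v - + (v %ℕ n)
  residue-∣ v = ∣-by (v /ℕ n) (trans (cong (_- + (v %ℕ n)) (a≡a%ℕn+[a/ℕn]*n v n)) (lem (+ (v %ℕ n)) _))
    where lem : ∀ a b → (a + b) - a ≡ b
          lem = solve-∀

  residue-cong : ∀ v w → + n ∣ v - w → v %ℕ n ≡ w %ℕ n
  residue-cong v w p = residue-unique (n%ℕd<d v n) (n%ℕd<d w n)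
    (∣-chain (+ (v %ℕ n)) w (+ (w %ℕ n)) (∣-chain (+ (v %ℕ n)) v w (∣-flip v _ (residue-∣ v)) p) (residue-∣ w))

ev-mulExp : ∀ f s x → ev f (mulExp s x) ≡ ev (λ v → f (s * v)) x
ev-mulExp f s (e v)   = refl
ev-mulExp f s 𝟘       = refl
ev-mulExp f s (x ⊞ y) = cong₂ _+_ (ev-mulExp f s x) (ev-mulExp f s y)
ev-mulExp f s (a • x) = cong (a *_) (ev-mulExp f s x)

private
  add-compare : ∀ {m} c a x b y → m ∣ a - c * x → m ∣ b - c * y → m ∣ (a + b) - c * (x + y)
  add-compare c a x b y p q = ∣-resp (lem a b c x y) (∣m∣n⇒∣m+n p q)
    where lem : ∀ a b d x y → (a - d * x) + (b - d * y) ≡ (a + b) - d * (x + y)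
          lem = solve-∀

  scale-compare : ∀ {m} c r a x → m ∣ a - c * x → m ∣ r * a - c * (r * x)
  scale-compare c r a x p = ∣-resp (lem r a c x) (∣n⇒∣m*n r p)
    where lem : ∀ c a d x → c * (a - d * x) ≡ c * a - d * (c * x)
          lem = solve-∀

  sum-compare : ∀ {m} a b c f s → m ∣ a - b → m ∣ c - f → m ∣ (b + f) - s → m ∣ (a + c) - s
  sum-compare a b c f s p q r = ∣-chain (a + c) (b + f) s (∣-resp (lem a b c f) (∣m∣n⇒∣m+n p q)) r
    where lem : ∀ a b c f → (a - b) + (c - f) ≡ (a + c) - (b + f)
          lem = solve-∀

  mul-compare : ∀ {m} c a b s → m ∣ a - b → m ∣ c * b - s → m ∣ c * a - s
  mul-compare c a b s p r = ∣-chain (c * a) (c * b) s (∣-resp (lem c a b) (∣n⇒∣m*n c p)) r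
    where lem : ∀ c a b → c * (a - b) ≡ c * a - c * b
          lem = solve-∀

  zero-compare : ∀ {m} c → m ∣ + 0 - c * + 0
  zero-compare c = ∣-resp (sym (lem c)) ∣-zero
    where lem : ∀ d → + 0 - d * + 0 ≡ + 0
          lem = solve-∀

Tm-ind : ∀ {A} (P : Tm A → Set) → (∀ v → P (e v)) → P 𝟘 →
         (∀ x y → P x → P y → P (x ⊞ y)) → (∀ a x → P x → P (a • x)) → ∀ x → P x
Tm-ind P pe p𝟘 p⊞ p• (e v)   = pe v
Tm-ind P pe p𝟘 p⊞ p• 𝟘       = p𝟘
Tm-ind P pe p𝟘 p⊞ p• (x ⊞ y) = p⊞ x y (Tm-ind P pe p𝟘 p⊞ p• x) (Tm-ind P pe p𝟘 p⊞ p• y)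
Tm-ind P pe p𝟘 p⊞ p• (a • x) = p• a x (Tm-ind P pe p𝟘 p⊞ p• x)

ev-compare : ∀ {m} (f g : ℤ → ℤ) c → (∀ v → m ∣ f v - c * g v) → ∀ x → m ∣ ev f x - c * ev g x
ev-compare {m} f g c p = Tm-ind (λ x → m ∣ ev f x - c * ev g x) p (zero-compare c)
  (λ x y → add-compare c (ev f x) (ev g x) (ev f y) (ev g y))
  (λ r x → scale-compare c r (ev f x) (ev g x))

module Towers (d : ℤ) where
  open Dune d
  open Bases d

  -- Multiplication of exponents by s is well defined from residues modulo n to residues modulo n′
  -- and commutes with multiplication by d. The case s = 1 is the projection to a divisor, s = d
  -- factors multiplication by d on Σ(n,d) through Σ(n₁,d), and s = θ embeds the part prime to d.
  mulExp-cong : ∀ s {n n′} → + n′ ∣ s * + n → ∀ {x y} → n ⊢ x ≈ y → n′ ⊢ mulExp s x ≈ mulExp s y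
  mulExp-cong s h ≈refl = ≈refl
  mulExp-cong s h (≈sym p) = ≈sym (mulExp-cong s h p)
  mulExp-cong s h (≈trans p q) = ≈trans (mulExp-cong s h p) (mulExp-cong s h q)
  mulExp-cong s h (⊞-cong p q) = ⊞-cong (mulExp-cong s h p) (mulExp-cong s h q)
  mulExp-cong s h (•-cong a p) = •-cong a (mulExp-cong s h p)
  mulExp-cong s h (⊞-assoc x y z) = ⊞-assoc _ _ _
  mulExp-cong s h (⊞-comm x y) = ⊞-comm _ _
  mulExp-cong s h (⊞-idˡ x) = ⊞-idˡ _
  mulExp-cong s h (•-distribˡ a x y) = •-distribˡ _ _ _
  mulExp-cong s h (•-distribʳ a b x) = •-distribʳ _ _ _
  mulExp-cong s h (•-assoc a b x) = •-assoc _ _ _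
  mulExp-cong s h (•-one x) = •-one _
  mulExp-cong s h (•-zero x) = •-zero _
  mulExp-cong s {n} h (periodic v w (divides q eq)) =
    periodic _ _ (∣-trans h (∣-by q (trans (lem₁ s v w) (trans (cong (s *_) eq) (lem₂ s q (+ n))))))
    where lem₁ : ∀ s v w → s * v - s * w ≡ s * (v - w)
          lem₁ = solve-∀
          lem₂ : ∀ s q n → s * (q * n) ≡ q * (s * n)
          lem₂ = solve-∀
  mulExp-cong s h e-zero = ≈trans (≡⇒≈ (cong e (ℤP.*-zeroʳ s))) e-zero
  mulExp-cong s h (e-scale v) = ≈trans (e-scale (s * v)) (≡⇒≈ (cong e (lem d s v)))
    where lem : ∀ d s v → d * (s * v) ≡ s * (d * v)
          lem = solve-∀

  mulExp-≈ : ∀ {n} s → (∀ v → + n ∣ s * v - v) → ∀ x → n ⊢ mulExp s x ≈ x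
  mulExp-≈ s h (e v)   = periodic _ _ (h v)
  mulExp-≈ s h 𝟘       = ≈refl
  mulExp-≈ s h (x ⊞ y) = ⊞-cong (mulExp-≈ s h x) (mulExp-≈ s h y)
  mulExp-≈ s h (a • x) = •-cong a (mulExp-≈ s h x)

  mulExp-one : ∀ {n} x → n ⊢ mulExp (+ 1) x ≈ x
  mulExp-one = mulExp-≈ (+ 1) (λ v → ∣-resp (sym (lem v)) ∣-zero)
    where lem : ∀ v → + 1 * v - v ≡ + 0
          lem = solve-∀

  weaken : ∀ {n n′} → + n′ ∣ + n → ∀ {x y} → n ⊢ x ≈ y → n′ ⊢ x ≈ y
  weaken {n} h {x} {y} p =
    ≈trans (≈sym (mulExp-one x)) (≈trans (mulExp-cong (+ 1) (∣-resp (sym (ℤP.*-identityˡ (+ n))) h) p) (mulExp-one y))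

  d•-mulExp : ∀ {n} x → n ⊢ d • x ≈ mulExp d x
  d•-mulExp (e v)   = e-scale v
  d•-mulExp {n} 𝟘   = ModuleSolver.•-𝟘 n d
  d•-mulExp (x ⊞ y) = ≈trans (•-distribˡ d x y) (⊞-cong (d•-mulExp x) (d•-mulExp y))
  d•-mulExp (a • x) = ≈trans (≈sym (•-assoc d a x))
    (≈trans (≡⇒≈ (cong (_• x) (ℤP.*-comm d a))) (≈trans (•-assoc a d x) (•-cong a (d•-mulExp x))))

  ∣•-vanish : ∀ {n M c x} → M ∣ c → n ⊢ M • x ≈ 𝟘 → n ⊢ c • x ≈ 𝟘
  ∣•-vanish {n} {M} {c} {x} (divides q eq) p = begin
    c • x        ≡⟨ cong (_• x) eq ⟩
    (q * M) • x  ≈⟨ •-assoc q M x ⟩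
    q • M • x    ≈⟨ •-cong q p ⟩
    q • 𝟘        ≈⟨ •-𝟘 q ⟩
    𝟘 ∎
    where
    open ModuleSolver n
    open ≈-Reasoning n

  -- A homomorphism from Σ(n,d) to ℤ_M, stored through integer lifts of its values on the symbols.
  record Functional (n : ℕ) (M : ℤ) : Set where
    field
      at       : ℤ → ℤ
      periodic∣ : ∀ v w → + n ∣ v - w → M ∣ at v - at w
      zero∣     : M ∣ at (+ 0)
      scale∣    : ∀ v → M ∣ d * at v - at (d * v)
    at-cong : ∀ {x y} → n ⊢ x ≈ y → M ∣ ev at x - ev at y
    at-cong = Evaluate.ev-cong (multiplesOf M) n (λ v _ → at v) periodic∣ zero∣ scale∣

  -- What the lifting of a basis along n = d₀ n₁ needs. By `kernel` and `indep`, the kernel of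
  -- Σ(n,d) → Σ(n₁,d) is generated modulo d Σ(n,d) by the `X i`, freely over ℤ_d. The two conditions
  -- on ψ are equalities of integers, so that weights can be divided exactly later.
  record Level (n n₁ : ℕ) : Set where
    field
      {{n≢0}} : ℕ.NonZero n
      d₀ d′  : ℤ
      n≡     : + n ≡ d₀ * + n₁
      d≡     : d ≡ d₀ * d′
      cancel : ∀ a → + n ∣ d * a → + n₁ ∣ a
      image? : ∀ v → Dec (Σ ℤ λ a → + n ∣ v - d * a)
      count  : ℕ
      X      : Fin (suc count) → T
      X-vanish  : ∀ i → n₁ ⊢ X i ≈ 𝟘
      ψ-special : ψ (X Fin.zero) ≡ + n₁
      ψ-other   : ∀ j → ψ (X (Fin.suc j)) ≡ + 0
      kernel : ∀ y → n₁ ⊢ y ≈ 𝟘 → Σ (Fin (suc count) → ℤ) λ b → Σ T λ ρ → n ⊢ y ≈ lin (fin (suc count)) b X ⊞ d • ρ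
      indep  : ∀ b z → n ⊢ lin (fin (suc count)) b X ⊞ d • z ≈ 𝟘 → ∀ i → d ∣ b i

    n₁∣n : + n₁ ∣ + n
    n₁∣n = ∣-by d₀ n≡

    n∣dn₁ : + n ∣ d * + n₁
    n∣dn₁ = ∣-by d′ (trans (cong (_* + n₁) d≡) (trans (lem d₀ d′ (+ n₁)) (cong (d′ *_) (sym n≡))))
      where lem : ∀ a b c → a * b * c ≡ b * (a * c)
            lem = solve-∀

    d•-vanish : ∀ {y} → n₁ ⊢ y ≈ 𝟘 → n ⊢ d • y ≈ 𝟘
    d•-vanish {y} p = ≈trans (d•-mulExp y) (mulExp-cong d n∣dn₁ p)

    module _ {M} (F : Functional n₁ M) where
      open Functional F

      -- d F on multiples of d, and any lift of F elsewhere
      private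
        liftAt : ∀ v → Dec (Σ ℤ λ a → + n ∣ v - d * a) → ℤ
        liftAt v (yes (a , _)) = d * at a
        liftAt v (no _)        = at (+ (v %ℕ n))

        cancel-diff : ∀ a b → + n ∣ d * a - d * b → + n₁ ∣ a - b
        cancel-diff a b p = cancel (a - b) (∣-resp (lem d a b) p)
          where lem : ∀ d a b → d * a - d * b ≡ d * (a - b)
                lem = solve-∀

        d*-diff : ∀ a b → M ∣ a - b → d * M ∣ d * a - d * b
        d*-diff a b p = ∣-resp (lem d a b) (*-mono-∣ d p)
          where lem : ∀ d a b → d * (a - b) ≡ d * a - d * b
                lem = solve-∀

        liftAt-scale : ∀ v → d * M ∣ liftAt (d * v) (image? (d * v)) - d * at v
        liftAt-scale v with image? (d * v)
        ... | yes (b , p) = d*-diff (at b) (at v) (periodic∣ b v (∣-flip v b (cancel-diff v b p)))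
        ... | no ¬p = ⊥-elim (¬p (v , ∣-resp (sym (ℤP.+-inverseʳ (d * v))) ∣-zero))

      lift : Functional n (d * M)
      lift = record { at = λ v → liftAt v (image? v) ; periodic∣ = per ; zero∣ = zer ; scale∣ = sca }
        where
        per : ∀ v w → + n ∣ v - w → d * M ∣ liftAt v (image? v) - liftAt w (image? w)
        per v w p with image? v | image? w
        ... | yes (a , q) | yes (b , r) = d*-diff (at a) (at b) (periodic∣ a b (cancel-diff a b
                (∣-chain (d * a) v (d * b) (∣-flip v (d * a) q) (∣-chain v w (d * b) p r))))
        ... | yes (a , q) | no ¬r = ⊥-elim (¬r (a , ∣-chain w v (d * a) (∣-flip v w p) q))
        ... | no ¬q | yes (b , r) = ⊥-elim (¬q (b , ∣-chain v w (d * b) p r))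
        -- The value depends only on the residue modulo n, so the two are equal. Periodicity of F
        -- would bound the difference only modulo M, not modulo d M.
        ... | no _ | no _ = ∣-resp (sym (trans (cong (λ s → at (+ s) - at (+ (w %ℕ n))) (residue-cong n v w p))
                (ℤP.+-inverseʳ (at (+ (w %ℕ n)))))) ∣-zero
        zer : d * M ∣ liftAt (+ 0) (image? (+ 0))
        zer with image? (+ 0)
        ... | yes (a , q) = *-mono-∣ d (∣-diff (periodic∣ a (+ 0) (cancel (a - + 0) (∣-resp (lem d a) (∣m⇒∣-m q)))) zero∣)
          where lem : ∀ d a → - (+ 0 - d * a) ≡ d * (a - + 0)
                lem = solve-∀
        ... | no ¬q = ⊥-elim (¬q (+ 0 , ∣-resp (sym (lem d)) ∣-zero))
          where lem : ∀ d → + 0 - d * + 0 ≡ + 0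
                lem = solve-∀
        -- Either value of the lift is congruent to F(v) modulo M: at v = d a because d F(a) ≡ F(d
        -- a), elsewhere by periodicity of F. The outer factor d supplies the rest of the modulus.
        sca′ : ∀ v → d * M ∣ d * liftAt v (image? v) - d * at v
        sca′ v with image? v
        ... | yes (a , q) = d*-diff (d * at a) (at v)
                (∣-chain (d * at a) (at (d * a)) (at v) (scale∣ a)
                  (periodic∣ (d * a) v (∣-flip v (d * a) (∣-trans n₁∣n q))))
        ... | no _ = d*-diff (at (+ (v %ℕ n))) (at v)
                (periodic∣ (+ (v %ℕ n)) v (∣-flip v _ (∣-trans n₁∣n (residue-∣ n v))))
        sca : ∀ v → d * M ∣ d * liftAt v (image? v) - liftAt (d * v) (image? (d * v))
        sca v = ∣-chain (d * liftAt v (image? v)) (d * at v) (liftAt (d * v) (image? (d * v)))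
                  (sca′ v) (∣-flip (liftAt (d * v) (image? (d * v))) (d * at v) (liftAt-scale v))

      lift-mulExp : ∀ y → d * M ∣ ev (Functional.at lift) (mulExp d y) - d * ev at y
      lift-mulExp y = subst (λ z → d * M ∣ z - d * ev at y) (sym (ev-mulExp (Functional.at lift) d y))
        (ev-compare (λ v → Functional.at lift (d * v)) at d liftAt-scale y)

  -- The lift of F takes the value d F(y) modulo d M at d y. If d y vanishes, d M divides d F(y),
  -- and d cancels.
  functional-vanish : ∀ {n n₁ M} → Level n n₁ → .{{_ : ℤ.NonZero d}} → (F : Functional n₁ M) →
                      ∀ y → n ⊢ mulExp d y ≈ 𝟘 → M ∣ ev (Functional.at F) y
  functional-vanish {n} {n₁} {M} L F y p = *-cancelˡ-∣ d {M} {a} dM∣da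
    where
    F̃ = Level.lift L F
    a = ev (Functional.at F) y
    b = ev (Functional.at F̃) (mulExp d y)
    dM∣b : d * M ∣ b
    dM∣b = ∣-resp (ℤP.+-identityʳ b) (Functional.at-cong F̃ p)
    dM∣da : d * M ∣ d * a
    dM∣da = ∣-diff′ {d * M} {b} {d * a} (Level.lift-mulExp L F y) dM∣b

  module Coordinates {n u g M} (B : Basis n (+ 1) u g M) where
    open Basis B
    open ModuleSolver n

    coord : T → ⟦ u ⟧ → ℤ
    coord y = proj₁ (gen y (1∣ _))

    coord-eq : ∀ y → n ⊢ y ≈ lin u (coord y) g
    coord-eq y = proj₂ (gen y (1∣ _))

    lin-injective : ∀ a b → n ⊢ lin u a g ≈ lin u b g → ∀ i → M i ∣ a i - b i
    lin-injective a b p i = ∣-resp (lem (a i) (b i)) (ind _ zero≈ i)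
      where
      lem : ∀ a b → a + (- + 1) * b ≡ a - b
      lem = solve-∀
      lem₀ : ∀ x → x + (- + 1) * x ≡ + 0 * x
      lem₀ = solve-∀
      open ≈-Reasoning n
      zero≈ : n ⊢ lin u (λ i → a i + (- + 1) * b i) g ≈ 𝟘
      zero≈ = begin
        lin u (λ i → a i + (- + 1) * b i) g           ≈⟨ lin-add u a _ g ⟩
        lin u a g ⊞ lin u (λ i → (- + 1) * b i) g     ≈⟨ ⊞-cong p (lin-scale u (- + 1) b g) ⟩
        lin u b g ⊟ lin u b g
          ≈⟨ solveT 1 (e 0F ⊟ e 0F) ((+ 0) • e 0F) (lookup (_ ∷ [])) (λ f → lem₀ (f 0F)) ⟩
        (+ 0) • lin u b g                             ≈⟨ •-zero _ ⟩
        𝟘 ∎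

    coord-cong : ∀ {x y} → n ⊢ x ≈ y → ∀ i → M i ∣ coord x i - coord y i
    coord-cong p = lin-injective _ _ (≈trans (≈sym (coord-eq _)) (≈trans p (coord-eq _)))

    functional : ∀ i → Functional n (M i)
    functional i = record
      { at = λ v → coord (e v) i
      ; periodic∣ = λ v w p → coord-cong (periodic v w p) i
      ; zero∣ = ind _ (≈trans (≈sym (coord-eq _)) e-zero) i
      ; scale∣ = λ v → lin-injective (λ i → d * coord (e v) i) _
          (≈trans (lin-scale u d _ g) (≈trans (•-cong d (≈sym (coord-eq _))) (≈trans (e-scale v) (coord-eq _)))) i
      }

    -- `coord` chooses coefficients for each term separately, hence is additive only modulo the
    -- orders; that is enough to compare it with its linear extension from the symbols.
    functional-coord : ∀ y i → M i ∣ ev (Functional.at (functional i)) y - coord y i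
    functional-coord y i = Tm-ind (λ y → M i ∣ ev (Functional.at (functional i)) y - coord y i)
      (λ v → ∣-resp (sym (ℤP.+-inverseʳ (coord (e v) i))) ∣-zero)
      (∣-resp (sym (ℤP.+-identityˡ _)) (∣m⇒∣-m (ind _ (≈sym (coord-eq 𝟘)) i)))
      (λ x y p q → sum-compare (ev (Functional.at (functional i)) x) (coord x i) (ev (Functional.at (functional i)) y) (coord y i) (coord (x ⊞ y) i) p q
        (lin-injective (λ i → coord x i + coord y i) _
          (≈trans (lin-add u _ _ g) (≈trans (⊞-cong (≈sym (coord-eq x)) (≈sym (coord-eq y))) (coord-eq _))) i))
      (λ c x p → mul-compare c (ev (Functional.at (functional i)) x) (coord x i) (coord (c • x) i) p
        (lin-injective (λ i → c * coord x i) _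
          (≈trans (lin-scale u c _ g) (≈trans (•-cong c (≈sym (coord-eq x))) (coord-eq _))) i))
      y

  -- The coordinate functionals of a basis of Σ(n₁,d) separate its elements, and `functional-vanish`
  -- applies to each of them.
  d•-injective : ∀ {n n₁ u g M} (L : Level n n₁) .{{_ : ℤ.NonZero d}} → Basis n₁ (+ 1) u g M →
                 ∀ y → n ⊢ d • y ≈ 𝟘 → n₁ ⊢ y ≈ 𝟘
  d•-injective {n} {n₁} {u} {g} {M} L B y p = begin
      y                    ≈⟨ coord-eq y ⟩
      lin u (coord y) g    ≈⟨ lin-zero u _ g vanish ⟩
      𝟘 ∎
    where
    open Basis B
    open Coordinates B
    open Level L
    open ModuleSolver n₁
    open ≈-Reasoning n₁
    M∣coord : ∀ i → M i ∣ coord y i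
    M∣coord i = ∣-diff′ {M i} (functional-coord y i)
      (functional-vanish L (functional i) y (≈trans (≈sym (d•-mulExp y)) p))
    vanish : ∀ i → n₁ ⊢ coord y i • g i ≈ 𝟘
    vanish i = ∣•-vanish (M∣coord i) (ord i)

  data Tower : ℕ → ℕ → Set where
    base : ∀ {m} → Tower m m
    step : ∀ {n n₁ m} → Level n n₁ → Tower n₁ m → Tower n m

-- The part annihilated by a power of d

module Lifting (d : ℤ) .{{d≢0 : ℤ.NonZero d}} where
  open Dune d
  open Bases d
  open Towers d

  tower-∣ : ∀ {n m} → Tower n m → + m ∣ + n
  tower-∣ base = ∣-refl
  tower-∣ (step L t) = ∣-trans (tower-∣ t) (Level.n₁∣n L)

  C : ∀ {n m} → Tower n m → U
  C base       = fin 0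
  C (step L t) = fin (suc (Level.count L)) ⊎ᵤ C t

  chains : ∀ {n m} (t : Tower n m) → ⟦ C t ⟧ → T
  chains (step L t) (inj₁ i) = Level.X L i
  chains (step L t) (inj₂ c) = chains t c

  -- The number k counts the levels above `t`; each of them contributes a factor d.
  order : ∀ {n m} (t : Tower n m) → ℕ → ⟦ C t ⟧ → ℤ
  order (step L t) k (inj₁ i) = d ^ suc k
  order (step L t) k (inj₂ c) = order t (suc k) c

  order-suc : ∀ {n m} (t : Tower n m) k c → order t (suc k) c ≡ d * order t k c
  order-suc (step L t) k (inj₁ i) = refl
  order-suc (step L t) k (inj₂ c) = order-suc t (suc k) c

  d∣order : ∀ {n m} (t : Tower n m) k c → d ∣ order t k c
  d∣order (step L t) k (inj₁ i) = ∣m⇒∣m*n (d ^ k) ∣-refl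
  d∣order (step L t) k (inj₂ c) = d∣order t (suc k) c

  chains-vanish : ∀ {n m} (t : Tower n m) c → m ⊢ chains t c ≈ 𝟘
  chains-vanish (step L t) (inj₁ i) = weaken (tower-∣ t) (Level.X-vanish L i)
  chains-vanish (step L t) (inj₂ c) = chains-vanish t c

  module _ {m p E P} (B : Basis m (+ 1) p E P) (θ : ℤ) (θ≡1 : ∀ v → + m ∣ θ * v - v) where

    gens : ∀ {n} (t : Tower n m) → ⟦ C t ⊎ᵤ p ⟧ → T
    gens t = [ chains t , mulExp θ ∘ E ]

    orders : ∀ {n} (t : Tower n m) → ⟦ C t ⊎ᵤ p ⟧ → ℤ
    orders t = [ order t 0 , P ]

    periodic-ord : ∀ {n} → + n ∣ θ * + m → ∀ i → n ⊢ P i • mulExp θ (E i) ≈ 𝟘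
    periodic-ord h i = mulExp-cong θ h (Basis.ord B i)

    -- The periodic generators enter as `mulExp θ (E i)`. Modulo m this is still `E i`, while n ∣ θ
    -- m carries the relations of Σ(m,d) over to Σ(n,d); the order of `E i` itself may be larger
    -- there.
    towerBasis : ∀ {n} (t : Tower n m) → + n ∣ θ * + m → Basis n (+ 1) (C t ⊎ᵤ p) (gens t) (orders t)
    towerBasis base h = record
      { mem = λ i → 1∣ _
      ; ord = λ { (inj₂ i) → periodic-ord h i }
      ; gen = λ y _ → (λ { (inj₂ i) → coord y i }) , ≈trans (coord-eq y)
          (≈trans (lin-cong p (coord y) (λ i → ≈sym (mulExp-≈ θ θ≡1 (E i)))) (≈sym (⊞-idˡ _)))
      ; ind = λ { a eq (inj₂ i) → Basis.ind B (a ∘ inj₂) (≈trans (lin-cong p (a ∘ inj₂) (λ i → ≈sym (mulExp-≈ θ θ≡1 (E i))))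
                  (≈trans (≈sym (⊞-idˡ _)) eq)) i }
      }
      where
      open Coordinates B
      open ModuleSolver m
    towerBasis {n} (step {n₁ = n₁} L t) h = record
      { mem = λ i → 1∣ _ ; ord = ord′ ; gen = λ y _ → gen′ y ; ind = ind′ }
      where
      open Level L
      open ModuleSolver n
      open ≈-Reasoning n
      IH : Basis n₁ (+ 1) (C t ⊎ᵤ p) (gens t) (orders t)
      IH = towerBasis t (∣-trans n₁∣n h)
      open Coordinates IH
      x = fin (suc count)
      Eθ = mulExp θ ∘ E
      lem₀ : ∀ x y → x + (y + (- + 1) * x) ≡ y
      lem₀ = solve-∀
      ord′ : ∀ i → n ⊢ orders (step L t) i • gens (step L t) i ≈ 𝟘
      ord′ (inj₁ (inj₁ i)) = ≈trans (≡⇒≈ (cong (_• X i) (ℤP.*-identityʳ d))) (d•-vanish (X-vanish i))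
      ord′ (inj₁ (inj₂ c)) = ≈trans (≡⇒≈ (cong (_• chains t c) (order-suc t 0 c)))
        (≈trans (•-assoc _ _ _) (d•-vanish (Basis.ord IH (inj₁ c))))
      ord′ (inj₂ i) = periodic-ord h i

      gen′ : ∀ y → Σ (⟦ C (step L t) ⊎ᵤ p ⟧ → ℤ) λ a → n ⊢ y ≈ lin (C (step L t) ⊎ᵤ p) a (gens (step L t))
      gen′ y = [ [ b , (λ c → a (inj₁ c) + d * a′ (inj₁ c)) ] , (λ i → a (inj₂ i) + d * a′ (inj₂ i)) ] , (begin
          y
            ≈⟨ solveT 2 (e 1F) (e 0F ⊞ (e 1F ⊟ e 0F)) (lookup (z ∷ y ∷ [])) (λ f → sym (lem₀ (f 0F) (f 1F))) ⟩
          z ⊞ (y ⊟ z)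
            ≈⟨ ⊞-cong ≈refl (proj₂ (proj₂ K)) ⟩
          z ⊞ (lin x b X ⊞ d • ρ)
            ≈⟨ ⊞-cong ≈refl (⊞-cong ≈refl dρ) ⟩
          z ⊞ (lin x b X ⊞ d • z′)
            ≈⟨ solveT 3 (e 0F ⊞ (e 1F ⊞ d • e 2F)) (e 1F ⊞ (e 0F ⊞ d • e 2F)) (lookup (z ∷ lin x b X ∷ z′ ∷ []))
                 (λ f → lem₁ d (f 0F) (f 1F) (f 2F)) ⟩
          lin x b X ⊞ (z ⊞ d • z′)
            ≈⟨ ⊞-cong ≈refl (≈trans (lin-add u a (λ i → d * a′ i) (gens t)) (⊞-cong ≈refl (lin-scale u d a′ (gens t)))) ⟨
          lin x b X ⊞ lin u (λ i → a i + d * a′ i) (gens t)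
            ≈⟨ ⊞-assoc _ _ _ ⟨
          (lin x b X ⊞ lin (C t) (λ i → a (inj₁ i) + d * a′ (inj₁ i)) (chains t)) ⊞ lin p (λ i → a (inj₂ i) + d * a′ (inj₂ i)) Eθ ∎)
        where
        u = C t ⊎ᵤ p
        a = coord y
        z = lin u a (gens t)
        lem₂ : ∀ x → x + (- + 1) * x ≡ + 0 * x
        lem₂ = solve-∀
        lem₁ : ∀ d x y z → x + (y + d * z) ≡ y + (x + d * z)
        lem₁ = solve-∀
        K = kernel (y ⊟ z) (≈trans (⊞-cong (coord-eq y) ≈refl)
              (≈trans (ModuleSolver.solveT n₁ 1 (e 0F ⊟ e 0F) ((+ 0) • e 0F) (lookup (z ∷ [])) (λ f → lem₂ (f 0F))) (•-zero z)))
        b = proj₁ K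
        ρ = proj₁ (proj₂ K)
        a′ = coord ρ
        z′ = lin u a′ (gens t)
        -- Since d ρ depends only on the class of ρ in Σ(n₁,d), the basis of that group may be used
        -- to expand ρ.
        dρ : n ⊢ d • ρ ≈ d • z′
        dρ = ≈trans (d•-mulExp ρ) (≈trans (mulExp-cong d n∣dn₁ (coord-eq ρ)) (≈sym (d•-mulExp z′)))

      ind′ : ∀ a → n ⊢ lin (C (step L t) ⊎ᵤ p) a (gens (step L t)) ≈ 𝟘 → ∀ i → orders (step L t) i ∣ a i
      ind′ a eq = λ { (inj₁ (inj₁ i)) → ∣-trans (∣-reflexive (ℤP.*-identityʳ d)) (d∣b i)
                    ; (inj₁ (inj₂ c)) → ∣-trans (∣-reflexive (order-suc t 0 c))
                        (∣-trans (*-mono-∣ d (Basis.ind IH (λ { (inj₁ c) → s c ; (inj₂ _) → + 0 }) s≈0 (inj₁ c))) (∣-reflexive (sym (ds c))))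
                    ; (inj₂ i) → M∣tail (inj₂ i) }
        where
        b : Fin (suc count) → ℤ
        b i = a (inj₁ (inj₁ i))
        tail : ⟦ C t ⊎ᵤ p ⟧ → ℤ
        tail = [ (λ c → a (inj₁ (inj₂ c))) , (λ i → a (inj₂ i)) ]
        -- In Σ(n₁,d) the `X i` vanish, so the other coefficients are divisible by the orders valid
        -- there. On the chains these orders are multiples of d, which permits writing the
        -- coefficients as d s.
        M∣tail : ∀ i → orders t i ∣ tail i
        M∣tail = Basis.ind IH tail (≈trans (≈trans (≈sym (⊞-idˡ _)) (⊞-cong
          (≈sym (ModuleSolver.lin-zero n₁ x b X (λ i → ≈trans (•-cong _ (X-vanish i)) (ModuleSolver.•-𝟘 n₁ _)))) ≈refl))
          (≈trans (≈sym (⊞-assoc _ _ _)) (weaken n₁∣n eq)))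
        s : ⟦ C t ⟧ → ℤ
        s c = quotient (∣-trans (d∣order t 0 c) (M∣tail (inj₁ c)))
        ds : ∀ c → a (inj₁ (inj₂ c)) ≡ d * s c
        ds c = trans (_∣_.equality (∣-trans (d∣order t 0 c) (M∣tail (inj₁ c)))) (ℤP.*-comm (s c) d)
        z = lin (C t) s (chains t)
        lin-s : n ⊢ lin (C t) (λ c → a (inj₁ (inj₂ c))) (chains t) ≈ d • z
        lin-s = ≈trans (lin-coeff (C t) (chains t) ds) (lin-scale (C t) d s (chains t))
        E-part : n ⊢ lin p (a ∘ inj₂) Eθ ≈ 𝟘
        E-part = lin-zero p _ Eθ λ i → ∣•-vanish (M∣tail (inj₂ i)) (periodic-ord h i)
        main : n ⊢ lin x b X ⊞ d • z ≈ 𝟘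
        main = begin
          lin x b X ⊞ d • z                                                    ≈⟨ ⊞-cong ≈refl lin-s ⟨
          lin x b X ⊞ lin (C t) (λ c → a (inj₁ (inj₂ c))) (chains t)           ≈⟨ ⊞-idʳ _ ⟨
          (lin x b X ⊞ lin (C t) (λ c → a (inj₁ (inj₂ c))) (chains t)) ⊞ 𝟘     ≈⟨ ⊞-cong ≈refl E-part ⟨
          lin (C (step L t) ⊎ᵤ p) a (gens (step L t))                          ≈⟨ eq ⟩
          𝟘 ∎
        d∣b : ∀ i → d ∣ b i
        d∣b = indep b z main
        X-part : n ⊢ lin x b X ≈ 𝟘
        X-part = lin-zero x b X λ i → ∣•-vanish (d∣b i) (d•-vanish (X-vanish i))
        dz≈0 : n ⊢ d • z ≈ 𝟘
        dz≈0 = ≈trans (≈sym (⊞-idˡ _)) (≈trans (⊞-cong (≈sym X-part) ≈refl) main)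
        -- The chain part is d z and vanishes in Σ(n,d), so z vanishes in Σ(n₁,d). This gains the
        -- missing factor d in the orders of the chains.
        s≈0 : n₁ ⊢ lin (C t) s (chains t) ⊞ lin p (λ _ → + 0) Eθ ≈ 𝟘
        s≈0 = ≈trans (⊞-cong (d•-injective L IH z dz≈0) (ModuleSolver.lin-zero n₁ p _ Eθ (λ _ → •-zero _))) (⊞-idˡ 𝟘)

-- Chains adapted to the kernel of ψ

module LiftingKernel (d : ℤ) .{{d≢0 : ℤ.NonZero d}} where
  open Dune d
  open Bases d
  open Towers d
  open Lifting d

  head : ∀ {n m} (t : Tower n m) → (⟦ C t ⟧ → ℤ) → ℤ
  head base       b = + 0
  head (step L t) b = b (inj₁ 0F)

  -- d₀ X₀, d₁ X₁ - X₀, d₂ X₂ - X₁, ... in place of the special generators X₀, X₁, X₂, ...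
  kernelChains : ∀ {n m} (t : Tower n m) → T → ⟦ C t ⟧ → T
  kernelChains (step L t) prev (inj₁ 0F)          = Level.d₀ L • Level.X L 0F ⊟ prev
  kernelChains (step L t) prev (inj₁ (Fin.suc j)) = Level.X L (Fin.suc j)
  kernelChains (step L t) prev (inj₂ c)           = kernelChains t (Level.X L 0F) c

  kernelOrder : ∀ {n m} (t : Tower n m) → ℕ → ⟦ C t ⟧ → ℤ
  kernelOrder (step L t) k (inj₁ 0F)          = Level.d′ L * d ^ k
  kernelOrder (step L t) k (inj₁ (Fin.suc j)) = d ^ suc k
  kernelOrder (step L t) k (inj₂ c)           = kernelOrder t (suc k) c

  -- Among the chains only the special ones have nonzero ψ, with values n₁, n₂, ... at successive
  -- levels.
  weight : ∀ {n m} (t : Tower n m) → (⟦ C t ⟧ → ℤ) → ℤ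
  weight base                a = + 0
  weight (step {n₁ = n₁} L t) a = a (inj₁ 0F) * + n₁ + weight t (a ∘ inj₂)

  ψ-chains : ∀ {n m} (t : Tower n m) a → ψ (lin (C t) a (chains t)) ≡ weight t a
  ψ-chains base a = refl
  ψ-chains (step {n₁ = n₁} L t) a =
    cong₂ _+_ {x = ψ (lin (fin (suc (Level.count L))) (a ∘ inj₁) (Level.X L))} {y = a (inj₁ 0F) * + n₁}
      (trans (cong₂ _+_ (cong (a (inj₁ 0F) *_) (Level.ψ-special L))
        (trans (ev-lin id (fin (Level.count L)) _ _)
          (sumU-zero (fin (Level.count L)) _ λ j → trans (cong (a (inj₁ (Fin.suc j)) *_) (Level.ψ-other L j)) (ℤP.*-zeroʳ (a (inj₁ (Fin.suc j)))))))
        (ℤP.+-identityʳ (a (inj₁ 0F) * + n₁)))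
      (ψ-chains t (a ∘ inj₂))

  weight-∣ : ∀ {n m} (t : Tower n m) a → + m ∣ weight t a
  weight-∣ base a = ∣-zero
  weight-∣ (step L t) a = ∣m∣n⇒∣m+n (∣n⇒∣m*n (a (inj₁ 0F)) (tower-∣ t)) (weight-∣ t (a ∘ inj₂))

  -- The bidiagonal matrix that expresses `kernelChains` through `chains`: the coefficient `head` of
  -- each level is charged to the special generator of the level above.
  kernel-coefficients : ∀ {n m} (t : Tower n m) → (⟦ C t ⟧ → ℤ) → ⟦ C t ⟧ → ℤ
  kernel-coefficients (step L t) b (inj₁ 0F)          = b (inj₁ 0F) * Level.d₀ L - head t (b ∘ inj₂)
  kernel-coefficients (step L t) b (inj₁ (Fin.suc j)) = b (inj₁ (Fin.suc j))
  kernel-coefficients (step L t) b (inj₂ c)           = kernel-coefficients t (b ∘ inj₂) c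

  lin-kernelChains : ∀ {N n m} (t : Tower n m) prev b →
    N ⊢ lin (C t) b (kernelChains t prev) ⊞ head t b • prev ≈ lin (C t) (kernel-coefficients t b) (chains t)
  lin-kernelChains base prev b = ≈trans (⊞-idˡ _) (•-zero prev)
  lin-kernelChains {N} (step L t) prev b = begin
      ((b₀ • (d₀ • X 0F ⊟ prev) ⊞ R) ⊞ H) ⊞ b₀ • prev
        ≈⟨ solveT 4 (((b₀ • (d₀ • e 0F ⊟ e 1F) ⊞ e 2F) ⊞ e 3F) ⊞ b₀ • e 1F)
                    (((b₀ * d₀ - h) • e 0F ⊞ e 2F) ⊞ (e 3F ⊞ h • e 0F))
                    (lookup (X 0F ∷ prev ∷ R ∷ H ∷ [])) (λ f → lem b₀ d₀ h (f 0F) (f 1F) (f 2F) (f 3F)) ⟩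
      ((b₀ * d₀ - h) • X 0F ⊞ R) ⊞ (H ⊞ h • X 0F)
        ≈⟨ ⊞-cong ≈refl (lin-kernelChains t (X 0F) (b ∘ inj₂)) ⟩
      lin (C (step L t)) (kernel-coefficients (step L t) b) (chains (step L t)) ∎
    where
    open Level L using (d₀; X; count)
    open ModuleSolver N
    open ≈-Reasoning N
    b₀ = b (inj₁ 0F)
    h = head t (b ∘ inj₂)
    R = lin (fin count) (λ j → b (inj₁ (Fin.suc j))) (X ∘ Fin.suc)
    H = lin (C t) (b ∘ inj₂) (kernelChains t (X 0F))
    lem : ∀ b d h x p r s → ((b * (d * x + (- + 1) * p) + r) + s) + b * p ≡ ((b * d - h) * x + r) + (s + h * x)
    lem = solve-∀

  -- Every partial weight is divisible by the n of its level, and the quotient is the coefficient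
  -- wanted there. Dividing q n = a₀ n₁ + h n₁ by n₁ gives q d₀ - h = a₀, the bidiagonal equation.
  kernel-solve : ∀ {n m} (t : Tower n m) a → + n ∣ weight t a →
                 Σ (⟦ C t ⟧ → ℤ) λ b → (∀ i → kernel-coefficients t b i ≡ a i) × head t b * + n ≡ weight t a
  kernel-solve base a p = a , (λ ()) , refl
  kernel-solve {n} (step {n₁ = n₁} L t) a (divides q eq) = b , b-coefficients , sym eq
    where
    open Level L
    a₀ = a (inj₁ 0F)
    n₁∣weight : + n₁ ∣ weight t (a ∘ inj₂)
    n₁∣weight = ∣m+n∣m⇒∣n {m = a₀ * + n₁} (∣-trans n₁∣n (∣-by q eq)) (∣-by a₀ refl)
    IH = kernel-solve t (a ∘ inj₂) n₁∣weight
    b′ = proj₁ IH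
    h = head t b′
    b : ⟦ C (step L t) ⟧ → ℤ
    b (inj₁ 0F)          = q
    b (inj₁ (Fin.suc j)) = a (inj₁ (Fin.suc j))
    b (inj₂ c)           = b′ c
    instance
      n₁≢0 : ℤ.NonZero (+ n₁)
      n₁≢0 = ℤ.≢-nonZero λ z → ℕ.≢-nonZero⁻¹ n (ℤP.+-injective (trans n≡ (trans (cong (d₀ *_) z) (ℤP.*-zeroʳ d₀))))
    qd₀ : q * d₀ ≡ a₀ + h
    qd₀ = ℤP.*-cancelʳ-≡ (q * d₀) (a₀ + h) (+ n₁)
      (trans (ℤP.*-assoc q d₀ (+ n₁)) (trans (cong (q *_) (sym n≡)) (trans (sym eq)
        (trans (cong (λ w → a₀ * + n₁ + w) (sym (proj₂ (proj₂ IH)))) (sym (ℤP.*-distribʳ-+ (+ n₁) a₀ h))))))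
    b-coefficients : ∀ i → kernel-coefficients (step L t) b i ≡ a i
    b-coefficients (inj₁ 0F) = trans (cong (_- h) qd₀) (lem a₀ h)
      where lem : ∀ a h → (a + h) - h ≡ a
            lem = solve-∀
    b-coefficients (inj₁ (Fin.suc j)) = refl
    b-coefficients (inj₂ c) = proj₁ (proj₂ IH) c

  module _ {n n₁} (L : Level n n₁) where
    open Level L
    d₀≢0 : ℤ.NonZero d₀
    d₀≢0 = ℤ.≢-nonZero λ z → ℕ.≢-nonZero⁻¹ ∣ d ∣ (cong ∣_∣ (trans d≡ (cong (_* d′) {x = d₀} {y = + 0} z)))

    d^suc : ∀ k → d ^ suc k ≡ d₀ * (d′ * d ^ k)
    d^suc k = trans (cong (_* d ^ k) d≡) (ℤP.*-assoc d₀ d′ (d ^ k))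

  mutual
    -- The matrix is triangular, so the divisibilities propagate from the last level upwards. Once
    -- d^(k+1) divides `head` of the level below, it divides b₀ d₀; as d^(k+1) = d₀ d′ d^k, the
    -- factor d₀ cancels.
    kernelOrder-∣ : ∀ {n m} (t : Tower n m) k b → (∀ i → order t k i ∣ kernel-coefficients t b i) →
                    ∀ i → kernelOrder t k i ∣ b i
    kernelOrder-∣ (step L t) k b p (inj₁ 0F) =
      *-cancelˡ-∣ (Level.d₀ L) {{d₀≢0 L}} (∣-trans (∣-reflexive (sym (d^suc L k)))
        (∣-trans (∣-diff (p (inj₁ 0F)) (head-∣ t k (b ∘ inj₂) (p ∘ inj₂))) (∣-reflexive (ℤP.*-comm (b (inj₁ 0F)) (Level.d₀ L)))))
    kernelOrder-∣ (step L t) k b p (inj₁ (Fin.suc j)) = p (inj₁ (Fin.suc j))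
    kernelOrder-∣ (step L t) k b p (inj₂ c) = kernelOrder-∣ t (suc k) (b ∘ inj₂) (p ∘ inj₂) c

    head-∣ : ∀ {n m} (t : Tower n m) k b → (∀ i → order t (suc k) i ∣ kernel-coefficients t b i) → d ^ suc k ∣ head t b
    head-∣ base k b p = ∣-zero
    head-∣ (step L t) k b p = ∣-trans (∣n⇒∣m*n (Level.d′ L) ∣-refl) (kernelOrder-∣ (step L t) (suc k) b p (inj₁ 0F))

  kernel-ord : ∀ {N n m} (t : Tower n m) k prev → (∀ i → N ⊢ order t k i • chains t i ≈ 𝟘) → N ⊢ d ^ k • prev ≈ 𝟘 →
               ∀ i → N ⊢ kernelOrder t k i • kernelChains t prev i ≈ 𝟘
  kernel-ord {N} (step L t) k prev p q (inj₁ 0F) = begin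
      (d′ * d ^ k) • (d₀ • X 0F ⊟ prev)
        ≈⟨ solveT 2 ((d′ * d ^ k) • (d₀ • e 0F ⊟ e 1F)) ((d₀ * (d′ * d ^ k)) • e 0F ⊞ ((- + 1) * d′) • d ^ k • e 1F)
             (lookup (X 0F ∷ prev ∷ [])) (λ f → lem d′ (d ^ k) d₀ (f 0F) (f 1F)) ⟩
      (d₀ * (d′ * d ^ k)) • X 0F ⊞ ((- + 1) * d′) • d ^ k • prev
        ≈⟨ ⊞-cong (≈trans (≡⇒≈ (cong (_• X 0F) (sym (d^suc L k)))) (p (inj₁ 0F))) (≈trans (•-cong _ q) (•-𝟘 _)) ⟩
      𝟘 ⊞ 𝟘  ≈⟨ ⊞-idˡ 𝟘 ⟩
      𝟘 ∎
    where
    open Level L using (d₀; d′; X)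
    open ModuleSolver N
    open ≈-Reasoning N
    lem : ∀ e k d x y → (e * k) * (d * x + (- + 1) * y) ≡ (d * (e * k)) * x + ((- + 1) * e) * (k * y)
    lem = solve-∀
  kernel-ord (step L t) k prev p q (inj₁ (Fin.suc j)) = p (inj₁ (Fin.suc j))
  kernel-ord (step L t) k prev p q (inj₂ c) = kernel-ord t (suc k) (Level.X L 0F) (p ∘ inj₂) (p (inj₁ 0F)) c

  -- On the special chain of a level ψ equals n - ψ prev, with n that of the level. This is n at the
  -- top, where `prev` is 𝟘, and 0 below, where `prev` is the special generator of the level above.
  kernel-mem : ∀ {N n m} (t : Tower n m) prev → N ∣ + n - ψ prev → ∀ i → N ∣ ψ (kernelChains t prev i)
  kernel-mem {N} {n} (step {n₁ = n₁} L t) prev p (inj₁ 0F) =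
    ∣-resp (trans (cong (_- ψ prev) (Level.n≡ L)) (trans (lem (Level.d₀ L) (+ n₁) (ψ prev))
      (cong (λ w → Level.d₀ L * w + (- + 1) * ψ prev) (sym (Level.ψ-special L))))) p
    where lem : ∀ d n p → d * n - p ≡ d * n + (- + 1) * p
          lem = solve-∀
  kernel-mem (step L t) prev p (inj₁ (Fin.suc j)) = ∣-resp (sym (Level.ψ-other L j)) ∣-zero
  kernel-mem (step {n₁ = n₁} L t) prev p (inj₂ c) = kernel-mem t (Level.X L 0F)
    (∣-resp (sym (trans (cong (λ w → + n₁ - w) (Level.ψ-special L)) (ℤP.+-inverseʳ (+ n₁)))) ∣-zero) c

  kernelChains-vanish : ∀ {n m} (t : Tower n m) prev → m ⊢ prev ≈ 𝟘 → ∀ c → m ⊢ kernelChains t prev c ≈ 𝟘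
  kernelChains-vanish {m = m} (step L t) prev p (inj₁ 0F) =
    ≈trans (⊞-cong (≈trans (•-cong _ (chains-vanish (step L t) (inj₁ 0F))) (ModuleSolver.•-𝟘 m _))
                   (≈trans (•-cong _ p) (ModuleSolver.•-𝟘 m _))) (⊞-idˡ 𝟘)
  kernelChains-vanish (step L t) prev p (inj₁ (Fin.suc j)) = chains-vanish (step L t) (inj₁ (Fin.suc j))
  kernelChains-vanish (step L t) prev p (inj₂ c) = kernelChains-vanish t (Level.X L 0F) (chains-vanish (step L t) (inj₁ 0F)) c

  module _ {m p E P} (B : Basis m (+ 1) p E P) {H PS} (BS : Basis m (+ m) p H PS)
           (θ : ℤ) (θ≡1 : ∀ v → + m ∣ θ * v - v) where

    kernelGens : ∀ {n} (t : Tower n m) → ⟦ C t ⊎ᵤ p ⟧ → T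
    kernelGens t = [ kernelChains t 𝟘 , mulExp θ ∘ H ]

    kernelOrders : ∀ {n} (t : Tower n m) → ⟦ C t ⊎ᵤ p ⟧ → ℤ
    kernelOrders t = [ kernelOrder t 0 , PS ]

    kernelTowerBasis : ∀ {n} (t : Tower n m) → + n ∣ θ * + m → Basis n (+ n) (C t ⊎ᵤ p) (kernelGens t) (kernelOrders t)
    kernelTowerBasis {n} t h = record
      { mem = mem′
      ; ord = [ kernel-ord t 0 𝟘 (λ i → Basis.ord full (inj₁ i)) (ModuleSolver.•-𝟘 n _) , per ]
      ; gen = gen′
      ; ind = ind′
      }
      where
      full : Basis n (+ 1) (C t ⊎ᵤ p) (gens B θ θ≡1 t) (orders B θ θ≡1 t)
      full = towerBasis B θ θ≡1 t h
      open ModuleSolver n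
      open ≈-Reasoning n
      per : ∀ i → n ⊢ PS i • mulExp θ (H i) ≈ 𝟘
      per i = mulExp-cong θ h (Basis.ord BS i)
      θ-∣ : ∀ {z} → + m ∣ z → + n ∣ θ * z
      θ-∣ q = ∣-trans h (*-mono-∣ θ q)
      mem′ : ∀ i → + n ∣ ψ (kernelGens t i)
      mem′ (inj₁ c) = kernel-mem t 𝟘 (∣-resp (sym (ℤP.+-identityʳ (+ n))) ∣-refl) c
      mem′ (inj₂ i) = ∣-resp (sym (ψ-mulExp θ (H i))) (θ-∣ (Basis.mem BS i))
      gen′ : ∀ y → + n ∣ ψ y → Σ (⟦ C t ⊎ᵤ p ⟧ → ℤ) λ a → n ⊢ y ≈ lin (C t ⊎ᵤ p) a (kernelGens t)
      gen′ y n∣ψy = [ b , b′ ] , (begin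
          y                                                      ≈⟨ y≈ ⟩
          lin (C t) a₁ (chains t) ⊞ lin p a₂ (mulExp θ ∘ E)       ≈⟨ ⊞-cong left right ⟩
          lin (C t) b (kernelChains t 𝟘) ⊞ lin p b′ (mulExp θ ∘ H) ∎)
        where
        a = proj₁ (Basis.gen full y (1∣ _))
        y≈ = proj₂ (Basis.gen full y (1∣ _))
        a₁ = a ∘ inj₁
        a₂ = a ∘ inj₂
        z = lin p a₂ E
        ψ-split : + n ∣ weight t a₁ + θ * ψ z
        ψ-split = ∣-resp (cong₂ _+_ (ψ-chains t a₁)
            (trans (cong ψ (sym (mulExp-lin θ p a₂ E))) (ψ-mulExp θ z))) (∣-diff′ (ψ-cong y≈) n∣ψy)
        -- All chain weights are multiples of m and θ ≡ 1 modulo m, so m ∣ ψ z; with n ∣ θ m the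
        -- periodic part is in ker ψ by itself. Hence so is the chain part, and the two can be
        -- solved separately.
        m∣ψz : + m ∣ ψ z
        m∣ψz = ∣-diff′ (θ≡1 (ψ z)) (∣m+n∣m⇒∣n {m = weight t a₁} (∣-trans (tower-∣ t) ψ-split) (weight-∣ t a₁))
        S = Basis.gen BS z m∣ψz
        b′ = proj₁ S
        K = kernel-solve t a₁ (∣m+n∣n⇒∣m {m = weight t a₁} ψ-split (θ-∣ m∣ψz))
        b = proj₁ K
        left : n ⊢ lin (C t) a₁ (chains t) ≈ lin (C t) b (kernelChains t 𝟘)
        left = ≈sym (≈trans (≈sym (≈trans (⊞-cong ≈refl (•-𝟘 _)) (⊞-idʳ _)))
          (≈trans (lin-kernelChains t 𝟘 b) (lin-coeff (C t) (chains t) (proj₁ (proj₂ K)))))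
        right : n ⊢ lin p a₂ (mulExp θ ∘ E) ≈ lin p b′ (mulExp θ ∘ H)
        right = ≈trans (≡⇒≈ (sym (mulExp-lin θ p a₂ E)))
          (≈trans (mulExp-cong θ h (proj₂ S)) (≡⇒≈ (mulExp-lin θ p b′ H)))
      ind′ : ∀ a → n ⊢ lin (C t ⊎ᵤ p) a (kernelGens t) ≈ 𝟘 → ∀ i → kernelOrders t i ∣ a i
      ind′ a eq = [ kernelOrder-∣ t 0 a₁ (λ c → Basis.ind full [ kernel-coefficients t a₁ , (λ _ → + 0) ] combination (inj₁ c)) , PS∣a₂ ]
        where
        a₁ = a ∘ inj₁
        a₂ = a ∘ inj₂
        PS∣a₂ : ∀ i → PS i ∣ a₂ i
        PS∣a₂ = Basis.ind BS a₂ (≈trans (lin-congₘ p a₂ (λ i → ≈sym (mulExp-≈ θ θ≡1 (H i))))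
          (≈trans (≈sym (⊞-idˡ _)) (≈trans (⊞-cong (≈sym (ModuleSolver.lin-zero m (C t) a₁ _
            (λ c → ≈trans (•-cong _ (kernelChains-vanish t 𝟘 ≈refl c)) (ModuleSolver.•-𝟘 m _)))) ≈refl)
            (weaken (tower-∣ t) eq))))
          where lin-congₘ = ModuleSolver.lin-cong m
        combination : n ⊢ lin (C t) (kernel-coefficients t a₁) (chains t) ⊞ lin p (λ _ → + 0) (mulExp θ ∘ E) ≈ 𝟘
        combination = begin
          lin (C t) (kernel-coefficients t a₁) (chains t) ⊞ lin p (λ _ → + 0) (mulExp θ ∘ E)
            ≈⟨ ⊞-cong (≈sym (lin-kernelChains t 𝟘 a₁)) (lin-zero p _ _ (λ _ → •-zero _)) ⟩
          (lin (C t) a₁ (kernelChains t 𝟘) ⊞ head t a₁ • 𝟘) ⊞ 𝟘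
            ≈⟨ ⊞-cong (≈trans (⊞-cong ≈refl (•-𝟘 _)) (⊞-idʳ _)) (≈sym (lin-zero p a₂ _ (λ i → ∣•-vanish (PS∣a₂ i) (per i)))) ⟩
          lin (C t ⊎ᵤ p) a (kernelGens t)  ≈⟨ eq ⟩
          𝟘 ∎

-- One division step: leaves, representatives and the generators X

∣ℕ⇒∣ℤ : ∀ {a b} → a ℕD.∣ b → + a ∣ + b
∣ℕ⇒∣ℤ = ∣ᵤ⇒∣

private
  bézout-ℕ : ∀ {g a b} → Bézout.Identity g a b → Σ ℤ λ x → + a ∣ + g - + b * x
  bézout-ℕ {g} {a} {b} (Bézout.+- x y eq) = - + y , ∣-by (+ x) (trans (lem (+ g) (+ b) (+ y))
      (trans (cong (λ w → + g + w) (sym (ℤP.pos-* y b))) (trans (cong +_ eq) (ℤP.pos-* x a))))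
    where lem : ∀ g b y → g - b * (- y) ≡ g + y * b
          lem = solve-∀
  bézout-ℕ {g} {a} {b} (Bézout.-+ x y eq) = + y , ∣-by (- + x) (trans (cong (λ w → + g - w)
      (trans (ℤP.*-comm (+ b) (+ y)) (trans (sym (ℤP.pos-* y b)) (trans (cong +_ (sym eq)) (cong (λ w → + g + w) (ℤP.pos-* x a))))))
      (lem (+ g) (+ x) (+ a)))
    where lem : ∀ g x a → g - (g + x * a) ≡ (- x) * a
          lem = solve-∀

bézout : ∀ a b → Σ ℤ λ x → + a ∣ (+ gcd a (∣ b ∣)) - b * x
bézout a (+ k) = bézout-ℕ (Bézout.identity (gcd-GCD a k))
bézout a -[1+ k ] = let (x , p) = bézout-ℕ (Bézout.identity (gcd-GCD a (suc k))) in
  - x , ∣-resp (cong (λ w → + gcd a (suc k) - w) (lem (+ suc k) x)) p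
  where lem : ∀ b x → b * x ≡ (- b) * (- x)
        lem = solve-∀

lookup-injective : ∀ {A : Set} {xs : List A} → Unique xs → ∀ i j → List.lookup xs i ≡ List.lookup xs j → i ≡ j
lookup-injective (x∉xs ∷ u) Fin.zero    Fin.zero    eq = refl
lookup-injective {xs = x List.∷ xs} (x∉xs ∷ u) Fin.zero (Fin.suc j) eq = ⊥-elim (All.lookup x∉xs (∈-lookup {xs = xs} j) eq)
lookup-injective {xs = x List.∷ xs} (x∉xs ∷ u) (Fin.suc i) Fin.zero eq = ⊥-elim (All.lookup x∉xs (∈-lookup {xs = xs} i) (sym eq))
lookup-injective (x∉xs ∷ u) (Fin.suc i) (Fin.suc j) eq = cong Fin.suc (lookup-injective u i j eq)

-- The non-leaves d₀ u, the chosen leaves (those below n₁ not divisible by d₁), the leaf w⋆ and the remaining leaves W.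
module Leaves (n n₁ d₀ d₁ n₂ w⋆ : ℕ) .{{_ : ℕ.NonZero d₀}} .{{_ : ℕ.NonZero d₁}}
              (n≡ : n ≡ d₀ ℕ.* n₁) (n₁≡ : n₁ ≡ d₁ ℕ.* n₂) (d₁∣d₀ : d₁ ℕD.∣ d₀) (w⋆<n : w⋆ < n) (d₀∤w⋆ : ¬ d₀ ℕD.∣ w⋆)
              (w⋆-unchosen : ¬ (w⋆ < n₁ × ¬ d₁ ℕD.∣ w⋆)) where

  Remaining : ℕ → Set
  Remaining w = ¬ d₀ ℕD.∣ w × ¬ (w < n₁ × ¬ d₁ ℕD.∣ w) × w ≢ w⋆

  remaining? : ∀ w → Dec (Remaining w)
  remaining? w = ¬? (d₀ ℕD.∣? w) ×-dec ¬? ((w ℕ.<? n₁) ×-dec ¬? (d₁ ℕD.∣? w)) ×-dec ¬? (w ℕ.≟ w⋆)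

  W : List ℕ
  W = filter remaining? (upTo n)

  W-unique : Unique W
  W-unique = Uniqueₚ.filter⁺ remaining? (Uniqueₚ.upTo⁺ n)

  ∈W⁻ : ∀ {w} → w ∈ W → w < n × Remaining w
  ∈W⁻ p = let (q , r) = ∈-filter⁻ remaining? {xs = upTo n} p in ∈-upTo⁻ q , r

  ∈W⁺ : ∀ {w} → w < n → Remaining w → w ∈ W
  ∈W⁺ p r = ∈-filter⁺ remaining? (∈-upTo⁺ p) r

  private
    undivided? : ∀ w → Dec (¬ d₁ ℕD.∣ w)
    undivided? w = ¬? (d₁ ℕD.∣? w)

    chosen : List ℕ
    chosen = filter undivided? (upTo n₁)

    multiples : ℕ → ℕ → List ℕ
    multiples c k = List.map (c ℕ.*_) (upTo k)

    multiples-unique : ∀ c k .{{_ : ℕ.NonZero c}} → Unique (multiples c k)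
    multiples-unique c k = Uniqueₚ.map⁺ (λ {x} {y} → ℕP.*-cancelˡ-≡ x y c) (Uniqueₚ.upTo⁺ k)

    ∈multiples⁻ : ∀ c k {w} .{{_ : ℕ.NonZero c}} → w ∈ multiples c k → w < c ℕ.* k × c ℕD.∣ w
    ∈multiples⁻ c k p with ∈-map⁻ (c ℕ.*_) p
    ... | x , q , refl = ℕP.*-monoʳ-< c (∈-upTo⁻ q) , ℕD.m∣m*n x

    ∈multiples⁺ : ∀ c k {w} .{{_ : ℕ.NonZero c}} → w < c ℕ.* k → c ℕD.∣ w → w ∈ multiples c k
    ∈multiples⁺ c k {w} lt (ℕD.divides q eq) rewrite trans eq (ℕP.*-comm q c) =
      ∈-map⁺ (c ℕ.*_) (∈-upTo⁺ (ℕP.*-cancelˡ-< c q k lt))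

    same-length : ∀ {xs ys : List ℕ} → Unique xs → Unique ys → (∀ {x} → x ∈ xs → x ∈ ys) → (∀ {x} → x ∈ ys → x ∈ xs) →
                  length xs ≡ length ys
    same-length u v f g = ↭-length (∼bag⇒↭ (unique∧set⇒bag u v (mk⇔ f g)))

    n₁≤n : n₁ ≤ n
    n₁≤n = subst (n₁ ≤_) (sym n≡) (ℕP.m≤n*m n₁ d₀)

    chosen⁻ : ∀ {w} → w ∈ chosen → w < n₁ × ¬ d₁ ℕD.∣ w
    chosen⁻ p = let (q , r) = ∈-filter⁻ undivided? {xs = upTo n₁} p in ∈-upTo⁻ q , r

    length-n₁ : length (upTo n₁) ≡ length (chosen ++ multiples d₁ n₂)
    length-n₁ = same-length (Uniqueₚ.upTo⁺ n₁)
      (Uniqueₚ.++⁺ (Uniqueₚ.filter⁺ undivided? (Uniqueₚ.upTo⁺ n₁)) (multiples-unique d₁ n₂)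
        λ (p , q) → proj₂ (chosen⁻ p) (proj₂ (∈multiples⁻ d₁ n₂ q)))
      to from
      where
      to : ∀ {x} → x ∈ upTo n₁ → x ∈ chosen ++ multiples d₁ n₂
      to {x} p with d₁ ℕD.∣? x
      ... | yes q = ∈-++⁺ʳ chosen (∈multiples⁺ d₁ n₂ (subst (x <_) n₁≡ (∈-upTo⁻ p)) q)
      ... | no ¬q = ∈-++⁺ˡ (∈-filter⁺ undivided? p ¬q)
      from : ∀ {x} → x ∈ chosen ++ multiples d₁ n₂ → x ∈ upTo n₁
      from {x} p with ∈-++⁻ chosen p
      ... | inj₁ q = ∈-upTo⁺ (proj₁ (chosen⁻ q))
      ... | inj₂ q = ∈-upTo⁺ (subst (x <_) (sym n₁≡) (proj₁ (∈multiples⁻ d₁ n₂ q)))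

    length-n : length (upTo n) ≡ length ((w⋆ List.∷ W) ++ chosen ++ multiples d₀ n₁)
    length-n = same-length (Uniqueₚ.upTo⁺ n)
      (Uniqueₚ.++⁺ (All.tabulate (λ p eq → proj₂ (proj₂ (proj₂ (∈W⁻ p))) (sym eq)) ∷ W-unique)
        (Uniqueₚ.++⁺ (Uniqueₚ.filter⁺ undivided? (Uniqueₚ.upTo⁺ n₁)) (multiples-unique d₀ n₁)
          λ (p , q) → proj₂ (chosen⁻ p) (ℕD.∣-trans d₁∣d₀ (proj₂ (∈multiples⁻ d₀ n₁ q))))
        apart)
      to from
      where
      apart : ∀ {x} → (x ∈ w⋆ List.∷ W) × (x ∈ chosen ++ multiples d₀ n₁) → ⊥
      apart (p , q) with ∈-++⁻ chosen q
      apart (here refl , q) | inj₁ r = w⋆-unchosen (chosen⁻ r)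
      apart (there p , q)   | inj₁ r = proj₁ (proj₂ (proj₂ (∈W⁻ p))) (chosen⁻ r)
      apart (here refl , q) | inj₂ r = d₀∤w⋆ (proj₂ (∈multiples⁻ d₀ n₁ r))
      apart (there p , q)   | inj₂ r = proj₁ (proj₂ (∈W⁻ p)) (proj₂ (∈multiples⁻ d₀ n₁ r))
      to : ∀ {x} → x ∈ upTo n → x ∈ (w⋆ List.∷ W) ++ chosen ++ multiples d₀ n₁
      to {x} p with d₀ ℕD.∣? x | (x ℕ.<? n₁) ×-dec undivided? x | x ℕ.≟ w⋆
      ... | yes q | _ | _ = ∈-++⁺ʳ (w⋆ List.∷ W) (∈-++⁺ʳ chosen (∈multiples⁺ d₀ n₁ (subst (x <_) n≡ (∈-upTo⁻ p)) q))
      ... | no _ | yes (q , r) | _ = ∈-++⁺ʳ (w⋆ List.∷ W) (∈-++⁺ˡ (∈-filter⁺ undivided? (∈-upTo⁺ q) r))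
      ... | no _ | no _ | yes refl = here refl
      ... | no a | no b | no c = there (∈-++⁺ˡ (∈W⁺ (∈-upTo⁻ p) (a , b , c)))
      from : ∀ {x} → x ∈ (w⋆ List.∷ W) ++ chosen ++ multiples d₀ n₁ → x ∈ upTo n
      from {x} (here refl) = ∈-upTo⁺ w⋆<n
      from {x} (there p) with ∈-++⁻ W p
      ... | inj₁ q = ∈-upTo⁺ (proj₁ (∈W⁻ q))
      ... | inj₂ q with ∈-++⁻ chosen q
      ...   | inj₁ r = ∈-upTo⁺ (ℕP.<-≤-trans (proj₁ (chosen⁻ r)) n₁≤n)
      ...   | inj₂ r = ∈-upTo⁺ (subst (x <_) (sym n≡) (proj₁ (∈multiples⁻ d₀ n₁ r)))

  -- The residues below n are `w⋆`, `W`, the chosen ones and n₁ multiples of d₀; those below n₁ are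
  -- the chosen ones and n₂ multiples of d₁. Eliminating the number of chosen ones gives the
  -- exponent n - 2 n₁ + n₂.
  count-leaves : suc (length W) ℕ.+ 2 ℕ.* n₁ ≡ n ℕ.+ n₂
  count-leaves = begin
    suc (length W) ℕ.+ 2 ℕ.* n₁                    ≡⟨ cong (λ k → suc (length W) ℕ.+ (n₁ ℕ.+ k)) (ℕP.+-identityʳ n₁) ⟩
    suc (length W) ℕ.+ (n₁ ℕ.+ n₁)                 ≡⟨ cong (λ k → suc (length W) ℕ.+ (k ℕ.+ n₁)) n₁-split ⟩
    suc (length W) ℕ.+ ((length chosen ℕ.+ n₂) ℕ.+ n₁) ≡⟨ cong (suc (length W) ℕ.+_) (ℕP.+-assoc (length chosen) n₂ n₁) ⟩
    suc (length W) ℕ.+ (length chosen ℕ.+ (n₂ ℕ.+ n₁)) ≡⟨ cong (λ k → suc (length W) ℕ.+ (length chosen ℕ.+ k)) (ℕP.+-comm n₂ n₁) ⟩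
    suc (length W) ℕ.+ (length chosen ℕ.+ (n₁ ℕ.+ n₂)) ≡⟨ cong (suc (length W) ℕ.+_) (ℕP.+-assoc (length chosen) n₁ n₂) ⟨
    suc (length W) ℕ.+ ((length chosen ℕ.+ n₁) ℕ.+ n₂) ≡⟨ ℕP.+-assoc (suc (length W)) _ n₂ ⟨
    suc (length W) ℕ.+ (length chosen ℕ.+ n₁) ℕ.+ n₂   ≡⟨ cong (ℕ._+ n₂) n-split ⟨
    n ℕ.+ n₂ ∎
    where
    open ≡-Reasoning
    length-multiples : ∀ c k → length (multiples c k) ≡ k
    length-multiples c k = trans (length-map (c ℕ.*_) (upTo k)) (length-upTo k)
    n₁-split : n₁ ≡ length chosen ℕ.+ n₂
    n₁-split = trans (sym (length-upTo n₁)) (trans length-n₁ (trans (length-++ chosen) (cong (length chosen ℕ.+_) (length-multiples d₁ n₂))))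
    n-split : n ≡ suc (length W) ℕ.+ (length chosen ℕ.+ n₁)
    n-split = trans (sym (length-upTo n)) (trans length-n (cong suc (trans (length-++ W)
      (cong (length W ℕ.+_) (trans (length-++ chosen) (cong (length chosen ℕ.+_) (length-multiples d₀ n₁)))))))

module Representatives (n₁ d₁ : ℕ) .{{_ : ℕ.NonZero n₁}} (x₀ : ℤ) where
  private
    -- A class of multiples of d₁ modulo n₁ is to be represented inside the multiples of d₀. For a =
    -- q d₁ the representative is q (d₁ + n₁ x₀), where x₀ is chosen so that d₀ ∣ d₁ + n₁ x₀. Every
    -- other class is represented by its residue, a chosen leaf.
    represent : ∀ a → Dec (d₁ ℕD.∣ a) → ℤ
    represent a (yes (ℕD.divides q _)) = + a + + n₁ * (x₀ * + q)
    represent a (no _)                 = + a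

    represent-≡ : ∀ a d? → + n₁ ∣ + a - represent a d?
    represent-≡ a (yes (ℕD.divides q _)) = ∣-by (- (x₀ * + q)) (lem (+ a) (+ n₁) (x₀ * + q))
      where lem : ∀ a n x → a - (a + n * x) ≡ (- x) * n
            lem = solve-∀
    represent-≡ a (no _) = ∣-resp (sym (ℤP.+-inverseʳ (+ a))) ∣-zero

    represent-no : ∀ a d? → ¬ d₁ ℕD.∣ a → represent a d? ≡ + a
    represent-no a (yes p) ¬p = ⊥-elim (¬p p)
    represent-no a (no _)  ¬p = refl

    represent-yes : ∀ {d₀} a d? → d₁ ℕD.∣ a → d₀ ∣ + d₁ + + n₁ * x₀ → d₀ ∣ represent a d?
    represent-yes a (yes (ℕD.divides q eq)) _ p = ∣-resp (sym (trans (cong (λ w → w + + n₁ * (x₀ * + q)) (trans (cong +_ eq) (ℤP.pos-* q d₁)))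
        (lem (+ q) (+ d₁) (+ n₁) x₀))) (∣n⇒∣m*n (+ q) p)
      where lem : ∀ q d n x → q * d + n * (x * q) ≡ q * (d + n * x)
            lem = solve-∀
    represent-yes a (no ¬p) p _ = ⊥-elim (¬p p)

    represent-zero : .{{_ : ℕ.NonZero d₁}} → ∀ d? → represent 0 d? ≡ + 0
    represent-zero (yes (ℕD.divides q eq)) = trans (ℤP.+-identityˡ (+ n₁ * (x₀ * + q)))
      (trans (cong (λ w → + n₁ * (x₀ * + w)) (ℕP.m*n≡0⇒m≡0 q d₁ (sym eq)))
        (trans (cong (+ n₁ *_) (ℤP.*-zeroʳ x₀)) (ℤP.*-zeroʳ (+ n₁))))
    represent-zero (no _) = refl

  abstract
    r : ℤ → ℤ
    r v = represent (v %ℕ n₁) (d₁ ℕD.∣? (v %ℕ n₁))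

    r-≡ : ∀ v → + n₁ ∣ v - r v
    r-≡ v = ∣-chain v (+ (v %ℕ n₁)) (r v) (residue-∣ n₁ v) (represent-≡ _ (d₁ ℕD.∣? (v %ℕ n₁)))

    r-cong : ∀ v w → + n₁ ∣ v - w → r v ≡ r w
    r-cong v w p = cong (λ a → represent a (d₁ ℕD.∣? a)) (residue-cong n₁ v w p)

    r-unchosen : ∀ v → ¬ d₁ ℕD.∣ v %ℕ n₁ → r v ≡ + (v %ℕ n₁)
    r-unchosen v = represent-no _ (d₁ ℕD.∣? (v %ℕ n₁))

    r-chosen : ∀ {d₀} v → d₁ ℕD.∣ v %ℕ n₁ → d₀ ∣ + d₁ + + n₁ * x₀ → d₀ ∣ r v
    r-chosen v = represent-yes _ (d₁ ℕD.∣? (v %ℕ n₁))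

    r-zero : .{{_ : ℕ.NonZero d₁}} → ∀ v → v %ℕ n₁ ≡ 0 → r v ≡ + 0
    r-zero v eq = trans (cong (λ a → represent a (d₁ ℕD.∣? a)) eq) (represent-zero (d₁ ℕD.∣? 0))

indicator : ∀ {P : Set} → Dec P → ℤ
indicator (yes _) = + 1
indicator (no _)  = + 0

indicator-yes : ∀ {P : Set} (p? : Dec P) → P → indicator p? ≡ + 1
indicator-yes (yes _) p = refl
indicator-yes (no ¬p) p = ⊥-elim (¬p p)

indicator-no : ∀ {P : Set} (p? : Dec P) → ¬ P → indicator p? ≡ + 0
indicator-no (yes p) ¬p = ⊥-elim (¬p p)
indicator-no (no _)  ¬p = refl

indicator-⇔ : ∀ {P Q : Set} (p? : Dec P) (q? : Dec Q) → (P → Q) → (Q → P) → indicator p? ≡ indicator q?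
indicator-⇔ (yes p) q? f g = sym (indicator-yes q? (f p))
indicator-⇔ (no ¬p) q? f g = sym (indicator-no q? (¬p ∘ g))

module Construct (d : ℤ) (n n₁ d₀ d₁ n₂ : ℕ) .{{n≢0 : ℕ.NonZero n}} .{{n₁≢0 : ℕ.NonZero n₁}}
                 .{{d₀≢0 : ℕ.NonZero d₀}} .{{d₁≢0 : ℕ.NonZero d₁}}
                 (n≡ : n ≡ d₀ ℕ.* n₁) (n₁≡ : n₁ ≡ d₁ ℕ.* n₂) (d₀≡ : d₀ ≡ gcd n (∣ d ∣)) (d₁≡ : d₁ ≡ gcd n₁ (∣ d ∣))
                 (d₀≢1 : d₀ ≢ 1) where
  open Dune d
  open Bases d
  open Towers d

  private
    n≡ℤ : + n ≡ + d₀ * + n₁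
    n≡ℤ = trans (cong +_ n≡) (ℤP.pos-* d₀ n₁)

    d₀∣d : + d₀ ∣ d
    d₀∣d = ∣ᵤ⇒∣ (subst (ℕD._∣ ∣ d ∣) (sym d₀≡) (gcd[m,n]∣n n (∣ d ∣)))

    d₀∣n : + d₀ ∣ + n
    d₀∣n = ∣-by (+ n₁) (trans n≡ℤ (ℤP.*-comm (+ d₀) (+ n₁)))

    d′ : ℤ
    d′ = quotient d₀∣d

    d≡ : d ≡ + d₀ * d′
    d≡ = trans (_∣_.equality d₀∣d) (ℤP.*-comm d′ (+ d₀))

    d₁∣d₀ : d₁ ℕD.∣ d₀
    d₁∣d₀ = subst₂ ℕD._∣_ (sym d₁≡) (sym d₀≡) (gcd-greatest
      (ℕD.∣-trans (gcd[m,n]∣m n₁ (∣ d ∣)) (ℕD.divides d₀ n≡)) (gcd[m,n]∣n n₁ (∣ d ∣)))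

    x : ℤ
    x = proj₁ (bézout n d)

    n∣d₀-dx : + n ∣ + d₀ - d * x
    n∣d₀-dx = subst (λ g → + n ∣ + g - d * x) (sym d₀≡) (proj₂ (bézout n d))

    n₁∣1-d′x : + n₁ ∣ + 1 - d′ * x
    n₁∣1-d′x = *-cancelˡ-∣ (+ d₀) (subst₂ _∣_ n≡ℤ (trans (cong (λ w → + d₀ - w * x) d≡) (lem (+ d₀) d′ x)) n∣d₀-dx)
      where lem : ∀ a d x → a - a * d * x ≡ a * (+ 1 - d * x)
            lem = solve-∀

    -- Dividing by d₀ turns the premise into d′ a ≡ 0 modulo n₁, and d′ is a unit there.
    cancel : ∀ a → + n ∣ d * a → + n₁ ∣ a
    cancel a p = ∣-diff {b = d′ * x * a} (∣-resp (lem₁ d′ x a) (∣m⇒∣m*n a n₁∣1-d′x)) (∣-resp (lem₂ x d′ a) (∣n⇒∣m*n x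
        (*-cancelˡ-∣ (+ d₀) (subst₂ _∣_ n≡ℤ (trans (cong (_* a) d≡) (ℤP.*-assoc (+ d₀) d′ a)) p))))
      where lem₁ : ∀ d x a → (+ 1 - d * x) * a ≡ a - d * x * a
            lem₁ = solve-∀
            lem₂ : ∀ x d a → x * (d * a) ≡ d * x * a
            lem₂ = solve-∀

    image : ∀ v → + d₀ ∣ v → Σ ℤ λ a → + n ∣ v - d * a
    image v (divides q eq) = q * x , ∣-resp (trans (lem q (+ d₀) d x) (cong (λ w → w - d * (q * x)) (sym eq))) (∣n⇒∣m*n q n∣d₀-dx)
      where lem : ∀ q a d x → q * (a - d * x) ≡ q * a - d * (q * x)
            lem = solve-∀

    image? : ∀ v → Dec (+ d₀ ∣ v) → Dec (Σ ℤ λ a → + n ∣ v - d * a)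
    image? v (yes p) = yes (image v p)
    image? v (no ¬p) = no λ (a , q) → ¬p (∣-diff {b = d * a} (∣-trans d₀∣n q) (∣m⇒∣m*n a d₀∣d))

    -- Bézout gives d₁ ≡ d z modulo n₁, and d₀ divides d.
    y : Σ ℤ λ x₀ → + d₀ ∣ + d₁ + + n₁ * x₀
    y = y′ (proj₂ (bézout n₁ d))
      where
      z = proj₁ (bézout n₁ d)
      y′ : + n₁ ∣ (+ gcd n₁ (∣ d ∣)) - d * z → Σ ℤ λ x₀ → + d₀ ∣ + d₁ + + n₁ * x₀
      y′ (divides q eq) = - q , ∣-resp (trans (sym (lem (+ d₁) (d * z))) (cong (λ w → + d₁ - w)
            (trans (subst (λ g → + g - d * z ≡ q * + n₁) (sym d₁≡) eq) (ℤP.*-comm q (+ n₁))) ∙ lem₂ (+ d₁) (+ n₁) q)) (∣m⇒∣m*n z d₀∣d)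
        where lem : ∀ a b → a - (a - b) ≡ b
              lem = solve-∀
              lem₂ : ∀ a n q → a - n * q ≡ a + n * (- q)
              lem₂ = solve-∀
              _∙_ = trans

  open Representatives n₁ d₁ (proj₁ y)

  private
    -- The chord of `w⋆` must have weight n₁ exactly, so a leaf just above n₁ is taken: n₁ itself,
    -- represented by 0, if d₁ = 1; otherwise n₁ + 1, represented by 1, as d₁ does not divide 1.
    -- Being at least n₁, it is not chosen.
    special : Dec (d₁ ≡ 1) → Σ ℕ λ w⋆ → w⋆ < n × (¬ d₀ ℕD.∣ w⋆) × (¬ (w⋆ < n₁ × ¬ d₁ ℕD.∣ w⋆)) × + w⋆ - r (+ w⋆) ≡ + n₁
    special (yes d₁≡1) = n₁ , n₁<n , d₀∤n₁ , (λ (p , _) → ℕP.<-irrefl refl p) , trans (cong (λ w → + n₁ - w) (r-zero (+ n₁) (ℕM.n%n≡0 n₁))) (ℤP.+-identityʳ (+ n₁))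
      where
      n₁<n : n₁ < n
      n₁<n = subst (n₁ <_) (trans (ℕP.*-comm n₁ d₀) (sym n≡)) (ℕP.m<m*n n₁ d₀ (ℕP.≤∧≢⇒< (ℕ.>-nonZero⁻¹ d₀) (d₀≢1 ∘ sym)))
      d₀∤n₁ : ¬ d₀ ℕD.∣ n₁
      d₀∤n₁ p = d₀≢1 (ℕD.∣1⇒≡1 (subst (d₀ ℕD.∣_) (trans (sym d₁≡) d₁≡1)
        (gcd-greatest p (∣⇒∣ᵤ d₀∣d))))
    special (no d₁≢1) = suc n₁ , lt , d₀∤ , (λ (p , _) → ℕP.<-irrefl refl (ℕP.<-trans p (ℕP.n<1+n n₁))) ,
        trans (cong (λ w → + suc n₁ - w) (trans (r-unchosen (+ suc n₁) (d₁∤1 ∘ subst (d₁ ℕD.∣_) residue)) (cong +_ residue))) refl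
      where
      2≤d₁ : 2 ≤ d₁
      2≤d₁ = ℕP.≤∧≢⇒< (ℕ.>-nonZero⁻¹ d₁) (d₁≢1 ∘ sym)
      2≤d₀ : 2 ≤ d₀
      2≤d₀ = ℕP.≤∧≢⇒< (ℕ.>-nonZero⁻¹ d₀) (d₀≢1 ∘ sym)
      2≤n₁ : 2 ≤ n₁
      2≤n₁ = ℕP.≤-trans 2≤d₁ (ℕD.∣⇒≤ (ℕD.divides n₂ (trans n₁≡ (ℕP.*-comm d₁ n₂))))
      lt : suc n₁ < n
      lt = ℕP.≤-trans (ℕP.+-monoˡ-≤ n₁ 2≤n₁) (subst (n₁ ℕ.+ n₁ ≤_) (sym n≡)
             (subst (_≤ d₀ ℕ.* n₁) (cong (n₁ ℕ.+_) (ℕP.+-identityʳ n₁)) (ℕP.*-monoˡ-≤ n₁ 2≤d₀)))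
      d₁∤1 : ¬ d₁ ℕD.∣ 1
      d₁∤1 p = d₁≢1 (ℕD.∣1⇒≡1 p)
      d₀∤ : ¬ d₀ ℕD.∣ suc n₁
      d₀∤ p = d₁∤1 (ℕD.∣m+n∣m⇒∣n (subst (d₁ ℕD.∣_) (ℕP.+-comm 1 n₁) (ℕD.∣-trans d₁∣d₀ p)) (ℕD.divides n₂ (trans n₁≡ (ℕP.*-comm d₁ n₂))))
      residue : (+ suc n₁) %ℕ n₁ ≡ 1
      residue = trans (ℕM.[m+n]%n≡m%n 1 n₁) (ℕM.m<n⇒m%n≡m 2≤n₁)

    abstract
      w⋆ : ℕ
      w⋆ = proj₁ (special (d₁ ℕ.≟ 1))
      w⋆<n : w⋆ < n
      w⋆<n = proj₁ (proj₂ (special (d₁ ℕ.≟ 1)))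
      d₀∤w⋆ : ¬ d₀ ℕD.∣ w⋆
      d₀∤w⋆ = proj₁ (proj₂ (proj₂ (special (d₁ ℕ.≟ 1))))
      w⋆-unchosen : ¬ (w⋆ < n₁ × ¬ d₁ ℕD.∣ w⋆)
      w⋆-unchosen = proj₁ (proj₂ (proj₂ (proj₂ (special (d₁ ℕ.≟ 1)))))
      w⋆-r : + w⋆ - r (+ w⋆) ≡ + n₁
      w⋆-r = proj₂ (proj₂ (proj₂ (proj₂ (special (d₁ ℕ.≟ 1)))))

  open Leaves n n₁ d₀ d₁ n₂ w⋆ n≡ n₁≡ d₁∣d₀ w⋆<n d₀∤w⋆ w⋆-unchosen

  private
    count : ℕ
    count = length W

    leaf : Fin (suc count) → ℕ
    leaf 0F          = w⋆
    leaf (Fin.suc j) = List.lookup W j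

    Leaf : ℕ → Set
    Leaf w = w < n × (¬ d₀ ℕD.∣ w) × (¬ (w < n₁ × ¬ d₁ ℕD.∣ w))

    leaf-Leaf : ∀ i → Leaf (leaf i)
    leaf-Leaf 0F = w⋆<n , d₀∤w⋆ , w⋆-unchosen
    leaf-Leaf (Fin.suc j) = let (p , q , s , _) = ∈W⁻ (∈-lookup {xs = W} j) in p , q , s

    leaf-injective : ∀ i j → leaf i ≡ leaf j → i ≡ j
    leaf-injective 0F 0F eq = refl
    leaf-injective 0F (Fin.suc j) eq = ⊥-elim (proj₂ (proj₂ (proj₂ (∈W⁻ (∈-lookup {xs = W} j)))) (sym eq))
    leaf-injective (Fin.suc i) 0F eq = ⊥-elim (proj₂ (proj₂ (proj₂ (∈W⁻ (∈-lookup {xs = W} i)))) eq)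
    leaf-injective (Fin.suc i) (Fin.suc j) eq = cong Fin.suc (lookup-injective W-unique i j eq)

    chord : ℤ → T
    chord v = e v ⊟ e (r v)

    abstract
      slope : Fin count → ℤ
      slope j = quotient (r-≡ (+ List.lookup W j))

      slope-eq : ∀ j → + List.lookup W j - r (+ List.lookup W j) ≡ slope j * + n₁
      slope-eq j = _∣_.equality (r-≡ (+ List.lookup W j))

    X : Fin (suc count) → T
    X 0F          = chord (+ w⋆)
    X (Fin.suc j) = chord (+ List.lookup W j) ⊟ slope j • chord (+ w⋆)

    as-difference : ∀ a b → a + (- + 1) * b ≡ a - b
    as-difference = solve-∀

    chord-vanish : ∀ v → n₁ ⊢ chord v ≈ 𝟘
    chord-vanish v = ≈trans (⊞-cong (periodic v (r v) (r-≡ v)) ≈refl)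
      (≈trans (ModuleSolver.solveT n₁ 1 (e 0F ⊟ e 0F) ((+ 0) • e 0F) (lookup (e (r v) ∷ [])) (λ f → lem (f 0F))) (•-zero _))
      where lem : ∀ x → x + (- + 1) * x ≡ + 0 * x
            lem = solve-∀

    X-vanish : ∀ i → n₁ ⊢ X i ≈ 𝟘
    X-vanish 0F = chord-vanish (+ w⋆)
    X-vanish (Fin.suc j) = ≈trans (⊞-cong (chord-vanish (+ List.lookup W j)) (•-cong _ (≈trans (•-cong _ (chord-vanish (+ w⋆))) (•-𝟘 _))))
      (≈trans (⊞-idˡ _) (•-𝟘 _))
      where open ModuleSolver n₁

    ψ-special : ψ (X 0F) ≡ + n₁
    ψ-special = trans (as-difference (+ w⋆) (r (+ w⋆))) w⋆-r

    corrected-difference : ∀ {a b s n c} → a - b ≡ s * n → c ≡ n → (a + (- + 1) * b) + (- + 1) * (s * c) ≡ + 0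
    corrected-difference {a} {b} {s} {n} {c} p q =
      trans (cong₂ (λ u v → u + (- + 1) * (s * v)) (trans (as-difference a b) p) q) (lem (s * n))
      where lem : ∀ u → u + (- + 1) * u ≡ + 0
            lem = solve-∀

    ψ-other : ∀ j → ψ (X (Fin.suc j)) ≡ + 0
    ψ-other j = corrected-difference {+ w} {r (+ w)} {slope j} {+ n₁} {ψ (X 0F)} (slope-eq j) ψ-special
      where w = List.lookup W j

    XU : U
    XU = fin (suc count)

    Good : T → Set
    Good z = Σ (⟦ XU ⟧ → ℤ) λ b → Σ T λ ρ → n ⊢ z ≈ lin XU b X ⊞ d • ρ

    open ModuleSolver n

    good-resp : ∀ {y z} → n ⊢ y ≈ z → Good z → Good y
    good-resp p (b , ρ , q) = b , ρ , ≈trans p q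

    good-add : ∀ {y z} → Good y → Good z → Good (y ⊞ z)
    good-add {y} {z} (b , ρ , p) (b′ , ρ′ , p′) = (λ i → b i + b′ i) , ρ ⊞ ρ′ ,
      ≈trans (⊞-cong p p′) (≈trans (⊞-interchange _ _ _ _) (⊞-cong (≈sym (lin-add XU b b′ X)) (≈sym (•-distribˡ d ρ ρ′))))

    good-scale : ∀ a {y} → Good y → Good (a • y)
    good-scale a {y} (b , ρ , p) = (λ i → a * b i) , a • ρ ,
      ≈trans (•-cong a p) (≈trans (•-distribˡ a _ _) (⊞-cong (≈sym (lin-scale XU a b X))
        (≈trans (≈sym (•-assoc a d ρ)) (≈trans (≡⇒≈ (cong (_• ρ) (ℤP.*-comm a d))) (•-assoc d a ρ)))))

    good-X : ∀ i → Good (X i)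
    good-X i = δ {XU} i , 𝟘 , ≈sym (≈trans (⊞-cong (lin-δ XU i X) (•-𝟘 d)) (⊞-idʳ _))

    good-d : ∀ ρ → Good (d • ρ)
    good-d ρ = (λ _ → + 0) , ρ , ≈sym (≈trans (⊞-cong (lin-zero XU _ X λ i → •-zero _) ≈refl) (⊞-idˡ _))

    good-𝟘 : Good 𝟘
    good-𝟘 = good-resp (≈sym (•-𝟘 d)) (good-d 𝟘)

    infix 4 _~_
    _~_ : T → T → Set
    x ~ y = Good (x ⊟ y)

    self-zero : ∀ x → x + (- + 1) * x ≡ + 0 * x
    self-zero = solve-∀

    ≈⇒~ : ∀ {x y} → n ⊢ x ≈ y → x ~ y
    ≈⇒~ {x} {y} p = good-resp (≈trans (⊞-cong p ≈refl)
      (≈trans (solveT 1 (e 0F ⊟ e 0F) ((+ 0) • e 0F) (lookup (y ∷ [])) (λ f → self-zero (f 0F))) (•-zero _))) good-𝟘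

    ~sym : ∀ {x y} → x ~ y → y ~ x
    ~sym {x} {y} p = good-resp (solveT 2 (e 1F ⊟ e 0F) ((- + 1) • (e 0F ⊟ e 1F)) (lookup (x ∷ y ∷ [])) (λ f → lem (f 0F) (f 1F)))
      (good-scale (- + 1) p)
      where lem : ∀ a b → b + (- + 1) * a ≡ (- + 1) * (a + (- + 1) * b)
            lem = solve-∀

    ~trans : ∀ {x y z} → x ~ y → y ~ z → x ~ z
    ~trans {x} {y} {z} p q = good-resp (solveT 3 (e 0F ⊟ e 2F) ((e 0F ⊟ e 1F) ⊞ (e 1F ⊟ e 2F)) (lookup (x ∷ y ∷ z ∷ [])) (λ f → lem (f 0F) (f 1F) (f 2F)))
      (good-add p q)
      where lem : ∀ a b c → a + (- + 1) * c ≡ (a + (- + 1) * b) + (b + (- + 1) * c)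
            lem = solve-∀

    ~⊞ : ∀ {x x′ y y′} → x ~ x′ → y ~ y′ → x ⊞ y ~ x′ ⊞ y′
    ~⊞ {x} {x′} {y} {y′} p q = good-resp (solveT 4 ((e 0F ⊞ e 2F) ⊟ (e 1F ⊞ e 3F)) ((e 0F ⊟ e 1F) ⊞ (e 2F ⊟ e 3F)) (lookup (x ∷ x′ ∷ y ∷ y′ ∷ []))
        (λ f → lem (f 0F) (f 1F) (f 2F) (f 3F))) (good-add p q)
      where lem : ∀ a b c g → (a + c) + (- + 1) * (b + g) ≡ (a + (- + 1) * b) + (c + (- + 1) * g)
            lem = solve-∀

    ~• : ∀ a {x y} → x ~ y → a • x ~ a • y
    ~• a {x} {y} p = good-resp (solveT 2 (a • e 0F ⊟ a • e 1F) (a • (e 0F ⊟ e 1F)) (lookup (x ∷ y ∷ [])) (λ f → lem a (f 0F) (f 1F))) (good-scale a p)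
      where lem : ∀ a b c → a * b + (- + 1) * (a * c) ≡ a * (b + (- + 1) * c)
            lem = solve-∀

    image~ : ∀ v w → + d₀ ∣ v → + d₀ ∣ w → e v ~ e w
    image~ v w p q = ~trans (≈⇒~ (≈trans (periodic v (d * a) (proj₂ (image v p))) (≈sym (e-scale a))))
      (~trans (good-resp (solveT 2 (d • e 0F ⊟ d • e 1F) (d • (e 0F ⊟ e 1F)) (lookup (e a ∷ e b ∷ [])) (λ f → lem d (f 0F) (f 1F))) (good-d (e a ⊟ e b)))
        (≈⇒~ (≈sym (≈trans (periodic w (d * b) (proj₂ (image w q))) (≈sym (e-scale b))))))
      where a = proj₁ (image v p)
            b = proj₁ (image w q)
            lem : ∀ a b c → a * b + (- + 1) * (a * c) ≡ a * (b + (- + 1) * c)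
            lem = solve-∀

    n₁∣n : + n₁ ∣ + n
    n₁∣n = ∣-by (+ d₀) n≡ℤ

    d₁∣n₁ : d₁ ℕD.∣ n₁
    d₁∣n₁ = ℕD.divides n₂ (trans n₁≡ (ℕP.*-comm d₁ n₂))

    -- Non-leaves fall under `image~`, a chosen leaf is its own representative, and the chord of any
    -- other leaf is one of the `X` up to a multiple of the special one.
    chord-below : ∀ w → w < n → Dec (d₀ ℕD.∣ w) → Dec (w < n₁ × ¬ d₁ ℕD.∣ w) → Dec (w ≡ w⋆) → e (+ w) ~ e (r (+ w))
    chord-below w w<n (yes p) _ _ = image~ (+ w) (r (+ w)) (∣ℕ⇒∣ℤ p)
      (r-chosen (+ w) (ℕD.%-presˡ-∣ (ℕD.∣-trans d₁∣d₀ p) d₁∣n₁) (proj₂ y))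
    chord-below w w<n (no _) (yes (lt , nd)) _ = ≈⇒~ (≡⇒≈ (cong e (sym (trans (r-unchosen (+ w) (nd ∘ subst (d₁ ℕD.∣_) small)) (cong +_ small)))))
      where small : (+ w) %ℕ n₁ ≡ w
            small = ℕM.m<n⇒m%n≡m lt
    chord-below w w<n (no _) (no _) (yes refl) = good-X 0F
    chord-below w w<n (no a) (no b) (no c) = good-resp (rearrange (index w∈W) (lookup-index w∈W))
        (good-add (good-X (Fin.suc (index w∈W))) (good-scale (slope (index w∈W)) (good-X 0F)))
      where
      w∈W : w ∈ W
      w∈W = ∈W⁺ w<n (a , b , c)
      lem : ∀ x s c → x ≡ (x + (- + 1) * (s * c)) + s * c
      lem = solve-∀
      rearrange : ∀ j → w ≡ List.lookup W j → n ⊢ chord (+ w) ≈ X (Fin.suc j) ⊞ slope j • X 0F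
      rearrange j refl = solveT 2 (e 0F) ((e 0F ⊟ slope j • e 1F) ⊞ slope j • e 1F) (lookup (chord (+ w) ∷ chord (+ w⋆) ∷ []))
        (λ f → lem (f 0F) (slope j) (f 1F))

    chord~ : ∀ v → e v ~ e (r v)
    chord~ v = ~trans (≈⇒~ (periodic v (+ w) v≡w))
      (~trans (chord-below w (n%ℕd<d v n) (d₀ ℕD.∣? w) ((w ℕ.<? n₁) ×-dec ¬? (d₁ ℕD.∣? w)) (w ℕ.≟ w⋆))
        (≈⇒~ (≡⇒≈ (cong e (sym (r-cong v (+ w) (∣-trans n₁∣n v≡w)))))))
      where w = v %ℕ n
            v≡w = residue-∣ n v

    -- The presentations for n and n₁ differ only in `periodic`, and there `e v ~ e (r v)` with `r`
    -- constant on classes modulo n₁.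
    coarse⇒~ : ∀ {x y} → n₁ ⊢ x ≈ y → x ~ y
    coarse⇒~ ≈refl = ≈⇒~ ≈refl
    coarse⇒~ (≈sym p) = ~sym (coarse⇒~ p)
    coarse⇒~ (≈trans p q) = ~trans (coarse⇒~ p) (coarse⇒~ q)
    coarse⇒~ (⊞-cong p q) = ~⊞ (coarse⇒~ p) (coarse⇒~ q)
    coarse⇒~ (•-cong a p) = ~• a (coarse⇒~ p)
    coarse⇒~ (⊞-assoc x y z) = ≈⇒~ (⊞-assoc x y z)
    coarse⇒~ (⊞-comm x y) = ≈⇒~ (⊞-comm x y)
    coarse⇒~ (⊞-idˡ x) = ≈⇒~ (⊞-idˡ x)
    coarse⇒~ (•-distribˡ a x y) = ≈⇒~ (•-distribˡ a x y)
    coarse⇒~ (•-distribʳ a b x) = ≈⇒~ (•-distribʳ a b x)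
    coarse⇒~ (•-assoc a b x) = ≈⇒~ (•-assoc a b x)
    coarse⇒~ (•-one x) = ≈⇒~ (•-one x)
    coarse⇒~ (•-zero x) = ≈⇒~ (•-zero x)
    coarse⇒~ (periodic v w p) = ~trans (chord~ v) (~trans (≈⇒~ (≡⇒≈ (cong e (r-cong v w p)))) (~sym (chord~ w)))
    coarse⇒~ e-zero = ≈⇒~ e-zero
    coarse⇒~ (e-scale v) = ≈⇒~ (e-scale v)

    kernel : ∀ y → n₁ ⊢ y ≈ 𝟘 → Good y
    kernel y p = good-resp (≈sym (≈trans (⊞-cong ≈refl (•-𝟘 _)) (⊞-idʳ y))) (coarse⇒~ p)

    module _ (w : ℕ) (w-leaf : Leaf w) where
      private
        at : ℤ → ℤ
        at v = indicator (+ n ∣? v - + w)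

        d₀∤ : ∀ {v} → + n ∣ v - + w → ¬ + d₀ ∣ v
        d₀∤ {v} p q = proj₁ (proj₂ w-leaf) (∣⇒∣ᵤ (∣-diff′ {a = v} (∣-trans d₀∣n p) q))

      -- A leaf is never congruent to d v, so its indicator F has F(d v) = 0 and satisfies d F(v) ≡
      -- F(d v) modulo d. It also vanishes on all representatives, hence reads off the coefficient
      -- of a single chord modulo d.
      mark : Functional n d
      mark = record
        { at = at
        ; periodic∣ = λ v v′ p → ∣-resp (sym (ℤP.i≡j⇒i-j≡0 (indicator-⇔ (+ n ∣? v - + w) (+ n ∣? v′ - + w)
            (∣-chain v′ v (+ w) (∣-flip v v′ p)) (∣-chain v v′ (+ w) p)))) ∣-zero
        ; zero∣ = ∣-resp (sym (indicator-no (+ n ∣? + 0 - + w) (λ p → d₀∤ p ∣-zero))) ∣-zero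
        ; scale∣ = λ v → ∣-resp (sym (trans (cong (λ z → d * at v - z)
              (indicator-no (+ n ∣? d * v - + w) (λ p → d₀∤ p (∣m⇒∣m*n v d₀∣d)))) (ℤP.+-identityʳ (d * at v)))) (∣m⇒∣m*n (at v) ∣-refl)
        }

      mark-self : at (+ w) ≡ + 1
      mark-self = indicator-yes (+ n ∣? + w - + w) (∣-resp (sym (ℤP.+-inverseʳ (+ w))) ∣-zero)

      mark-other : ∀ w′ → w′ < n → w′ ≢ w → at (+ w′) ≡ + 0
      mark-other w′ lt ne = indicator-no (+ n ∣? + w′ - + w) (λ p → ne (residue-unique lt (proj₁ w-leaf) p))

      mark-r : ∀ v → at (r v) ≡ + 0
      mark-r v = indicator-no (+ n ∣? r v - + w) (go (d₁ ℕD.∣? (v %ℕ n₁)))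
        where
        go : Dec (d₁ ℕD.∣ v %ℕ n₁) → ¬ + n ∣ r v - + w
        go (yes q) p = d₀∤ p (r-chosen v q (proj₂ y))
        go (no ¬q) p = proj₂ (proj₂ w-leaf) (subst (_< n₁) a≡w a<n₁ , ¬q ∘ subst (d₁ ℕD.∣_) (sym a≡w))
          where
          a<n₁ = n%ℕd<d v n₁
          a≡w : v %ℕ n₁ ≡ w
          a≡w = residue-unique (ℕP.<-≤-trans a<n₁ (ℕD.∣⇒≤ (∣⇒∣ᵤ n₁∣n))) (proj₁ w-leaf)
            (subst (λ z → + n ∣ z - + w) (r-unchosen v ¬q) p)

      mark-chord : ∀ w′ → ev at (chord (+ w′)) ≡ at (+ w′)
      mark-chord w′ = trans (cong (λ z → at (+ w′) + (- + 1) * z) (mark-r (+ w′))) (ℤP.+-identityʳ (at (+ w′)))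

    module _ (b : ⟦ XU ⟧ → ℤ) (z : T) (p : n ⊢ lin XU b X ⊞ d • z ≈ 𝟘) where
      private
        markSum : ∀ w (l : Leaf w) → d ∣ sumU XU (λ i → b i * ev (Functional.at (mark w l)) (X i))
        markSum w l = ∣-resp (ev-lin (Functional.at (mark w l)) XU b X)
          (∣m+n∣n⇒∣m (∣-resp (ℤP.+-identityʳ _) (Functional.at-cong (mark w l) p)) (∣m⇒∣m*n (ev (Functional.at (mark w l)) z) ∣-refl))

        mark-X-special : ∀ j → ev (Functional.at (mark (leaf (Fin.suc j)) (leaf-Leaf (Fin.suc j)))) (X 0F) ≡ + 0
        mark-X-special j = trans (mark-chord w l w⋆) (mark-other w l w⋆ w⋆<n (0≢suc ∘ leaf-injective 0F (Fin.suc j)))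
          where w = leaf (Fin.suc j)
                l = leaf-Leaf (Fin.suc j)
                0≢suc : ∀ {k : Fin count} → Fin.zero ≢ Fin.suc k
                0≢suc ()

        mark-X : ∀ j i → ev (Functional.at (mark (leaf (Fin.suc j)) (leaf-Leaf (Fin.suc j)))) (X (Fin.suc i)) ≡
                         Functional.at (mark (leaf (Fin.suc j)) (leaf-Leaf (Fin.suc j))) (+ leaf (Fin.suc i))
        mark-X j i = trans (cong₂ (λ s t → s + (- + 1) * (slope i * t)) (mark-chord w l (List.lookup W i)) (mark-X-special j))
            (lem (Functional.at (mark w l) (+ List.lookup W i)) (slope i))
          where
          w = leaf (Fin.suc j)
          l = leaf-Leaf (Fin.suc j)
          lem : ∀ a s → a + (- + 1) * (s * + 0) ≡ a
          lem = solve-∀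

        d∣other : ∀ j → d ∣ b (Fin.suc j)
        d∣other j = ∣-resp (trans (cong (b (Fin.suc j) *_) (trans (mark-X j j) (mark-self w l))) (ℤP.*-identityʳ (b (Fin.suc j))))
            (∣-diff′ (sumU-single XU (λ i → b i * ev (Functional.at (mark w l)) (X i)) (Fin.suc j) off) (markSum w l))
          where
          w = leaf (Fin.suc j)
          l = leaf-Leaf (Fin.suc j)
          off : ∀ i → i ≢ Fin.suc j → d ∣ b i * ev (Functional.at (mark w l)) (X i)
          off 0F ne = ∣-resp (sym (trans (cong (b 0F *_) (mark-X-special j)) (ℤP.*-zeroʳ (b 0F)))) ∣-zero
          off (Fin.suc i) ne = ∣-resp (sym (trans (cong (b (Fin.suc i) *_) (trans (mark-X j i)
            (mark-other w l (List.lookup W i) (proj₁ (leaf-Leaf (Fin.suc i))) (λ eq → ne (cong Fin.suc (lookup-injective W-unique i j eq))))))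
            (ℤP.*-zeroʳ (b (Fin.suc i))))) ∣-zero

      independent : ∀ i → d ∣ b i
      independent (Fin.suc j) = d∣other j
      -- The mark at `w⋆` also sees the corrections inside the other `X`; these are harmless because
      -- their coefficients are already known to be multiples of d.
      independent 0F = ∣-resp (trans (cong (b 0F *_) (trans (mark-chord w⋆ (leaf-Leaf 0F) w⋆) (mark-self w⋆ (leaf-Leaf 0F)))) (ℤP.*-identityʳ (b 0F)))
          (∣-diff′ (sumU-single XU (λ i → b i * ev (Functional.at (mark w⋆ (leaf-Leaf 0F))) (X i)) 0F
            λ { 0F ne → ⊥-elim (ne refl) ; (Fin.suc j) _ → ∣m⇒∣m*n _ (d∣other j) }) (markSum w⋆ (leaf-Leaf 0F)))

  level : Level n n₁
  level = record
    { n≢0 = ℕ.≢-nonZero (ℕ.≢-nonZero⁻¹ n) ; d₀ = + d₀ ; d′ = d′ ; n≡ = n≡ℤ ; d≡ = d≡ ; cancel = cancel ; image? = λ v → image? v (+ d₀ ∣? v)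
    ; count = count ; X = X ; X-vanish = X-vanish ; ψ-special = ψ-special ; ψ-other = ψ-other
    ; kernel = kernel ; indep = independent }

  level-count : suc (Level.count level) ℕ.+ 2 ℕ.* n₁ ≡ n ℕ.+ n₂
  level-count = count-leaves

-- The part prime to d

∣-product : ∀ {m a b} c → m ∣ a - b → m ∣ c * a - c * b
∣-product {m} {a} {b} c p = ∣-resp (lem c a b) (∣n⇒∣m*n c p)
  where lem : ∀ c a b → c * (a - b) ≡ c * a - c * b
        lem = solve-∀

pow-1-∣ : ∀ x q → x - + 1 ∣ x ^ q - + 1
pow-1-∣ x zero    = ∣-zero
pow-1-∣ x (suc q) = ∣-chain (x * x ^ q) (x * + 1) (+ 1) (∣-product x (pow-1-∣ x q)) (∣-reflexive (cong (_- + 1) (sym (ℤP.*-identityʳ x))))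

AllPairs-lookup : ∀ {A : Set} {R : A → A → Set} {xs : List A} → AllPairs.AllPairs R xs → ∀ i j → i ≢ j →
                  R (List.lookup xs i) (List.lookup xs j) ⊎ R (List.lookup xs j) (List.lookup xs i)
AllPairs-lookup (r ∷ rs) Fin.zero Fin.zero ne = ⊥-elim (ne refl)
AllPairs-lookup {xs = x List.∷ xs} (r ∷ rs) Fin.zero (Fin.suc j) ne = inj₁ (All.lookup r (∈-lookup {xs = xs} j))
AllPairs-lookup {xs = x List.∷ xs} (r ∷ rs) (Fin.suc i) Fin.zero ne = inj₂ (All.lookup r (∈-lookup {xs = xs} i))
AllPairs-lookup (r ∷ rs) (Fin.suc i) (Fin.suc j) ne = AllPairs-lookup rs i j (ne ∘ cong Fin.suc)

module Orbits (d : ℤ) (m : ℕ) .{{_ : ℕ.NonZero m}} (coprime : gcd m (∣ d ∣) ≡ 1) where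

  private
    x = proj₁ (bézout m d)
    m∣1-dx : + m ∣ + 1 - d * x
    m∣1-dx = subst (λ g → + m ∣ + g - d * x) coprime (proj₂ (bézout m d))

  cancel-d : ∀ a → + m ∣ d * a → + m ∣ a
  cancel-d a p = ∣-diff {b = d * x * a} (∣-resp (lem₁ d x a) (∣m⇒∣m*n a m∣1-dx)) (∣-resp (lem₂ x d a) (∣n⇒∣m*n x p))
    where lem₁ : ∀ d x a → (+ 1 - d * x) * a ≡ a - d * x * a
          lem₁ = solve-∀
          lem₂ : ∀ x d a → x * (d * a) ≡ d * x * a
          lem₂ = solve-∀

  cancel-d^ : ∀ t a → + m ∣ d ^ t * a → + m ∣ a
  cancel-d^ zero    a p = ∣-resp (ℤP.*-identityˡ a) p
  cancel-d^ (suc t) a p = cancel-d^ t a (cancel-d (d ^ t * a) (∣-resp (ℤP.*-assoc d (d ^ t) a) p))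

  module Orbit (v o : ℕ) (orbit : IsOrbitSize m d v o) where
    1≤o : 1 ≤ o
    1≤o = proj₁ orbit

    private
      instance
        o≢0 : ℕ.NonZero o
        o≢0 = ℕ.>-nonZero 1≤o

    closed : + m ∣ (d ^ o - + 1) * + v
    closed = ∣-resp (lem (d ^ o) (+ v)) (∣ᵤ⇒∣ (proj₁ (proj₂ orbit)))
      where lem : ∀ a v → a * v - v ≡ (a - + 1) * v
            lem = solve-∀

    minimal : ∀ t → 1 ≤ t → t < o → ¬ + m ∣ d ^ t * + v - + v
    minimal t p q r = proj₂ (proj₂ orbit) t p q (∣⇒∣ᵤ r)

    reduce : ∀ a → d ^ o - + 1 ∣ d ^ a - d ^ (a ℕ.% o)
    reduce a = ∣-resp (trans (lem (d ^ r) ((d ^ o) ^ q)) (cong (_- d ^ r) (sym d^a))) (∣n⇒∣m*n (d ^ r) (pow-1-∣ (d ^ o) q))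
      where
      r = a ℕ.% o
      q = a ℕ./ o
      d^a : d ^ a ≡ d ^ r * (d ^ o) ^ q
      d^a = trans (cong (d ^_) (ℕM.m≡m%n+[m/n]*n a o)) (trans (ℤP.^-distribˡ-+-* d r (q ℕ.* o))
        (cong (d ^ r *_) (trans (cong (d ^_) (ℕP.*-comm q o)) (sym (ℤP.^-*-assoc d o q)))))
      lem : ∀ r q → r * (q - + 1) ≡ r * q - r
      lem = solve-∀

    act : ∀ {a b} → d ^ o - + 1 ∣ a - b → + m ∣ a * + v - b * + v
    act {a} {b} (divides q eq) = ∣-resp (trans (lem₁ q (d ^ o - + 1) (+ v)) (trans (cong (_* + v) (sym eq)) (lem₂ a b (+ v)))) (∣n⇒∣m*n q closed)
      where lem₁ : ∀ q c v → q * (c * v) ≡ q * c * v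
            lem₁ = solve-∀
            lem₂ : ∀ a b v → (a - b) * v ≡ a * v - b * v
            lem₂ = solve-∀

    private
      no-shorter : ∀ r s → r < s → s < o → ¬ + m ∣ d ^ r * + v - d ^ s * + v
      no-shorter r s r<s s<o p = minimal t (ℕP.m<n⇒0<n∸m r<s) (ℕP.≤-<-trans (ℕP.m∸n≤m s r) s<o)
          (cancel-d^ r (d ^ t * + v - + v) (∣-resp (trans (cong (λ z → z * + v - d ^ r * + v) d^s) (lem (d ^ r) (d ^ t) (+ v)))
            (∣-flip (d ^ r * + v) (d ^ s * + v) p)))
        where
        t = s ℕ.∸ r
        d^s : d ^ s ≡ d ^ r * d ^ t
        d^s = trans (cong (d ^_) (sym (ℕP.m+[n∸m]≡n (ℕP.<⇒≤ r<s)))) (ℤP.^-distribˡ-+-* d r t)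
        lem : ∀ a b v → a * b * v - a * v ≡ a * (b * v - v)
        lem = solve-∀

      residues-agree : ∀ r s → r < o → s < o → + m ∣ d ^ r * + v - d ^ s * + v → r ≡ s
      residues-agree r s r<o s<o p with ℕP.<-cmp r s
      ... | tri< lt _ _ = ⊥-elim (no-shorter r s lt s<o p)
      ... | tri≈ _ eq _ = eq
      ... | tri> _ _ gt = ⊥-elim (no-shorter s r gt r<o (∣-flip (d ^ r * + v) (d ^ s * + v) p))

    -- Both exponents may be reduced modulo o, and by minimality of o powers with different
    -- exponents below o act differently on v.
    faithful : ∀ a b → + m ∣ d ^ a * + v - d ^ b * + v → d ^ o - + 1 ∣ d ^ a - d ^ b
    faithful a b p = ∣-chain (d ^ a) (d ^ (a ℕ.% o)) (d ^ b) (reduce a)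
        (∣-resp (cong (λ k → d ^ k - d ^ b) (sym eq)) (∣-flip (d ^ b) (d ^ (b ℕ.% o)) (reduce b)))
      where
      eq : a ℕ.% o ≡ b ℕ.% o
      eq = residues-agree _ _ (ℕM.m%n<n a o) (ℕM.m%n<n b o)
        (∣-chain (d ^ (a ℕ.% o) * + v) (d ^ a * + v) (d ^ (b ℕ.% o) * + v)
          (∣-flip (d ^ a * + v) (d ^ (a ℕ.% o) * + v) (act {d ^ a} {d ^ (a ℕ.% o)} (reduce a)))
          (∣-chain (d ^ a * + v) (d ^ b * + v) (d ^ (b ℕ.% o) * + v) p (act {d ^ b} {d ^ (b ℕ.% o)} (reduce b))))

    -- `SameOrbit` admits nonnegative exponents only. On the orbit of v the inverse of d^b is d^(o b
    -- - b), because d^(o b) fixes v.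
    reach : ∀ w a b → + m ∣ d ^ a * + w - d ^ b * + v → SameOrbit m d w v
    reach w a b p = c ℕ.+ a , ∣⇒∣ᵤ (∣-resp (cong (λ z → z * + w - + v) (sym (ℤP.^-distribˡ-+-* d c a)))
        (∣-chain (d ^ c * d ^ a * + w) (d ^ c * d ^ b * + v) (+ v)
          (∣-resp (lem (d ^ c) (d ^ a) (d ^ b) (+ w) (+ v)) (∣n⇒∣m*n (d ^ c) p))
          (∣-resp (cong₂ _-_ (cong (_* + v) power) (ℤP.*-identityˡ (+ v))) (act {(d ^ o) ^ b} {+ 1} (pow-1-∣ (d ^ o) b)))))
      where
      c = o ℕ.* b ℕ.∸ b
      power : (d ^ o) ^ b ≡ d ^ c * d ^ b
      power = trans (ℤP.^-*-assoc d o b) (trans (cong (d ^_) (sym (ℕP.m∸n+n≡m (ℕP.m≤n*m b o)))) (ℤP.^-distribˡ-+-* d c b))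
      lem : ∀ c a b w v → c * (a * w - b * v) ≡ c * a * w - c * b * v
      lem = solve-∀

module Periodic (d : ℤ) (m : ℕ) .{{_ : ℕ.NonZero m}} (coprime : gcd m (∣ d ∣) ≡ 1) (o : ℕ → ℕ) (𝒱 : List ℕ)
                (repSet : IsRepSet m d 𝒱) (orbitSize : ∀ v → v ∈ 𝒱 → IsOrbitSize m d v (o v)) where
  open Dune d
  open Bases d
  open Towers d
  open Orbits d m coprime

  PU : U
  PU = fin (length 𝒱)

  rep : ⟦ PU ⟧ → ℕ
  rep = List.lookup 𝒱

  rep∈ : ∀ i → rep i ∈ 𝒱
  rep∈ i = ∈-lookup {xs = 𝒱} i

  E : ⟦ PU ⟧ → T
  E i = e (+ rep i)

  P : ⟦ PU ⟧ → ℤ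
  P i = d ^ o (rep i) - + 1

  module O (i : ⟦ PU ⟧) = Orbit (rep i) (o (rep i)) (orbitSize (rep i) (rep∈ i))

  rep-range : ∀ i → (1 ≤ rep i) × (rep i < m)
  rep-range i = All.lookup (proj₁ repSet) (rep∈ i)

  rep≢0 : ∀ i → ¬ + m ∣ + rep i
  rep≢0 i p = ℕP.<⇒≱ (proj₂ (rep-range i)) (ℕD.∣⇒≤ {{ℕ.>-nonZero (proj₁ (rep-range i))}} (∣⇒∣ᵤ p))

  same-index : ∀ i j a b → + m ∣ d ^ a * + rep i - d ^ b * + rep j → i ≡ j
  same-index i j a b p with i Fin.≟ j
  ... | yes eq = eq
  ... | no ne with AllPairs-lookup (proj₁ (proj₂ (proj₂ repSet))) i j ne
  ...   | inj₁ ¬s = ⊥-elim (¬s (O.reach j (rep i) a b p))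
  ...   | inj₂ ¬s = ⊥-elim (¬s (O.reach i (rep j) b a (∣-flip (d ^ a * + rep i) (d ^ b * + rep j) p)))

  rep-injective : ∀ i j → rep i ≡ rep j → i ≡ j
  rep-injective i j eq = same-index i j 0 0 (∣-resp (sym (ℤP.i≡j⇒i-j≡0 (cong (λ v → + 1 * + v) eq))) ∣-zero)

  private
    Location : ℤ → Set
    Location u = + m ∣ u ⊎ Σ ⟦ PU ⟧ λ j → Σ ℕ λ t → + m ∣ d ^ t * + rep j - u

    locate : ∀ u → Location u
    locate u = go (u %ℕ m) (n%ℕd<d u m) (residue-∣ m u)
      where
      go : ∀ w → w < m → + m ∣ u - + w → Location u
      go zero    lt p = inj₁ (∣-resp (ℤP.+-identityʳ u) p)
      go (suc w) lt p = found (proj₁ (proj₂ repSet) (suc w) (ℕ.s≤s ℕ.z≤n) lt)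
        where
        found : (Σ ℕ λ v → (v ∈ 𝒱) × SameOrbit m d v (suc w)) → Location u
        found (v , v∈ , t , q) = inj₂ (index v∈ , t , ∣-chain (d ^ t * + rep (index v∈)) (+ suc w) u
          (∣-resp (cong (λ z → d ^ t * + z - + suc w) (lookup-index v∈)) (∣ᵤ⇒∣ q)) (∣-flip u (+ suc w) p))

    entry : ∀ {Q : Set} → Dec Q → ℕ → ℤ
    entry (yes _) t = d ^ t
    entry (no _)  t = + 0

    -- The coordinate at i of the symbol of d^t `rep i` is d^t, which `faithful` makes well defined
    -- modulo d^o - 1; symbols of other orbits have coordinate 0.
    value : ∀ {u} → ⟦ PU ⟧ → Location u → ℤ
    value i (inj₁ _)           = + 0
    value i (inj₂ (j , t , _)) = entry (i Fin.≟ j) t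

    entries-agree : ∀ i j s t t′ → (dec : Dec (i ≡ j)) → + m ∣ d ^ s * d ^ t * + rep j - d ^ t′ * + rep j →
                    P i ∣ d ^ s * entry dec t - entry dec t′
    entries-agree i .i s t t′ (yes refl) p = ∣-resp (cong (_- d ^ t′) (ℤP.^-distribˡ-+-* d s t))
      (O.faithful i (s ℕ.+ t) t′ (∣-resp (cong (λ z → z * + rep i - d ^ t′ * + rep i) (sym (ℤP.^-distribˡ-+-* d s t))) p))
    entries-agree i j s t t′ (no _) p = ∣-resp (sym (lem (d ^ s))) ∣-zero
      where lem : ∀ a → a * + 0 - + 0 ≡ + 0
            lem = solve-∀

    -- One statement for two uses: s = 0 gives periodicity and independence of the location found, s
    -- = 1 gives the scaling relation.
    values-agree : ∀ i s {u u′} (L : Location u) (L′ : Location u′) → + m ∣ d ^ s * u - u′ →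
                   P i ∣ d ^ s * value i L - value i L′
    values-agree i s (inj₁ _) (inj₁ _) p = ∣-resp (sym (lem (d ^ s))) ∣-zero
      where lem : ∀ a → a * + 0 - + 0 ≡ + 0
            lem = solve-∀
    values-agree i s {u} {u′} (inj₁ m∣u) (inj₂ (j , t , q)) p =
      ⊥-elim (rep≢0 j (cancel-d^ t (+ rep j) (∣-diff q (∣-diff′ p (∣n⇒∣m*n (d ^ s) m∣u)))))
    values-agree i s {u} {u′} (inj₂ (j , t , q)) (inj₁ m∣u′) p =
      ⊥-elim (rep≢0 j (cancel-d^ t (+ rep j) (∣-diff q (cancel-d^ s u (∣-diff p m∣u′)))))
    values-agree i s {u} {u′} (inj₂ (j , t , q)) (inj₂ (j′ , t′ , q′)) p = merge j′ (same-index j j′ (s ℕ.+ t) t′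
        (∣-resp (cong (λ z → z * + rep j - d ^ t′ * + rep j′) (sym (ℤP.^-distribˡ-+-* d s t))) main)) main
      where
      lem : ∀ a b r u → a * (b * r - u) ≡ a * b * r - a * u
      lem = solve-∀
      main : + m ∣ d ^ s * d ^ t * + rep j - d ^ t′ * + rep j′
      main = ∣-chain (d ^ s * d ^ t * + rep j) (d ^ s * u) (d ^ t′ * + rep j′)
        (∣-resp (lem (d ^ s) (d ^ t) (+ rep j) u) (∣n⇒∣m*n (d ^ s) q))
        (∣-chain (d ^ s * u) u′ (d ^ t′ * + rep j′) p (∣-flip (d ^ t′ * + rep j′) u′ q′))
      merge : ∀ j′ → j ≡ j′ → + m ∣ d ^ s * d ^ t * + rep j - d ^ t′ * + rep j′ →
              P i ∣ d ^ s * entry (i Fin.≟ j) t - entry (i Fin.≟ j′) t′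
      merge .j refl main = entries-agree i j s t t′ (i Fin.≟ j) main

    abstract
      coordinate-at : ⟦ PU ⟧ → ℤ → ℤ
      coordinate-at i u = value i (locate u)

      coordinate-agree : ∀ i s u u′ → + m ∣ d ^ s * u - u′ → P i ∣ d ^ s * coordinate-at i u - coordinate-at i u′
      coordinate-agree i s u u′ = values-agree i s (locate u) (locate u′)

      coordinate-zero : ∀ i → P i ∣ coordinate-at i (+ 0)
      coordinate-zero i = ∣-resp (lem (coordinate-at i (+ 0))) (values-agree i 0 {+ 0} {+ 0} (locate (+ 0)) (inj₁ ∣-zero) ∣-zero)
        where lem : ∀ a → + 1 * a - + 0 ≡ a
              lem = solve-∀

      coordinate-rep : ∀ i j → P i ∣ coordinate-at i (+ rep j) - entry (i Fin.≟ j) 0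
      coordinate-rep i j = ∣-resp (cong (_- entry (i Fin.≟ j) 0) (ℤP.*-identityˡ (coordinate-at i (+ rep j))))
        (values-agree i 0 (locate (+ rep j)) (inj₂ (j , 0 , self)) self)
        where self : + m ∣ + 1 * + rep j - + rep j
              self = ∣-resp (sym (ℤP.i≡j⇒i-j≡0 (ℤP.*-identityˡ (+ rep j)))) ∣-zero

    coordinateFunctional : ∀ i → Functional m (P i)
    coordinateFunctional i = record
      { at = coordinate-at i
      ; periodic∣ = λ v w p → ∣-resp (cong (_- coordinate-at i w) (ℤP.*-identityˡ (coordinate-at i v)))
          (coordinate-agree i 0 v w (∣-resp (cong (_- w) (sym (ℤP.*-identityˡ v))) p))
      ; zero∣ = coordinate-zero i
      ; scale∣ = λ v → ∣-resp (cong (λ z → z * coordinate-at i v - coordinate-at i (d * v)) (ℤP.*-identityʳ d))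
          (coordinate-agree i 1 v (d * v) (∣-resp (sym (ℤP.i≡j⇒i-j≡0 (cong (_* v) (ℤP.*-identityʳ d)))) ∣-zero))
      }

    open ModuleSolver m

    d^•e : ∀ t v → m ⊢ d ^ t • e v ≈ e (d ^ t * v)
    d^•e zero    v = ≈trans (•-one _) (≡⇒≈ (cong e (sym (ℤP.*-identityˡ v))))
    d^•e (suc t) v = ≈trans (•-assoc d (d ^ t) (e v)) (≈trans (•-cong d (d^•e t v))
      (≈trans (e-scale (d ^ t * v)) (≡⇒≈ (cong e (sym (ℤP.*-assoc d (d ^ t) v))))))

    periodic-order : ∀ i → m ⊢ P i • E i ≈ 𝟘
    periodic-order i = ≈trans (solveT 1 ((D - + 1) • e 0F) (D • e 0F ⊟ e 0F) (lookup (E i ∷ [])) (λ f → lem D (f 0F)))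
        (≈trans (⊞-cong (≈trans (d^•e (o (rep i)) (+ rep i)) (periodic (D * + rep i) (+ rep i) (∣-resp (lem₂ D (+ rep i)) (O.closed i)))) ≈refl)
          (≈trans (solveT 1 (e 0F ⊟ e 0F) ((+ 0) • e 0F) (lookup (E i ∷ [])) (λ f → lem₃ (f 0F))) (•-zero _)))
      where
      D = d ^ o (rep i)
      lem : ∀ a x → (a - + 1) * x ≡ a * x + (- + 1) * x
      lem = solve-∀
      lem₂ : ∀ a x → (a - + 1) * x ≡ a * x - x
      lem₂ = solve-∀
      lem₃ : ∀ x → x + (- + 1) * x ≡ + 0 * x
      lem₃ = solve-∀

    generate : ∀ y → Σ (⟦ PU ⟧ → ℤ) λ a → m ⊢ y ≈ lin PU a E
    generate (e u) = go (locate u)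
      where
      go : Location u → Σ (⟦ PU ⟧ → ℤ) λ a → m ⊢ e u ≈ lin PU a E
      go (inj₁ p) = (λ _ → + 0) , ≈trans (periodic u (+ 0) (∣-resp (sym (ℤP.+-identityʳ u)) p))
        (≈trans e-zero (≈sym (lin-zero PU _ E λ _ → •-zero _)))
      go (inj₂ (j , t , p)) = (λ i → d ^ t * δ {PU} j i) , ≈trans (periodic u (d ^ t * + rep j) (∣-flip (d ^ t * + rep j) u p))
        (≈trans (≈sym (d^•e t (+ rep j))) (≈trans (•-cong (d ^ t) (≈sym (lin-δ PU j E))) (≈sym (lin-scale PU (d ^ t) (δ {PU} j) E))))
    generate 𝟘 = (λ _ → + 0) , ≈sym (lin-zero PU _ E λ _ → •-zero _)
    generate (x ⊞ y) = let (a , p) = generate x ; (b , q) = generate y in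
      (λ i → a i + b i) , ≈trans (⊞-cong p q) (≈sym (lin-add PU a b E))
    generate (c • x) = let (a , p) = generate x in (λ i → c * a i) , ≈trans (•-cong c p) (≈sym (lin-scale PU c a E))

    independent : ∀ a → m ⊢ lin PU a E ≈ 𝟘 → ∀ i → P i ∣ a i
    independent a p i = ∣-resp (ℤP.*-identityʳ (a i))
        (∣-diff′ (∣-product (a i) (diagonal (i Fin.≟ i) (coordinate-rep i i)))
          (∣-diff′ (sumU-single PU (λ j → a j * coordinate-at i (+ rep j)) i off)
            (∣-resp (ev-lin (coordinate-at i) PU a E) (∣-resp (ℤP.+-identityʳ _) (Functional.at-cong (coordinateFunctional i) p)))))
      where
      diagonal : ∀ dec → P i ∣ coordinate-at i (+ rep i) - entry {i ≡ i} dec 0 → P i ∣ coordinate-at i (+ rep i) - + 1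
      diagonal (yes _) q = q
      diagonal (no ne) q = ⊥-elim (ne refl)
      off-diagonal : ∀ j dec → j ≢ i → P i ∣ coordinate-at i (+ rep j) - entry {i ≡ j} dec 0 → P i ∣ coordinate-at i (+ rep j)
      off-diagonal j (yes eq) ne q = ⊥-elim (ne (sym eq))
      off-diagonal j (no _) ne q = ∣-resp (ℤP.+-identityʳ _) q
      off : ∀ j → j ≢ i → P i ∣ a j * coordinate-at i (+ rep j)
      off j ne = ∣n⇒∣m*n (a j) (off-diagonal j (i Fin.≟ j) ne (coordinate-rep i j))

  periodicBasis : Basis m (+ 1) PU E P
  periodicBasis = record { mem = λ i → 1∣ _ ; ord = periodic-order ; gen = λ y _ → generate y ; ind = independent }

-- Prime powers

pos-^ : ∀ p k → + (p ℕ.^ k) ≡ (+ p) ^ k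
pos-^ p zero    = refl
pos-^ p (suc k) = trans (ℤP.pos-* p (p ℕ.^ k)) (cong (+ p *_) (pos-^ p k))

geometric : ℤ → ℕ → ℤ
geometric Y zero    = + 0
geometric Y (suc k) = geometric Y k + Y ^ k

geometric-sum : ∀ Y k → (Y - + 1) * geometric Y k ≡ Y ^ k - + 1
geometric-sum Y zero    = ℤP.*-zeroʳ (Y - + 1)
geometric-sum Y (suc k) = trans (ℤP.*-distribˡ-+ (Y - + 1) (geometric Y k) (Y ^ k))
    (trans (cong (_+ (Y - + 1) * Y ^ k) (geometric-sum Y k)) (lem Y (Y ^ k)))
  where lem : ∀ y z → (z - + 1) + (y - + 1) * z ≡ y * z - + 1
        lem = solve-∀

n<p^n : ∀ p n → 2 ≤ p → n < p ℕ.^ n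
n<p^n p zero    h = ℕ.s≤s ℕ.z≤n
n<p^n p (suc n) h = ℕP.≤-trans (ℕP.+-mono-≤ {1} (ℕP.≤-trans (ℕ.s≤s ℕ.z≤n) (n<p^n p n h)) (n<p^n p n h))
  (subst (_≤ p ℕ.* p ℕ.^ n) (cong (p ℕ.^ n ℕ.+_) (ℕP.+-identityʳ (p ℕ.^ n))) (ℕP.*-monoˡ-≤ (p ℕ.^ n) h))

private
  -- The factor 2 comes from clearing the denominator of k (k - 1) / 2 in the expansion of the
  -- geometric sum; it is cancelled here since p is odd.
  odd-quotient : ∀ p s .{{_ : ℤ.NonZero p}} → (∀ b → p ∣ + 2 * b → (p ∣ + 2) ⊎ (p ∣ b)) → ¬ p ∣ + 2 → p * p ∣ + 2 * s - + 2 * p →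
                 Σ ℤ λ G → (¬ p ∣ G) × s ≡ p * G
  odd-quotient p s prm ¬p∣2 q = split ([ (λ r → ⊥-elim (¬p∣2 r)) , id ] (prm s p∣2s))
    where
    p∣2s : p ∣ + 2 * s
    p∣2s = ∣-diff {p} {+ 2 * s} {+ 2 * p} (∣-trans (∣-by p refl) q) (∣n⇒∣m*n (+ 2) (∣-refl {p}))
    lem : ∀ g p → + 2 * (g * p) - + 2 * p ≡ p * (+ 2 * g - + 2)
    lem = solve-∀
    split : p ∣ s → Σ ℤ λ G → (¬ p ∣ G) × s ≡ p * G
    split (divides G eq) = G , (λ r → ¬p∣2 (∣-diff′ {p} {+ 2 * G} {+ 2} p∣2G-2 (∣n⇒∣m*n (+ 2) r))) , trans eq (ℤP.*-comm G p)
      where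
      p∣2G-2 : p ∣ + 2 * G - + 2
      p∣2G-2 = *-cancelˡ-∣ p {p} {+ 2 * G - + 2} (∣-resp (trans (cong (λ z → + 2 * z - + 2 * p) eq) (lem G p)) q)

  two-terms : ∀ X w → X - + 1 ≡ w * + 4 → geometric X 2 ≡ + 2 * (+ 1 + + 2 * w)
  two-terms X w eq = trans (lem₁ X) (trans (cong (_+ + 2) eq) (lem₂ w))
    where lem₁ : ∀ x → + 0 + + 1 + x * + 1 ≡ (x - + 1) + + 2
          lem₁ = solve-∀
          lem₂ : ∀ w → w * + 4 + + 2 ≡ + 2 * (+ 1 + + 2 * w)
          lem₂ = solve-∀

  from-quotient : ∀ X p w → X - + 1 ≡ w * p → + 1 + p * w ≡ X
  from-quotient X p w eq = trans (cong (λ z → + 1 + z) (trans (ℤP.*-comm p w) (sym eq))) (lem X)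
    where lem : ∀ x → + 1 + (x - + 1) ≡ x
          lem = solve-∀

ℕ-ind : ∀ (Q : ℕ → Set) → Q 0 → (∀ k → Q k → Q (suc k)) → ∀ k → Q k
ℕ-ind Q q₀ qs zero    = q₀
ℕ-ind Q q₀ qs (suc k) = qs k (ℕ-ind Q q₀ qs k)

private
  power-step : ∀ p w y k → p * p ∣ y - (+ 1 + k * (p * w)) → p * p ∣ (+ 1 + p * w) * y - (+ 1 + (+ 1 + k) * (p * w))
  power-step p w y k q = ∣-resp (lem p w y k) (∣m∣n⇒∣m+n (∣n⇒∣m*n (+ 1 + p * w) q) (∣n⇒∣m*n (k * w * w) (∣-refl {p * p})))
    where lem : ∀ p w y k → (+ 1 + p * w) * (y - (+ 1 + k * (p * w))) + k * w * w * (p * p) ≡ (+ 1 + p * w) * y - (+ 1 + (+ 1 + k) * (p * w))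
          lem = solve-∀

  geometric-step : ∀ {m} a g y k → m ∣ + 2 * g - (+ 2 * k + k * (k - + 1) * a) → m ∣ y - (+ 1 + k * a) →
                   m ∣ + 2 * (g + y) - (+ 2 * (+ 1 + k) + (+ 1 + k) * ((+ 1 + k) - + 1) * a)
  geometric-step a g y k q r = ∣-resp (lem a g y k) (∣m∣n⇒∣m+n q (∣n⇒∣m*n (+ 2) r))
    where lem : ∀ a g y k → (+ 2 * g - (+ 2 * k + k * (k - + 1) * a)) + + 2 * (y - (+ 1 + k * a)) ≡
                            + 2 * (g + y) - (+ 2 * (+ 1 + k) + (+ 1 + k) * ((+ 1 + k) - + 1) * a)
          lem = solve-∀

module AtPrime (p : ℕ) (pr : Prime p) where

  2≤p : 2 ≤ p
  2≤p = ℕ.nonTrivial⇒n>1 p {{prime⇒nonTrivial pr}}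

  private
    instance
      p≢0 : ℕ.NonZero p
      p≢0 = prime⇒nonZero pr

  prime-∣ : ∀ a b → + p ∣ a * b → (+ p ∣ a) ⊎ (+ p ∣ b)
  prime-∣ a b q with euclidsLemma ∣ a ∣ ∣ b ∣ pr (subst (p ℕD.∣_) (ℤP.abs-* a b) (∣⇒∣ᵤ q))
  ... | inj₁ r = inj₁ (∣ᵤ⇒∣ r)
  ... | inj₂ r = inj₂ (∣ᵤ⇒∣ r)

  p∤1 : ¬ + p ∣ + 1
  p∤1 q = ℕP.<⇒≱ 2≤p (ℕD.∣⇒≤ (∣⇒∣ᵤ q))

  p^k∣^ : ∀ {k l} → k ≤ l → (+ p) ^ k ∣ (+ p) ^ l
  p^k∣^ {k} {l} h = ∣-by ((+ p) ^ (l ℕ.∸ k)) (trans (cong ((+ p) ^_) (sym (ℕP.m∸n+n≡m h))) (ℤP.^-distribˡ-+-* (+ p) (l ℕ.∸ k) k))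

  ∤-product : ∀ a → ¬ + p ∣ a → ∀ b → ¬ + p ∣ b → ¬ + p ∣ a * b
  ∤-product a na b nb q with prime-∣ a b q
  ... | inj₁ r = na r
  ... | inj₂ r = nb r

  private
    inverse₁ : ∀ a → ¬ + p ∣ a → Σ ℤ λ s → + p ∣ + 1 - a * s
    inverse₁ a na = proj₁ (bézout p a) , subst (λ g → + p ∣ + g - a * proj₁ (bézout p a)) gcd≡1 (proj₂ (bézout p a))
      where
      gcd≡1 : gcd p (∣ a ∣) ≡ 1
      gcd≡1 with prime⇒irreducible pr (gcd[m,n]∣m p (∣ a ∣))
      ... | inj₁ eq = eq
      ... | inj₂ eq = ⊥-elim (na (∣ᵤ⇒∣ (subst (ℕD._∣ ∣ a ∣) eq (gcd[m,n]∣n p (∣ a ∣)))))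

    ∣-product₂ : ∀ {a b x y} → a ∣ x → b ∣ y → a * b ∣ x * y
    ∣-product₂ {a} {b} {x} {y} (divides q eq) (divides q′ eq′) = ∣-by (q * q′) (trans (cong₂ _*_ eq eq′) (lem q a q′ b))
      where lem : ∀ q a r b → (q * a) * (r * b) ≡ (q * r) * (a * b)
            lem = solve-∀

  -- An inverse modulo p and one modulo p^k combine, since the product (1 - a s)(1 - a s′) is again
  -- of the form 1 - a s″.
  inverse : ∀ k a → ¬ + p ∣ a → Σ ℤ λ s → (+ p) ^ k ∣ + 1 - a * s
  inverse zero    a na = + 0 , 1∣ _
  inverse (suc k) a na = combine (inverse₁ a na) (inverse k a na)
    where
    combine : (Σ ℤ λ s → + p ∣ + 1 - a * s) → (Σ ℤ λ s → (+ p) ^ k ∣ + 1 - a * s) → Σ ℤ λ s → (+ p) ^ suc k ∣ + 1 - a * s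
    combine (s , q) (s′ , q′) = s + s′ - a * s * s′ , ∣-resp (lem a s s′) (∣-product₂ q q′)
      where lem : ∀ a s t → (+ 1 - a * s) * (+ 1 - a * t) ≡ + 1 - a * (s + t - a * s * t)
            lem = solve-∀

  cancel-unit : ∀ k a b → ¬ + p ∣ a → (+ p) ^ k ∣ a * b → (+ p) ^ k ∣ b
  cancel-unit k a b na q = let (s , r) = inverse k a na in
    ∣-diff {b = b * (a * s)} (∣-resp (lem b a s) (∣n⇒∣m*n b r)) (∣-resp (lem₂ s a b) (∣n⇒∣m*n s q))
    where lem : ∀ b a s → b * (+ 1 - a * s) ≡ b - b * (a * s)
          lem = solve-∀
          lem₂ : ∀ s a b → s * (a * b) ≡ b * (a * s)
          lem₂ = solve-∀

  valuation : ∀ v → 1 ≤ v → Σ ℕ λ f → Σ ℕ λ v′ → v ≡ p ℕ.^ f ℕ.* v′ × ¬ p ℕD.∣ v′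
  valuation v h = go v v h ℕP.≤-refl
    where
    go : ∀ fuel v → 1 ≤ v → v ≤ fuel → Σ ℕ λ f → Σ ℕ λ v′ → v ≡ p ℕ.^ f ℕ.* v′ × ¬ p ℕD.∣ v′
    go zero    v h l = ⊥-elim (ℕP.<⇒≱ h l)
    go (suc n) v h l with p ℕD.∣? v
    ... | no ¬q = 0 , v , sym (ℕP.*-identityˡ v) , ¬q
    ... | yes (ℕD.divides zero eq) = ⊥-elim (ℕP.<⇒≱ h (ℕP.≤-reflexive eq))
    ... | yes (ℕD.divides q@(suc _) eq) with go n q (ℕ.s≤s ℕ.z≤n) (ℕP.≤-pred (ℕP.≤-trans (subst (q <_) (sym eq) (ℕP.m<m*n q p 2≤p)) l))
    ...   | f , v′ , eq′ , nd = suc f , v′ , trans eq (trans (ℕP.*-comm q p) (trans (cong (p ℕ.*_) eq′) (sym (ℕP.*-assoc p (p ℕ.^ f) v′)))) , nd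

  record Primary (m : ℕ) : Set where
    field
      ν t  : ℕ
      m≡   : m ≡ p ℕ.^ ν ℕ.* t
      p∤t  : ¬ + p ∣ + t
      π≡   : πp p m ≡ p ℕ.^ ν
      ν>0  : p ℕD.∣ m → 1 ≤ ν

    m≡ℤ : + m ≡ (+ p) ^ ν * + t
    m≡ℤ = trans (cong +_ m≡) (trans (ℤP.pos-* (p ℕ.^ ν) t) (cong (_* + t) (pos-^ p ν)))

    π∣m : (+ p) ^ ν ∣ + m
    π∣m = ∣-by (+ t) (trans m≡ℤ (ℤP.*-comm ((+ p) ^ ν) (+ t)))

    π≡ℤ : + πp p m ≡ (+ p) ^ ν
    π≡ℤ = trans (cong +_ π≡) (pos-^ p ν)

  -- The gcd of m with p^m is p^ν: ν ≤ m because ν < p^ν ≤ m, and the cofactor t is invertible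
  -- modulo p^m.
  primary : ∀ m → 1 ≤ m → Primary m
  primary m h = build (valuation m h)
    where
    build : (Σ ℕ λ f → Σ ℕ λ v′ → m ≡ p ℕ.^ f ℕ.* v′ × ¬ p ℕD.∣ v′) → Primary m
    build (ν , t , eq , nd) = record { ν = ν ; t = t ; m≡ = eq ; p∤t = p∤t′ ; π≡ = ℕD.∣-antisym below above ; ν>0 = positive ν eq }
      where
      p∤t′ : ¬ + p ∣ + t
      p∤t′ q = nd (∣⇒∣ᵤ q)
      positive : ∀ ν → m ≡ p ℕ.^ ν ℕ.* t → p ℕD.∣ m → 1 ≤ ν
      positive zero eq q = ⊥-elim (nd (subst (p ℕD.∣_) (trans eq (ℕP.*-identityˡ t)) q))
      positive (suc ν) eq q = ℕ.s≤s ℕ.z≤n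
      g = πp p m
      ν≤m : ν ≤ m
      ν≤m = ℕP.≤-trans (ℕP.<⇒≤ (n<p^n p ν 2≤p)) (ℕD.∣⇒≤ {{ℕ.>-nonZero h}} (ℕD.divides t (trans eq (ℕP.*-comm (p ℕ.^ ν) t))))
      above : p ℕ.^ ν ℕD.∣ g
      above = gcd-greatest (ℕD.divides t (trans eq (ℕP.*-comm (p ℕ.^ ν) t)))
        (∣⇒∣ᵤ (subst₂ _∣_ (sym (pos-^ p ν)) (sym (pos-^ p m)) (p^k∣^ ν≤m)))
      below : g ℕD.∣ p ℕ.^ ν
      below = ∣⇒∣ᵤ (∣-diff {a = + (p ℕ.^ ν)} {b = + (p ℕ.^ ν) * + t * s}
          (∣-resp (lem (+ (p ℕ.^ ν)) (+ t) s) (∣n⇒∣m*n (+ (p ℕ.^ ν)) (∣-trans (∣ℕ⇒∣ℤ (gcd[m,n]∣n m (p ℕ.^ m))) (subst (_∣ + 1 - + t * s) (sym (pos-^ p m)) unit))))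
          (∣m⇒∣m*n s (∣-resp (trans (cong +_ eq) (ℤP.pos-* (p ℕ.^ ν) t)) (∣ℕ⇒∣ℤ (gcd[m,n]∣m m (p ℕ.^ m))))))
        where
        s = proj₁ (inverse m (+ t) p∤t′)
        unit = proj₂ (inverse m (+ t) p∤t′)
        lem : ∀ q t s → q * (+ 1 - t * s) ≡ q - q * t * s
        lem = solve-∀

  private
    module _ (w : ℤ) where
      Y = + 1 + + p * w
      p² = + p * + p

      power-mod : ∀ k → p² ∣ Y ^ k - (+ 1 + + k * (+ p * w))
      power-mod = ℕ-ind (λ k → p² ∣ Y ^ k - (+ 1 + + k * (+ p * w)))
        (∣-resp (sym (lem (+ p * w))) ∣-zero) (λ k → power-step (+ p) w (Y ^ k) (+ k))
        where lem : ∀ a → + 1 - (+ 1 + + 0 * a) ≡ + 0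
              lem = solve-∀

      geometric-mod : ∀ k → p² ∣ + 2 * geometric Y k - (+ 2 * + k + + k * (+ k - + 1) * (+ p * w))
      geometric-mod = ℕ-ind (λ k → p² ∣ + 2 * geometric Y k - (+ 2 * + k + + k * (+ k - + 1) * (+ p * w)))
        (∣-resp (sym (lem (+ p * w))) ∣-zero)
        (λ k q → geometric-step (+ p * w) (geometric Y k) (Y ^ k) (+ k) q (power-mod k))
        where lem : ∀ a → + 2 * + 0 - (+ 2 * + 0 + + 0 * (+ 0 - + 1) * a) ≡ + 0
              lem = solve-∀

      -- At k = p the linear term k (k - 1) p w of the expansion is itself a multiple of p².
      geometric-p : p² ∣ + 2 * geometric Y p - + 2 * + p
      geometric-p = ∣-resp (lem (+ 2 * geometric Y p) (+ p) w) (∣m∣n⇒∣m+n (geometric-mod p) (∣n⇒∣m*n ((+ p - + 1) * w) (∣-refl {p²})))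
        where lem : ∀ g p w → (g - (+ 2 * p + p * (p - + 1) * (p * w))) + (p - + 1) * w * (p * p) ≡ g - + 2 * p
              lem = solve-∀

    Condition : ℤ → Set
    Condition X = (p ≢ 2) ⊎ (+ 4 ∣ X - + 1)

    Unitary : ℤ → Set
    Unitary s = Σ ℤ λ G → (¬ + p ∣ G) × s ≡ + p * G

    p∤2 : p ≢ 2 → ¬ + p ∣ + 2
    p∤2 ne q = ne (ℕP.≤-antisym (ℕD.∣⇒≤ (∣⇒∣ᵤ q)) 2≤p)

    geometric-odd : ∀ w → p ≢ 2 → Unitary (geometric (+ 1 + + p * w) p)
    geometric-odd w ne = odd-quotient (+ p) (geometric (+ 1 + + p * w) p) (prime-∣ (+ 2)) (p∤2 ne) (geometric-p w)

    geometric-two : ∀ X → p ≡ 2 → + 4 ∣ X - + 1 → Unitary (geometric X p)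
    geometric-two X eq (divides w eq′) = + 1 + + 2 * w ,
      (λ q → p∤1 (∣m+n∣n⇒∣m {m = + 1} q (∣m⇒∣m*n {m = + 2} w (∣-reflexive (cong +_ eq))))) ,
      subst (λ k → geometric X k ≡ + k * (+ 1 + + 2 * w)) (sym eq) (two-terms X w eq′)

    geometric-exact : ∀ X → + p ∣ X - + 1 → Dec (p ≡ 2) → Condition X → Unitary (geometric X p)
    geometric-exact X _ (yes eq) (inj₂ h) = geometric-two X eq h
    geometric-exact X _ (yes eq) (inj₁ ne) = ⊥-elim (ne eq)
    geometric-exact X (divides w eq) (no ne) _ = subst (λ y → Unitary (geometric y p))
        (from-quotient X (+ p) w eq) (geometric-odd w ne)

  -- Lifting the exponent: passing from Z to Z^p multiplies Z - 1 by the geometric sum of length p,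
  -- which is p times a number prime to p. The condition at the prime 2 persists because X - 1
  -- divides Z - 1.
  lifting : ∀ X → + p ∣ X - + 1 → Condition X → ∀ f → Σ ℤ λ Q → (¬ + p ∣ Q) × X ^ (p ℕ.^ f) - + 1 ≡ (X - + 1) * ((+ p) ^ f * Q)
  lifting X p∣ c zero = + 1 , p∤1 , trans (cong (_- + 1) (ℤP.*-identityʳ X)) (sym (ℤP.*-identityʳ (X - + 1)))
  lifting X p∣ c (suc f) = combine (lifting X p∣ c f)
    where
    Z = X ^ (p ℕ.^ f)
    combine : (Σ ℤ λ Q → (¬ + p ∣ Q) × Z - + 1 ≡ (X - + 1) * ((+ p) ^ f * Q)) →
              Σ ℤ λ Q → (¬ + p ∣ Q) × X ^ (p ℕ.* p ℕ.^ f) - + 1 ≡ (X - + 1) * ((+ p) ^ suc f * Q)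
    combine (Q , nQ , eq) = finish (geometric-exact Z (∣-trans p∣ (pow-1-∣ X (p ℕ.^ f))) (p ℕ.≟ 2) (lift-condition c))
      where
      lift-condition : Condition X → Condition Z
      lift-condition (inj₁ ne) = inj₁ ne
      lift-condition (inj₂ h)  = inj₂ (∣-trans h (pow-1-∣ X (p ℕ.^ f)))
      lem : ∀ x q Q p G → x * (q * Q) * (p * G) ≡ x * (p * q * (Q * G))
      lem = solve-∀
      finish : (Σ ℤ λ G → (¬ + p ∣ G) × geometric Z p ≡ + p * G) →
               Σ ℤ λ Q → (¬ + p ∣ Q) × X ^ (p ℕ.* p ℕ.^ f) - + 1 ≡ (X - + 1) * ((+ p) ^ suc f * Q)
      finish (G , nG , eq′) = Q * G , ∤-product Q nQ G nG , trans (cong (_- + 1)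
          (trans (cong (X ^_) (ℕP.*-comm p (p ℕ.^ f))) (sym (ℤP.^-*-assoc X (p ℕ.^ f) p))))
        (trans (sym (geometric-sum Z p)) (trans (cong₂ _*_ eq eq′) (lem (X - + 1) ((+ p) ^ f) Q (+ p) G)))

prime-divisor : ∀ n → 2 ≤ n → Σ ℕ λ p → Prime p × p ℕD.∣ n
prime-divisor n h = go (factors F) (isFactorisation F) (factorsPrime F)
  where
  instance _ = ℕ.>-nonZero (ℕP.≤-trans (ℕ.s≤s ℕ.z≤n) h)
  open PrimeFactorisation
  F = factorise n
  go : ∀ ps → n ≡ List.foldr ℕ._*_ 1 ps → All Prime ps → Σ ℕ λ p → Prime p × p ℕD.∣ n
  go List.[] eq _ = ⊥-elim (ℕP.<⇒≱ h (ℕP.≤-reflexive eq))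
  go (p List.∷ ps) eq (pr All.∷ _) = p , pr , subst (p ℕD.∣_) (sym eq) (ℕD.m∣m*n _)

-- If m / gcd(m, z) had a prime divisor p, then p π_p(m) would divide m.
∣-by-primary-parts : ∀ m z → 1 ≤ m → (∀ p → Prime p → p ℕD.∣ m → + πp p m ∣ z) → + m ∣ z
∣-by-primary-parts m z h parts = go (gcd[m,n]∣m m (∣ z ∣))
  where
  g = gcd m (∣ z ∣)
  go : g ℕD.∣ m → + m ∣ z
  go (ℕD.divides zero eq) = ⊥-elim (ℕP.<⇒≱ h (ℕP.≤-reflexive eq))
  go (ℕD.divides (suc zero) eq) = ∣ᵤ⇒∣ (subst (ℕD._∣ ∣ z ∣) (sym (trans eq (ℕP.+-identityʳ g))) (gcd[m,n]∣n m (∣ z ∣)))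
  go (ℕD.divides (suc (suc k)) eq) = contradict (prime-divisor (suc (suc k)) (ℕ.s≤s (ℕ.s≤s ℕ.z≤n)))
    where
    r = suc (suc k)
    contradict : (Σ ℕ λ p → Prime p × p ℕD.∣ r) → + m ∣ z
    contradict (p , pr , p∣r) = ⊥-elim (∤t (∣⇒∣ᵤ p∤t-target))
      where
      open AtPrime p pr
      open Primary (primary m h)
      instance
        p^ν≢0 : ℕ.NonZero (p ℕ.^ ν)
        p^ν≢0 = ℕP.m^n≢0 p ν {{prime⇒nonZero pr}}
      ∤t : ¬ p ℕD.∣ t
      ∤t q = p∤t (∣ᵤ⇒∣ q)
      p∣m : p ℕD.∣ m
      p∣m = ℕD.∣-trans p∣r (ℕD.divides g (trans eq (ℕP.*-comm r g)))
      π∣g : p ℕ.^ ν ℕD.∣ g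
      π∣g = subst (ℕD._∣ g) π≡ (gcd-greatest (gcd[m,n]∣m m (p ℕ.^ m)) (∣⇒∣ᵤ (parts p pr p∣m)))
      p∤t-target : + p ∣ + t
      p∤t-target = ∣ᵤ⇒∣ (ℕD.*-cancelˡ-∣ (p ℕ.^ ν) (subst₂ ℕD._∣_ (ℕP.*-comm p (p ℕ.^ ν)) (trans (sym eq) m≡) (ℕD.*-pres-∣ p∣r π∣g)))

-- The exponents c(v)

⌊⌋-yes : ∀ {A : Set} (a? : Dec A) → A → ⌊ a? ⌋ ≡ true
⌊⌋-yes (yes _) a = refl
⌊⌋-yes (no ¬a) a = ⊥-elim (¬a a)

⌊⌋-no : ∀ {A : Set} (a? : Dec A) → ¬ A → ⌊ a? ⌋ ≡ false
⌊⌋-no (yes a) ¬a = ⊥-elim (¬a a)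
⌊⌋-no (no _)  ¬a = refl

∧-false : ∀ b → b ∧ false ≡ false
∧-false true  = refl
∧-false false = refl

module Exponents (d : ℤ) (m : ℕ) .{{m≢0 : ℕ.NonZero m}} (coprime : gcd m (∣ d ∣) ≡ 1) where

  1≤m : 1 ≤ m
  1≤m = ℕ.>-nonZero⁻¹ m

  Top : ℕ → Set
  Top v = Σ ℕ λ p → Prime p × p ℕD.∣ m × v ℕ.* πp p m ≡ m

  Exceptional : Set
  Exceptional = 4 ℕD.∣ m × 4 ℕD.∣ ∣ d - + 3 ∣

  exceptional? : Dec Exceptional
  exceptional? = (4 ℕD.∣? m) ×-dec (4 ℕD.∣? ∣ d - + 3 ∣)

  even⇒odd : 2 ℕD.∣ m → ¬ + 2 ∣ d
  even⇒odd 2∣m q = ℕP.<⇒≱ (ℕ.s≤s (ℕ.s≤s ℕ.z≤n)) (ℕD.∣⇒≤ (subst (2 ℕD.∣_) coprime (gcd-greatest 2∣m (∣⇒∣ᵤ q))))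

  mod4 : 2 ℕD.∣ m → (+ 4 ∣ d - + 1) ⊎ (+ 4 ∣ d - + 3)
  mod4 2∣m = go (d %ℕ 4) (n%ℕd<d d 4) (residue-∣ 4 d)
    where
    2∣4 : + 2 ∣ + 4
    2∣4 = divides (+ 2) refl
    go : ∀ r → r < 4 → + 4 ∣ d - + r → (+ 4 ∣ d - + 1) ⊎ (+ 4 ∣ d - + 3)
    go 0 _ p = ⊥-elim (even⇒odd 2∣m (∣-diff {b = + 0} (∣-trans 2∣4 p) ∣-zero))
    go 1 _ p = inj₁ p
    go 2 _ p = ⊥-elim (even⇒odd 2∣m (∣-diff {b = + 2} (∣-trans 2∣4 p) ∣-refl))
    go 3 _ p = inj₂ p
    go (suc (suc (suc (suc r)))) (ℕ.s≤s (ℕ.s≤s (ℕ.s≤s (ℕ.s≤s ())))) p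

  not-both : + 4 ∣ d - + 1 → ¬ + 4 ∣ d - + 3
  not-both p q = absurd (∣⇒∣ᵤ (∣-resp (lem d) (∣m∣n⇒∣m-n p q)))
    where
    lem : ∀ d → (d - + 1) - (d - + 3) ≡ + 2
    lem = solve-∀
    absurd : ¬ 4 ℕD.∣ 2
    absurd r = ℕP.<⇒≱ (ℕ.s≤s (ℕ.s≤s (ℕ.s≤s ℕ.z≤n))) (ℕD.∣⇒≤ r)

  private
    Hit : ℕ → ℕ → Set
    Hit v p = Prime p × p ℕD.∣ m × v ℕ.* πp p m ≡ m

    hit? : ∀ v p → Dec (Hit v p)
    hit? v p = prime? p ×-dec (p ℕD.∣? m) ×-dec (v ℕ.* πp p m ℕ.≟ m)

    test : ℕ → ℕ → Bool
    test v p = ⌊ prime? p ⌋ ∧ (p ∣ᵇ m) ∧ ⌊ v ℕ.* πp p m ℕ.≟ m ⌋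

    hit-test : ∀ v p → Hit v p → test v p ≡ true
    hit-test v p (a , b , c) = trans (cong (_∧ ((p ∣ᵇ m) ∧ ⌊ v ℕ.* πp p m ℕ.≟ m ⌋)) (⌊⌋-yes (prime? p) a))
      (trans (cong (_∧ ⌊ v ℕ.* πp p m ℕ.≟ m ⌋) (⌊⌋-yes (p ℕD.∣? m) b)) (⌊⌋-yes (v ℕ.* πp p m ℕ.≟ m) c))

    miss-test : ∀ v p → ¬ Hit v p → test v p ≡ false
    miss-test v p ¬h = go (prime? p) (p ℕD.∣? m) (v ℕ.* πp p m ℕ.≟ m) (λ a b c → ¬h (a , b , c))
      where
      go : ∀ {A B C : Set} (a? : Dec A) (b? : Dec B) (c? : Dec C) → (A → B → C → ⊥) → ⌊ a? ⌋ ∧ ⌊ b? ⌋ ∧ ⌊ c? ⌋ ≡ false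
      go (no _)  b?      c?      _ = refl
      go (yes _) (no _)  c?      _ = refl
      go (yes _) (yes _) (no _)  _ = refl
      go (yes a) (yes b) (yes c) f = ⊥-elim (f a b c)

    body : ℕ → Maybe ℕ
    body p = if not ⌊ p ℕ.≟ 2 ⌋ ∨ d≡1mod4 d ∨ not (4 ∣ᵇ m) then just (πp p m)
             else if d≡3mod4 d ∧ (4 ∣ᵇ m) then just (πp 2 m div 2) else nothing

    if-true : ∀ {A : Set} {b} {x y : A} → b ≡ true → (if b then x else y) ≡ x
    if-true refl = refl

    if-false : ∀ {A : Set} {b} {x y : A} → b ≡ false → (if b then x else y) ≡ y
    if-false refl = refl

    search : ∀ v ps → (Σ ℕ λ p → Hit v p × primeCase m d v ps ≡ body p) ⊎
                      ((∀ {p} → p ∈ ps → ¬ Hit v p) × primeCase m d v ps ≡ nothing)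
    search v List.[] = inj₂ ((λ ()) , refl)
    search v (p List.∷ ps) with hit? v p
    ... | yes h = inj₁ (p , h , if-true (hit-test v p h))
    ... | no ¬h with search v ps
    ...   | inj₁ (q , h , eq) = inj₁ (q , h , trans (if-false (miss-test v p ¬h)) eq)
    ...   | inj₂ (none , eq) = inj₂ ((λ { (here refl) → ¬h ; (there q) → none q }) , trans (if-false (miss-test v p ¬h)) eq)

    -- For p = 2 coprimality makes d odd, so d is 1 or 3 modulo 4 and the branch `nothing` is never
    -- reached.
    body-value : ∀ p → p ℕD.∣ m → (p ≢ 2 ⊎ ¬ Exceptional → body p ≡ just (πp p m)) × (p ≡ 2 → Exceptional → body p ≡ just (πp 2 m div 2))
    body-value p p∣m = regular , exceptional
      where
      cond : Bool
      cond = not ⌊ p ℕ.≟ 2 ⌋ ∨ d≡1mod4 d ∨ not (4 ∣ᵇ m)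
      ∨-true : ∀ b → b ∨ true ≡ true
      ∨-true true  = refl
      ∨-true false = refl
      regular : p ≢ 2 ⊎ ¬ Exceptional → body p ≡ just (πp p m)
      regular h = if-true (go h (p ℕ.≟ 2) (4 ℕD.∣? m))
        where
        go : p ≢ 2 ⊎ ¬ Exceptional → Dec (p ≡ 2) → Dec (4 ℕD.∣ m) → cond ≡ true
        go h (no ne) _ = cong (λ b → not b ∨ d≡1mod4 d ∨ not (4 ∣ᵇ m)) (⌊⌋-no (p ℕ.≟ 2) ne)
        go h (yes _) (no ¬4) = trans (cong (λ b → not ⌊ p ℕ.≟ 2 ⌋ ∨ d≡1mod4 d ∨ not b) (⌊⌋-no (4 ℕD.∣? m) ¬4))
          (trans (cong (not ⌊ p ℕ.≟ 2 ⌋ ∨_) (∨-true (d≡1mod4 d))) (∨-true (not ⌊ p ℕ.≟ 2 ⌋)))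
        go (inj₁ ne) (yes eq) (yes 4∣) = ⊥-elim (ne eq)
        go (inj₂ ¬x) (yes eq) (yes 4∣) with mod4 (ℕD.∣-trans (ℕD.divides 2 refl) 4∣)
        ... | inj₁ q = trans (cong (λ b → not ⌊ p ℕ.≟ 2 ⌋ ∨ b ∨ not (4 ∣ᵇ m)) (⌊⌋-yes (4 ℕD.∣? ∣ d - + 1 ∣) (∣⇒∣ᵤ q))) (∨-true (not ⌊ p ℕ.≟ 2 ⌋))
        ... | inj₂ q = ⊥-elim (¬x (4∣ , ∣⇒∣ᵤ q))
      exceptional : p ≡ 2 → Exceptional → body p ≡ just (πp 2 m div 2)
      exceptional eq (4∣ , 3d) = trans (if-false false-cond) (if-true (trans (cong (_∧ (4 ∣ᵇ m)) (⌊⌋-yes (4 ℕD.∣? ∣ d - + 3 ∣) 3d)) (⌊⌋-yes (4 ℕD.∣? m) 4∣)))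
        where
        false-cond : cond ≡ false
        false-cond = trans (cong (λ b → not b ∨ d≡1mod4 d ∨ not (4 ∣ᵇ m)) (⌊⌋-yes (p ℕ.≟ 2) eq))
          (trans (cong (λ b → b ∨ not (4 ∣ᵇ m)) (⌊⌋-no (4 ℕD.∣? ∣ d - + 1 ∣) (λ q → not-both (∣ᵤ⇒∣ q) (∣ᵤ⇒∣ 3d))))
            (cong not (⌊⌋-yes (4 ℕD.∣? m) 4∣)))

    rest : ℕ → ℕ
    rest v = if ⌊ v ℕ.* 2 ℕ.≟ m ⌋ ∧ (4 ∣ᵇ m) ∧ d≡3mod4 d then 2 else 1

  prime-below : ∀ {v} → ((p , _) : Top v) → p ∈ upTo (suc m)
  prime-below (p , _ , p∣m , _) = ∈-upTo⁺ (ℕ.s≤s (ℕD.∣⇒≤ p∣m))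

  π-prime-unique : ∀ p q → Prime p → Prime q → p ℕD.∣ m → πp p m ≡ πp q m → p ≡ q
  π-prime-unique p q pr qr p∣m eq = go (ν>0 p∣m) π≡
    where
    open AtPrime p pr
    open Primary (primary m 1≤m)
    module Q = AtPrime.Primary (AtPrime.primary q qr m 1≤m)
    divides-power : ∀ k → p ℕD.∣ q ℕ.^ k → p ≡ q
    divides-power zero r = ⊥-elim (p∤1 (∣ℕ⇒∣ℤ r))
    divides-power (suc k) r with euclidsLemma q (q ℕ.^ k) pr r
    ... | inj₂ r′ = divides-power k r′
    ... | inj₁ r′ with prime⇒irreducible qr r′
    ...   | inj₁ p≡1 = ⊥-elim (p∤1 (subst (λ z → + p ∣ + z) p≡1 ∣-refl))
    ...   | inj₂ p≡q = p≡q
    go : ∀ {k} → 1 ≤ k → πp p m ≡ p ℕ.^ k → p ≡ q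
    go {suc k} _ eq′ = divides-power Q.ν (subst (p ℕD.∣_) (trans (sym eq′) (trans eq Q.π≡)) (ℕD.m∣m*n (p ℕ.^ k)))

  top-prime-unique : ∀ {v} → 1 ≤ v → ((p , _) (q , _) : Top v) → p ≡ q
  top-prime-unique {v} h (p , pr , p∣m , eq) (q , qr , _ , eq′) =
    π-prime-unique p q pr qr p∣m (ℕP.*-cancelˡ-≡ _ _ v {{ℕ.>-nonZero h}} (trans eq (sym eq′)))

  -- The graph of v ↦ c(v) as a case distinction, freed from the Boolean tests and the search for a
  -- prime.
  data Exponent (v : ℕ) : ℕ → Set where
    regular     : ((p , _) : Top v) → p ≢ 2 ⊎ ¬ Exceptional → Exponent v (πp p m)
    exceptional : ((p , _) : Top v) → p ≡ 2 → Exceptional → Exponent v (πp 2 m div 2)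
    half        : ¬ Top v → Exceptional → v ℕ.* 2 ≡ m → Exponent v 2
    generic     : ¬ Top v → ¬ (Exceptional × v ℕ.* 2 ≡ m) → Exponent v 1

  exponent : ∀ v → Exponent v (cOf m d v)
  exponent v with search v (upTo (suc m))
  ... | inj₁ (p , h , eq) = subst (Exponent v) (sym (cong (maybe (λ c → c) (rest v)) eq)) (go (p ℕ.≟ 2) exceptional?)
    where
    go : Dec (p ≡ 2) → Dec Exceptional → Exponent v (maybe (λ c → c) (rest v) (body p))
    go (no ne) _ = subst (Exponent v) (sym (cong (maybe (λ c → c) (rest v)) (proj₁ (body-value p (proj₁ (proj₂ h))) (inj₁ ne)))) (regular (p , h) (inj₁ ne))
    go (yes _) (no ¬x) = subst (Exponent v) (sym (cong (maybe (λ c → c) (rest v)) (proj₁ (body-value p (proj₁ (proj₂ h))) (inj₂ ¬x)))) (regular (p , h) (inj₂ ¬x))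
    go (yes eq) (yes x) = subst (Exponent v) (sym (cong (maybe (λ c → c) (rest v)) (proj₂ (body-value p (proj₁ (proj₂ h))) eq x))) (exceptional (p , h) eq x)
  ... | inj₂ (none , eq) = subst (Exponent v) (sym (cong (maybe (λ c → c) (rest v)) eq)) (go (v ℕ.* 2 ℕ.≟ m) exceptional?)
    where
    ¬top : ¬ Top v
    ¬top t@(p , h) = none (prime-below {v} t) h
    go : Dec (v ℕ.* 2 ≡ m) → Dec Exceptional → Exponent v (rest v)
    go (yes eq) (yes x) = subst (Exponent v) (sym (if-true (trans (cong (_∧ ((4 ∣ᵇ m) ∧ d≡3mod4 d)) (⌊⌋-yes (v ℕ.* 2 ℕ.≟ m) eq))
      (trans (cong (_∧ d≡3mod4 d) (⌊⌋-yes (4 ℕD.∣? m) (proj₁ x))) (⌊⌋-yes (4 ℕD.∣? ∣ d - + 3 ∣) (proj₂ x)))))) (half ¬top x eq)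
    go (no ne) _ = subst (Exponent v) (sym (if-false (cong (_∧ ((4 ∣ᵇ m) ∧ d≡3mod4 d)) (⌊⌋-no (v ℕ.* 2 ℕ.≟ m) ne)))) (generic ¬top (ne ∘ proj₂))
    go (yes _) (no ¬x) = subst (Exponent v) (sym (if-false (trans (cong (⌊ v ℕ.* 2 ℕ.≟ m ⌋ ∧_) (not-exceptional (4 ℕD.∣? m) (4 ℕD.∣? ∣ d - + 3 ∣))) (∧-false _)))) (generic ¬top (¬x ∘ proj₁))
      where
      not-exceptional : (a? : Dec (4 ℕD.∣ m)) (b? : Dec (4 ℕD.∣ ∣ d - + 3 ∣)) → ⌊ a? ⌋ ∧ ⌊ b? ⌋ ≡ false
      not-exceptional (no _)  _       = refl
      not-exceptional (yes _) (no _)  = refl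
      not-exceptional (yes a) (yes b) = ⊥-elim (¬x (a , b))

-- Correcting the periodic generators one prime at a time

odd-difference : ∀ a b → ¬ + 2 ∣ a → ¬ + 2 ∣ b → + 2 ∣ a - b
odd-difference a b na nb = ∣-chain a (+ 1) b (one a na) (∣-flip b (+ 1) (one b nb))
  where
  one : ∀ a → ¬ + 2 ∣ a → + 2 ∣ a - + 1
  one a na = go (a %ℕ 2) (n%ℕd<d a 2) (residue-∣ 2 a)
    where
    go : ∀ r → r < 2 → + 2 ∣ a - + r → + 2 ∣ a - + 1
    go 0 _ p = ⊥-elim (na (∣-diff {b = + 0} p ∣-zero))
    go 1 _ p = p
    go (suc (suc r)) (ℕ.s≤s (ℕ.s≤s ())) p

module Coefficients (d : ℤ) (m : ℕ) .{{m≢0 : ℕ.NonZero m}} (coprime : gcd m (∣ d ∣) ≡ 1) (o : ℕ → ℕ) (𝒱 : List ℕ)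
                    (repSet : IsRepSet m d 𝒱) (orbitSize : ∀ v → v ∈ 𝒱 → IsOrbitSize m d v (o v)) where
  open Periodic d m coprime o 𝒱 repSet orbitSize
  open Exponents d m coprime

  -- Modulo πp p m, rep i is a times the representative m / πp p m for some a such that the order of the latter
  -- divides P i a, or else it is m / 2.
  data Good (i : ⟦ PU ⟧) (p : ℕ) : ℤ × ℤ → Set where
    plain  : ∀ {a} → (∀ τ → rep τ ℕ.* πp p m ≡ m → P τ ∣ P i * a) →
             (∀ τ → rep τ ℕ.* πp p m ≡ m → + πp p m ∣ a * + rep τ - + rep i) → Good i p (a , + 0)
    halved : p ≡ 2 → Exceptional → (∀ η → rep η ℕ.* 2 ≡ m → + πp p m ∣ + rep η - + rep i) → Good i p (+ 0 , + 1)

  module _ (p : ℕ) (pr : Prime p) (p∣m : p ℕD.∣ m) (i : ⟦ PU ⟧) where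
    private
      open AtPrime p pr
      open Primary (primary m 1≤m)

      v = rep i
      X = d ^ o v
      q = + p
      instance
        p≢0 : ℕ.NonZero p
        p≢0 = prime⇒nonZero pr
        π≢0 : ℕ.NonZero (p ℕ.^ ν)
        π≢0 = ℕP.m^n≢0 p ν

      rep-top : ∀ τ → rep τ ℕ.* πp p m ≡ m → rep τ ≡ t
      rep-top τ eq = ℕP.*-cancelʳ-≡ (rep τ) t (p ℕ.^ ν) (trans (cong (rep τ ℕ.*_) (sym π≡)) (trans eq (trans m≡ (ℕP.*-comm (p ℕ.^ ν) t))))

      π-∣ : ∀ {z} → q ^ ν ∣ z → + πp p m ∣ z
      π-∣ = subst (_∣ _) (sym π≡ℤ)

    -- The top representative is t with m = p^ν t, so d^N fixes it modulo m as soon as d^N ≡ 1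
    -- modulo p^ν.
    top-order : ∀ N τ → rep τ ℕ.* πp p m ≡ m → q ^ ν ∣ d ^ N - + 1 → P τ ∣ d ^ N - + 1
    top-order N τ eq h = O.faithful τ N 0 (subst (λ z → + m ∣ d ^ N * + z - + 1 * + z) (sym (rep-top τ eq))
      (subst₂ _∣_ (sym m≡ℤ) (lem (d ^ N) (+ t)) (multiply h)))
      where
      lem : ∀ x t → (x - + 1) * t ≡ x * t - + 1 * t
      lem = solve-∀
      multiply : ∀ {a z} → a ∣ z → a * + t ∣ z * + t
      multiply {a} {z} h = subst₂ _∣_ (ℤP.*-comm (+ t) a) (ℤP.*-comm (+ t) z) (*-mono-∣ (+ t) h)

    private
      module _ (f v′ : ℕ) (v≡ : v ≡ p ℕ.^ f ℕ.* v′) (p∤v′ : ¬ p ℕD.∣ v′) where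
        v≡ℤ : + v ≡ q ^ f * + v′
        v≡ℤ = trans (cong +_ v≡) (trans (ℤP.pos-* (p ℕ.^ f) v′) (cong (_* + v′) (pos-^ p f)))

        deep : ν ≤ f → Good i p (+ 0 , + 0)
        deep h = plain (λ τ _ → ∣-resp (sym (ℤP.*-zeroʳ (P i))) ∣-zero)
          (λ τ _ → ∣-resp (sym (ℤP.+-identityˡ (- + v))) (∣m⇒∣-m (π-∣ (∣-resp (sym v≡ℤ) (∣m⇒∣m*n (+ v′) (p^k∣^ h))))))

        module _ (f<ν : f < ν) where
          j = ν ℕ.∸ f

          q^ν : q ^ ν ≡ q ^ f * q ^ j
          q^ν = trans (cong (q ^_) (sym (ℕP.m+[n∸m]≡n (ℕP.<⇒≤ f<ν)))) (ℤP.^-distribˡ-+-* q f j)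

          q^j∣X-1 : q ^ j ∣ X - + 1
          q^j∣X-1 = cancel-unit j (+ v′) (X - + 1) (λ r → p∤v′ (∣⇒∣ᵤ r)) (*-cancelˡ-∣ (q ^ f) {{q^f≢0}}
              (subst₂ _∣_ q^ν (trans (cong (λ z → (X - + 1) * z) v≡ℤ) (lem (X - + 1) (q ^ f) (+ v′))) (∣-trans π∣m (O.closed i))))
            where
            q^f≢0 : ℤ.NonZero (q ^ f)
            q^f≢0 = subst ℤ.NonZero (pos-^ p f) (ℕP.m^n≢0 p f)
            lem : ∀ x q v → x * (q * v) ≡ q * (v * x)
            lem = solve-∀

          1≤j : 1 ≤ j
          1≤j = ℕP.m<n⇒0<n∸m f<ν

          p∣X-1 : q ∣ X - + 1
          p∣X-1 = ∣-trans (subst (_∣ q ^ j) (ℤP.*-identityʳ q) (p^k∣^ {1} 1≤j)) q^j∣X-1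

          Lifted : Set
          Lifted = Σ ℤ λ Q → (¬ q ∣ Q) × X ^ (p ℕ.^ f) - + 1 ≡ (X - + 1) * (q ^ f * Q)

          -- With N = o(v) p^f, the number d^N - 1 = P i · p^f Q is a multiple of p^ν, so the order
          -- of the top representative divides P i · p^f Q. The extra factor s v′, with s inverse to
          -- Q t modulo p^ν, adjusts the residue: a t ≡ p^f v′ = v.
          solved : Lifted → Σ (ℤ × ℤ) (Good i p)
          solved (Q , p∤Q , eq) = (a , + 0) , plain ord res
            where
            s = proj₁ (inverse ν (Q * + t) (∤-product Q p∤Q (+ t) p∤t))
            unit = proj₂ (inverse ν (Q * + t) (∤-product Q p∤Q (+ t) p∤t))
            a = (q ^ f * Q) * (s * + v′)
            N = o v ℕ.* p ℕ.^ f
            q^ν∣ : q ^ ν ∣ d ^ N - + 1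
            q^ν∣ = subst₂ _∣_ (sym q^ν) (trans (lem (q ^ f) (X - + 1) Q) (trans (sym eq) (cong (_- + 1) (ℤP.^-*-assoc d (o v) (p ℕ.^ f)))))
                (*-mono-∣ (q ^ f) (∣m⇒∣m*n Q q^j∣X-1))
              where lem : ∀ q x Q → q * (x * Q) ≡ x * (q * Q)
                    lem = solve-∀
            ord : ∀ τ → rep τ ℕ.* πp p m ≡ m → P τ ∣ P i * a
            ord τ h = ∣-resp (trans (cong (_* (s * + v′)) (trans (cong (_- + 1) (sym (ℤP.^-*-assoc d (o v) (p ℕ.^ f)))) eq))
                (ℤP.*-assoc (X - + 1) (q ^ f * Q) (s * + v′))) (∣m⇒∣m*n (s * + v′) (top-order N τ h q^ν∣))
            res : ∀ τ → rep τ ℕ.* πp p m ≡ m → + πp p m ∣ a * + rep τ - + rep i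
            res τ h = π-∣ (∣-resp (trans (lem (q ^ f) Q s (+ v′) (+ t)) (cong₂ (λ y z → a * + y - z) (sym (rep-top τ h)) (sym v≡ℤ)))
                (∣n⇒∣m*n (- (q ^ f * + v′)) unit))
              where lem : ∀ f Q s v t → (- (f * v)) * (+ 1 - Q * t * s) ≡ (f * Q) * (s * v) * t - f * v
                    lem = solve-∀

          split-off : ¬ (+ 4 ∣ X - + 1) → p ≡ 2 → f ≢ 0 → Σ (ℤ × ℤ) (Good i p)
          split-off ¬4 p≡2 f≢0 = (+ 0 , + 1) , halved p≡2 (4∣m , 3d (mod4 2∣m)) res
            where
            4≡q² : + 4 ≡ q ^ 2
            4≡q² = cong (λ k → (+ k) ^ 2) (sym p≡2)
            2∣m : 2 ℕD.∣ m
            2∣m = subst (ℕD._∣ m) p≡2 p∣m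
            2≤ν : 2 ≤ ν
            2≤ν = ℕP.≤-trans (ℕ.s≤s (ℕP.n≢0⇒n>0 f≢0)) f<ν
            4∣m : 4 ℕD.∣ m
            4∣m = ∣⇒∣ᵤ (subst (_∣ + m) (sym 4≡q²) (∣-trans (p^k∣^ 2≤ν) π∣m))
            3d : (+ 4 ∣ d - + 1) ⊎ (+ 4 ∣ d - + 3) → 4 ℕD.∣ ∣ d - + 3 ∣
            3d (inj₁ r) = ⊥-elim (¬4 (∣-trans r (pow-1-∣ d (o v))))
            3d (inj₂ r) = ∣⇒∣ᵤ r
            j≡1 : j ≡ 1
            j≡1 = go (2 ℕ.≤? j)
              where
              go : Dec (2 ≤ j) → j ≡ 1
              go (yes h) = ⊥-elim (¬4 (subst (_∣ X - + 1) (sym 4≡q²) (∣-trans (p^k∣^ h) q^j∣X-1)))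
              go (no h) = ℕP.≤-antisym (ℕP.≤-pred (ℕP.≰⇒> h)) 1≤j
            π≡f : q ^ ν ≡ q ^ f * q
            π≡f = trans q^ν (cong (q ^ f *_) (trans (cong (q ^_) j≡1) (ℤP.*-identityʳ q)))
            res : ∀ η → rep η ℕ.* 2 ≡ m → + πp p m ∣ + rep η - + rep i
            res η h = π-∣ (subst₂ _∣_ (sym π≡f) (trans (lem (q ^ f) (+ t) (+ v′)) (cong₂ _-_ (sym rep-η) (sym v≡ℤ)))
                (*-mono-∣ (q ^ f) (subst (_∣ + t - + v′) (cong +_ (sym p≡2)) (odd-difference (+ t) (+ v′)
                  (p∤t ∘ subst (_∣ + t) (cong +_ (sym p≡2))) (λ r → p∤v′ (∣⇒∣ᵤ (subst (_∣ + v′) (cong +_ (sym p≡2)) r)))))))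
              where
              lem : ∀ f t v → f * (t - v) ≡ f * t - f * v
              lem = solve-∀
              lem₂ : ∀ f p t → f * p * t ≡ f * t * p
              lem₂ = solve-∀
              rep-η : + rep η ≡ q ^ f * + t
              rep-η = ℤP.*-cancelʳ-≡ (+ rep η) (q ^ f * + t) q (trans (cong (λ k → + rep η * + k) p≡2)
                (trans (sym (ℤP.pos-* (rep η) 2)) (trans (cong +_ h) (trans m≡ℤ (trans (cong (_* + t) π≡f) (lem₂ (q ^ f) q (+ t)))))))

          shallow : Dec (f ≡ 0) → Dec (p ≡ 2) → Dec (+ 4 ∣ X - + 1) → Σ (ℤ × ℤ) (Good i p)
          shallow (yes refl) _ _ = solved (+ 1 , p∤1 , trans (cong (_- + 1) (ℤP.*-identityʳ X)) (sym (ℤP.*-identityʳ (X - + 1))))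
          shallow (no _) (no p≢2) _ = solved (lifting X p∣X-1 (inj₁ p≢2) f)
          shallow (no _) (yes _) (yes 4∣) = solved (lifting X p∣X-1 (inj₂ 4∣) f)
          shallow (no f≢0) (yes p≡2) (no ¬4) = split-off ¬4 p≡2 f≢0

    coefficient : Σ (ℤ × ℤ) (Good i p)
    coefficient = go (valuation v (proj₁ (rep-range i)))
      where
      go : (Σ ℕ λ f → Σ ℕ λ v′ → v ≡ p ℕ.^ f ℕ.* v′ × ¬ p ℕD.∣ v′) → Σ (ℤ × ℤ) (Good i p)
      go (f , v′ , v≡ , p∤v′) with ν ℕ.≤? f
      ... | yes h = (+ 0 , + 0) , deep f v′ v≡ p∤v′ h
      ... | no h  = shallow f v′ v≡ p∤v′ (ℕP.≰⇒> h) (f ℕ.≟ 0) (p ℕ.≟ 2) (+ 4 ∣? X - + 1)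

module Changed (d : ℤ) (m : ℕ) .{{m≢0 : ℕ.NonZero m}} (coprime : gcd m (∣ d ∣) ≡ 1) (o : ℕ → ℕ) (𝒱 : List ℕ)
               (repSet : IsRepSet m d 𝒱) (orbitSize : ∀ v → v ∈ 𝒱 → IsOrbitSize m d v (o v)) where
  open Dune d
  open Bases d
  open Periodic d m coprime o 𝒱 repSet orbitSize public
  open Exponents d m coprime public
  open Coefficients d m coprime o 𝒱 repSet orbitSize public

  data View (v : ℕ) : Set where
    isTop     : Top v → View v
    isHalf    : ¬ Top v → Exceptional → v ℕ.* 2 ≡ m → View v
    isGeneric : ¬ Top v → ¬ (Exceptional × v ℕ.* 2 ≡ m) → View v

  viewOf : ∀ {v c} → Exponent v c → View v
  viewOf (regular t _)       = isTop t
  viewOf (exceptional t _ _) = isTop t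
  viewOf (half ¬t x eq)      = isHalf ¬t x eq
  viewOf (generic ¬t ¬x)     = isGeneric ¬t ¬x

  view : ∀ i → View (rep i)
  view i = viewOf (exponent (rep i))

  1≤rep : ∀ i → 1 ≤ rep i
  1≤rep i = proj₁ (rep-range i)

  member : ∀ p k → Prime p → p ℕD.∣ m → 1 ≤ k → p ℕ.^ k ℕD.∣ m → Σ ⟦ PU ⟧ λ i → rep i ℕ.* p ℕ.^ k ≡ m
  member p k pr p∣m h h′ with proj₂ (proj₂ (proj₂ repSet)) p k pr p∣m h h′
  ... | v , v∈ , eq = index v∈ , trans (cong (ℕ._* p ℕ.^ k) (sym (lookup-index v∈))) eq

  module Part (p : ℕ) (pr : Prime p) (p∣m : p ℕD.∣ m) where
    open AtPrime p pr public
    open Primary (primary m 1≤m) public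

    private
      instance
        p≢0 : ℕ.NonZero p
        p≢0 = prime⇒nonZero pr
        π≢0 : ℕ.NonZero (p ℕ.^ ν)
        π≢0 = ℕP.m^n≢0 p ν

    π∣m′ : + πp p m ∣ + m
    π∣m′ = subst (_∣ + m) (sym π≡ℤ) π∣m

    top : Σ ⟦ PU ⟧ λ τ → rep τ ℕ.* πp p m ≡ m
    top = let (τ , eq) = member p ν pr p∣m (ν>0 p∣m) (ℕD.divides t (trans m≡ (ℕP.*-comm (p ℕ.^ ν) t))) in
      τ , trans (cong (rep τ ℕ.*_) π≡) eq

    rep-top≡t : ∀ {v} → v ℕ.* πp p m ≡ m → v ≡ t
    rep-top≡t {v} eq = ℕP.*-cancelʳ-≡ v t (p ℕ.^ ν) (trans (cong (v ℕ.*_) (sym π≡)) (trans eq (trans m≡ (ℕP.*-comm (p ℕ.^ ν) t))))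

    p∤top : ∀ {v} → v ℕ.* πp p m ≡ m → ¬ + p ∣ + v
    p∤top eq = subst (λ z → ¬ + p ∣ + z) (sym (rep-top≡t eq)) p∤t

    top-unique : ∀ i j → rep i ℕ.* πp p m ≡ m → rep j ℕ.* πp p m ≡ m → i ≡ j
    top-unique i j eq eq′ = rep-injective i j (trans (rep-top≡t eq) (sym (rep-top≡t eq′)))

    cofactor : ∀ {v k} → v ℕ.* k ≡ m → ¬ p ℕD.∣ k → + πp p m ∣ + v
    cofactor {v} {k} eq p∤k = subst (_∣ + v) (sym π≡ℤ) (cancel-unit ν (+ k) (+ v) (λ r → p∤k (∣⇒∣ᵤ r))
      (∣-resp (trans (cong +_ (trans (sym eq) (ℕP.*-comm v k))) (ℤP.pos-* k v)) π∣m))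

    other-prime : ∀ q → Prime q → q ≢ p → ∀ k → ¬ p ℕD.∣ q ℕ.^ k
    other-prime q qr ne zero r = p∤1 (∣ℕ⇒∣ℤ r)
    other-prime q qr ne (suc k) r with euclidsLemma q (q ℕ.^ k) pr r
    ... | inj₂ r′ = other-prime q qr ne k r′
    ... | inj₁ r′ with prime⇒irreducible qr r′
    ...   | inj₁ p≡1 = p∤1 (subst (λ z → + p ∣ + z) p≡1 ∣-refl)
    ...   | inj₂ p≡q = ne (sym p≡q)

    other-top : ∀ {v} → ((q , _) : Top v) → q ≢ p → + πp p m ∣ + v
    other-top (q , qr , q∣m , eq) ne = cofactor eq (subst (λ z → ¬ p ℕD.∣ z) (sym Q.π≡) (other-prime q qr ne Q.ν))
      where module Q = AtPrime.Primary (AtPrime.primary q qr m 1≤m)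

    other-half : ∀ {v} → v ℕ.* 2 ≡ m → p ≢ 2 → + πp p m ∣ + v
    other-half eq ne = cofactor eq (λ r → ne (ℕP.≤-antisym (ℕD.∣⇒≤ r) 2≤p))

  -- Otherwise π_q(m) = 2 for some prime q, so q = 2, contrary to 4 ∣ m.
  half-not-top : ∀ {v} → 1 ≤ v → Exceptional → v ℕ.* 2 ≡ m → ¬ Top v
  half-not-top {v} h (4∣m , _) eq (q , qr , q∣m , eq′) = go (ν>0 q∣m) (trans (sym π≡) π≡2)
    where
    open AtPrime q qr
    open Primary (primary m 1≤m)
    π≡2 : πp q m ≡ 2
    π≡2 = ℕP.*-cancelˡ-≡ (πp q m) 2 v {{ℕ.>-nonZero h}} (trans eq′ (sym eq))
    go : ∀ {k} → 1 ≤ k → q ℕ.^ k ≡ 2 → ⊥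
    go {suc k} _ q^≡2 = p∤t (∣ℕ⇒∣ℤ (subst (ℕD._∣ t) (sym q≡2) (ℕD.*-cancelˡ-∣ 2 (subst (4 ℕD.∣_) (trans m≡ (cong (ℕ._* t) (trans (sym π≡) π≡2))) 4∣m))))
      where
      q≡2 : q ≡ 2
      q≡2 = ℕP.≤-antisym (ℕD.∣⇒≤ (subst (q ℕD.∣_) q^≡2 (ℕD.m∣m*n (q ℕ.^ k)))) 2≤p

  -- As d - 1 is even, multiplication by d fixes m/2 modulo m.
  half-order-d : Exceptional → ∀ η → rep η ℕ.* 2 ≡ m → P η ∣ d - + 1
  half-order-d (4∣m , 3d) η eq = ∣-trans (O.faithful η 1 0 order-1) (∣-reflexive (cong (_- + 1) (ℤP.*-identityʳ d)))
    where
    lem : ∀ d → d - + 1 ≡ (d - + 3) + + 2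
    lem = solve-∀
    lem₂ : ∀ x r → (x * + 1 - + 1) * r ≡ x * + 1 * r - + 1 * r
    lem₂ = solve-∀
    2∣d-1 : + 2 ∣ d - + 1
    2∣d-1 = ∣-resp (sym (lem d)) (∣m∣n⇒∣m+n {m = d - + 3} (∣-trans (divides (+ 2) refl) (∣ᵤ⇒∣ {+ 4} 3d)) ∣-refl)
    order-1 : + m ∣ d ^ 1 * + rep η - d ^ 0 * + rep η
    order-1 = ∣-resp (trans (cong (λ z → (z - + 1) * + rep η) (sym (ℤP.*-identityʳ d))) (lem₂ d (+ rep η)))
      (subst₂ _∣_ (trans (sym (ℤP.pos-* (rep η) 2)) (cong +_ eq)) (ℤP.*-comm (+ rep η) (d - + 1)) (*-mono-∣ (+ rep η) 2∣d-1))

  half-order : Exceptional → ∀ η → rep η ℕ.* 2 ≡ m → ∀ i → P η ∣ P i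
  half-order x η eq i = ∣-trans (half-order-d x η eq) (pow-1-∣ d (o (rep i)))

  coefficients : ∀ i p → Σ (ℤ × ℤ) λ ab → Prime p → p ℕD.∣ m → Good i p ab
  coefficients i p = go (prime? p) (p ℕD.∣? m)
    where
    go : Dec (Prime p) → Dec (p ℕD.∣ m) → Σ (ℤ × ℤ) λ ab → Prime p → p ℕD.∣ m → Good i p ab
    go (yes pr) (yes p∣m) = proj₁ (coefficient p pr p∣m i) , λ _ _ → proj₂ (coefficient p pr p∣m i)
    go (no ¬pr) _         = (+ 0 , + 0) , λ pr _ → ⊥-elim (¬pr pr)
    go (yes _)  (no p∤m)  = (+ 0 , + 0) , λ _ p∣m → ⊥-elim (p∤m p∣m)

  abstract
    coeff : ⟦ PU ⟧ → ℕ → ℤ × ℤ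
    coeff i p = proj₁ (coefficients i p)

    coeff-good : ∀ i p → Prime p → p ℕD.∣ m → Good i p (coeff i p)
    coeff-good i p = proj₂ (coefficients i p)

  -- Corrections lead from generic members to tops and to m/2 and never further, which is what
  -- `two-step` requires. A top is used with the coefficient of its own prime, and m/2 only with
  -- that of the prime 2.
  entry : ∀ {v w} → (ℕ → ℤ × ℤ) → View v → View w → ℤ
  entry f (isGeneric _ _) (isTop (p , _)) = proj₁ (f p)
  entry f (isGeneric _ _) (isHalf _ _ _)  = proj₂ (f 2)
  entry f (isGeneric _ _) (isGeneric _ _) = + 0
  entry f (isTop _)       _               = + 0
  entry f (isHalf _ _ _)  _               = + 0

  A : ⟦ PU ⟧ → ⟦ PU ⟧ → ℤ
  A i j = entry (coeff i) (view i) (view j)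

  private
    entry-generic : ∀ {v w} f (V : View v) ¬t ¬x → entry f V (isGeneric {w} ¬t ¬x) ≡ + 0
    entry-generic f (isTop _)       _ _ = refl
    entry-generic f (isHalf _ _ _)  _ _ = refl
    entry-generic f (isGeneric _ _) _ _ = refl

    two-step : ∀ j → (V : View (rep j)) → V ≡ view j → (∀ i → A i j ≡ + 0) ⊎ (∀ l → A j l ≡ + 0)
    two-step j (isGeneric ¬t ¬x) eq = inj₁ λ i → trans (cong (entry (coeff i) (view i)) (sym eq)) (entry-generic (coeff i) (view i) ¬t ¬x)
    two-step j (isTop t) eq         = inj₂ λ l → cong (λ V → entry (coeff j) V (view l)) (sym eq)
    two-step j (isHalf ¬t x h) eq   = inj₂ λ l → cong (λ V → entry (coeff j) V (view l)) (sym eq)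

    *0-∣ : ∀ {k z} → z ≡ + 0 → ∀ a → k ∣ a * z
    *0-∣ refl a = ∣-resp (sym (ℤP.*-zeroʳ a)) ∣-zero

    good-order : ∀ i p ab → Good i p ab → ∀ τ → rep τ ℕ.* πp p m ≡ m → P τ ∣ P i * proj₁ ab
    good-order i p _ (plain ord _)    τ eq = ord τ eq
    good-order i p _ (halved _ _ _) τ eq = *0-∣ refl (P i)

    order : ∀ i j (V : View (rep i)) (W : View (rep j)) → P j ∣ P i * entry (coeff i) V W
    order i j (isGeneric _ _) (isTop (p , pr , p∣m , eq)) = good-order i p (coeff i p) (coeff-good i p pr p∣m) j eq
    order i j (isGeneric _ _) (isHalf _ x eq)  = ∣m⇒∣m*n (proj₂ (coeff i 2)) (half-order x j eq i)
    order i j (isGeneric _ _) (isGeneric _ _)  = *0-∣ refl (P i)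
    order i j (isTop _)       _                = *0-∣ refl (P i)
    order i j (isHalf _ _ _)  _                = *0-∣ refl (P i)

  changed-two-step : ∀ j → (∀ i → A i j ≡ + 0) ⊎ (∀ l → A j l ≡ + 0)
  changed-two-step j = two-step j (view j) refl

  changed-order : ∀ i j → P j ∣ P i * A i j
  changed-order i j = order i j (view i) (view j)

  changedBasis : Basis m (+ 1) PU (changed periodicBasis A changed-two-step changed-order) P
  changedBasis = changeBasis periodicBasis A changed-two-step changed-order (λ i → 1∣ _)

  private
    rowSum : ∀ {v} → (ℕ → ℤ × ℤ) → View v → ℤ
    rowSum f V = sumU PU (λ j → entry f V (view j) * + rep j)

    module _ (i : ⟦ PU ⟧) (¬t : ¬ Top (rep i)) (¬x : ¬ (Exceptional × rep i ℕ.* 2 ≡ m)) where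
      V : View (rep i)
      V = isGeneric ¬t ¬x

      term : ⟦ PU ⟧ → ℤ
      term j = entry (coeff i) V (view j) * + rep j

      module _ (p : ℕ) (pr : Prime p) (p∣m : p ℕD.∣ m) where
        open Part p pr p∣m

        same-prime : ∀ {v} → 1 ≤ v → v ℕ.* πp p m ≡ m → ((q , _) : Top v) → q ≡ p
        same-prime h eq t = top-prime-unique h t (p , pr , p∣m , eq)

        plain-case : ∀ a → coeff i p ≡ (a , + 0) → (∀ τ → rep τ ℕ.* πp p m ≡ m → + πp p m ∣ a * + rep τ - + rep i) →
                     + πp p m ∣ rowSum (coeff i) V - + rep i
        plain-case a ce res = ∣-chain (rowSum (coeff i) V) (term τ) (+ rep i) (sumU-single PU term τ (λ j ne → off j ne (view j)))
            (subst (λ z → + πp p m ∣ z * + rep τ - + rep i) (sym (at-top (view τ))) (res τ (proj₂ top)))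
          where
          τ = proj₁ top
          at-top : (W : View (rep τ)) → entry (coeff i) V W ≡ a
          at-top (isTop t) = trans (cong (λ q → proj₁ (coeff i q)) (same-prime (1≤rep τ) (proj₂ top) t)) (cong proj₁ ce)
          at-top (isHalf ¬t _ _) = ⊥-elim (¬t (p , pr , p∣m , proj₂ top))
          at-top (isGeneric ¬t _) = ⊥-elim (¬t (p , pr , p∣m , proj₂ top))
          off : ∀ j → j ≢ τ → (W : View (rep j)) → + πp p m ∣ entry (coeff i) V W * + rep j
          off j ne (isTop t@(q , qr , q∣m , eq)) = ∣n⇒∣m*n (proj₁ (coeff i q)) (other-top t (λ q≡p → ne
            (top-unique j τ (subst (λ z → rep j ℕ.* πp z m ≡ m) q≡p eq) (proj₂ top))))
          off j ne (isHalf _ x eq) = go (p ℕ.≟ 2)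
            where
            go : Dec (p ≡ 2) → + πp p m ∣ proj₂ (coeff i 2) * + rep j
            go (no p≢2)  = ∣n⇒∣m*n (proj₂ (coeff i 2)) (other-half eq p≢2)
            go (yes p≡2) = ∣-resp (sym (cong (_* + rep j) (trans (cong (λ z → proj₂ (coeff i z)) (sym p≡2)) (cong proj₂ ce)))) ∣-zero
          off j ne (isGeneric _ _) = ∣-zero

        halved-case : coeff i p ≡ (+ 0 , + 1) → p ≡ 2 → Exceptional → (∀ η → rep η ℕ.* 2 ≡ m → + πp p m ∣ + rep η - + rep i) →
                      + πp p m ∣ rowSum (coeff i) V - + rep i
        halved-case ce p≡2 x res = ∣-chain (rowSum (coeff i) V) (term η) (+ rep i) (sumU-single PU term η (λ j ne → off j ne (view j)))
            (∣-resp (cong (_- + rep i) (trans (sym (ℤP.*-identityˡ (+ rep η))) (cong (_* + rep η) (sym (at-half (view η)))))) (res η η-half))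
          where
          p^1 : p ℕ.^ 1 ≡ 2
          p^1 = trans (ℕP.*-identityʳ p) p≡2
          η : ⟦ PU ⟧
          η = proj₁ (member p 1 pr p∣m ℕP.≤-refl (subst (ℕD._∣ m) (sym (ℕP.*-identityʳ p)) p∣m))
          η-half : rep η ℕ.* 2 ≡ m
          η-half = trans (cong (rep η ℕ.*_) (sym p^1)) (proj₂ (member p 1 pr p∣m ℕP.≤-refl (subst (ℕD._∣ m) (sym (ℕP.*-identityʳ p)) p∣m)))
          at-half : (W : View (rep η)) → entry (coeff i) V W ≡ + 1
          at-half (isTop t) = ⊥-elim (half-not-top (1≤rep η) x η-half t)
          at-half (isHalf _ _ _) = trans (cong (λ z → proj₂ (coeff i z)) (sym p≡2)) (cong proj₂ ce)
          at-half (isGeneric _ ¬x) = ⊥-elim (¬x (x , η-half))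
          off : ∀ j → j ≢ η → (W : View (rep j)) → + πp p m ∣ entry (coeff i) V W * + rep j
          off j ne (isTop t@(q , _)) = go (q ℕ.≟ p)
            where
            go : Dec (q ≡ p) → + πp p m ∣ proj₁ (coeff i q) * + rep j
            go (no q≢p)  = ∣n⇒∣m*n (proj₁ (coeff i q)) (other-top t q≢p)
            go (yes q≡p) = ∣-resp (sym (cong (_* + rep j) (trans (cong (λ z → proj₁ (coeff i z)) q≡p) (cong proj₁ ce)))) ∣-zero
          off j ne (isHalf _ _ eq) = ⊥-elim (ne (rep-injective j η (ℕP.*-cancelʳ-≡ (rep j) (rep η) 2 (trans eq (sym η-half)))))
          off j ne (isGeneric _ _) = ∣-zero

        part : ∀ ab → coeff i p ≡ ab → Good i p ab → + πp p m ∣ rowSum (coeff i) V - + rep i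
        part _ ce (plain _ res)        = plain-case _ ce res
        part _ ce (halved p≡2 x res) = halved-case ce p≡2 x res

      -- Modulo π_p(m) the tops of other primes vanish, and so does m/2 for odd p. For p = 2 at most
      -- one of the two coefficients, at the top and at m/2, is nonzero. So at most one term of the
      -- row survives, and `Good` says that its value is `rep i`.
      row-generic : + m ∣ rowSum (coeff i) V - + rep i
      row-generic = ∣-by-primary-parts m _ 1≤m (λ p pr p∣m → part p pr p∣m (coeff i p) refl (coeff-good i p pr p∣m))

    negate : ∀ {k} r s → k ∣ s - r → k ∣ r + (- + 1) * s
    negate r s p = ∣-resp (lem r s) (∣m⇒∣-m p)
      where lem : ∀ r s → - (s - r) ≡ r + (- + 1) * s
            lem = solve-∀

  Ψ : ⟦ PU ⟧ → ℤ
  Ψ i = ψ (changed periodicBasis A changed-two-step changed-order i)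

  private
    Ψ-row : ∀ i → Ψ i ≡ + rep i + (- + 1) * rowSum (coeff i) (view i)
    Ψ-row i = cong (λ z → + rep i + (- + 1) * z) (ev-lin id PU (A i) E)

    special-row : ∀ r {v} (V : View v) → (∀ f j → entry f V (view j) ≡ + 0) → ∀ f → + r + (- + 1) * rowSum f V ≡ + r
    special-row r V p f = trans (cong (λ z → + r + (- + 1) * z) (sumU-zero PU _ λ j → cong (_* + rep j) (p f j))) (ℤP.+-identityʳ (+ r))

  Ψ-top : ∀ i → Top (rep i) → Ψ i ≡ + rep i
  Ψ-top i t = trans (Ψ-row i) (go (view i))
    where
    go : (V : View (rep i)) → + rep i + (- + 1) * rowSum (coeff i) V ≡ + rep i
    go V@(isTop _) = special-row (rep i) V (λ _ _ → refl) (coeff i)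
    go V@(isHalf _ _ _) = special-row (rep i) V (λ _ _ → refl) (coeff i)
    go (isGeneric ¬t _) = ⊥-elim (¬t t)

  Ψ-half : ∀ i → Exceptional → rep i ℕ.* 2 ≡ m → Ψ i ≡ + rep i
  Ψ-half i x eq = trans (Ψ-row i) (go (view i))
    where
    go : (V : View (rep i)) → + rep i + (- + 1) * rowSum (coeff i) V ≡ + rep i
    go V@(isTop _) = special-row (rep i) V (λ _ _ → refl) (coeff i)
    go V@(isHalf _ _ _) = special-row (rep i) V (λ _ _ → refl) (coeff i)
    go (isGeneric _ ¬x) = ⊥-elim (¬x (x , eq))

  Ψ-generic : ∀ i → ¬ Top (rep i) → ¬ (Exceptional × rep i ℕ.* 2 ≡ m) → + m ∣ Ψ i
  Ψ-generic i ¬t ¬x = ∣-resp (sym (Ψ-row i)) (go (view i))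
    where
    go : (V : View (rep i)) → + m ∣ + rep i + (- + 1) * rowSum (coeff i) V
    go (isTop t) = ⊥-elim (¬t t)
    go (isHalf _ x eq) = ⊥-elim (¬x (x , eq))
    go (isGeneric ¬t ¬x) = negate (+ rep i) (rowSum (coeff i) (isGeneric ¬t ¬x)) (row-generic i ¬t ¬x)

-- The kernel of ψ when m is prime to d

module KernelAtM (d : ℤ) (m : ℕ) .{{m≢0 : ℕ.NonZero m}} (coprime : gcd m (∣ d ∣) ≡ 1) (o : ℕ → ℕ) (𝒱 : List ℕ)
                 (repSet : IsRepSet m d 𝒱) (orbitSize : ∀ v → v ∈ 𝒱 → IsOrbitSize m d v (o v)) where
  open Dune d
  open Bases d
  open Changed d m coprime o 𝒱 repSet orbitSize

  private
    -- the part of the exponent that is split off in the first restriction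
    κ : ∀ {v c} → Exponent v c → ℕ
    κ {c = c} (regular _ _)       = c
    κ {c = c} (exceptional _ _ _) = c
    κ         (half _ _ _)        = 1
    κ         (generic _ _)       = 1

    -- In the exceptional case the first restriction stops at weights divisible by m/2, where
    -- independence still holds; the last factor 2 is dealt with after the twist.
    N₀ : Dec Exceptional → ℕ
    N₀ (yes _) = m ℕ./ 2
    N₀ (no _)  = m

    module Half (x : Exceptional) where
      η₀ : ℕ
      η₀ = m ℕ./ 2

      2∣m : 2 ℕD.∣ m
      2∣m = ℕD.∣-trans (ℕD.divides 2 refl) (proj₁ x)

      η₀*2 : η₀ ℕ.* 2 ≡ m
      η₀*2 = ℕM.m/n*n≡m 2∣m

      half-value : ∀ {v} → v ℕ.* 2 ≡ m → v ≡ η₀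
      half-value {v} eq = ℕP.*-cancelʳ-≡ v η₀ 2 (trans eq (sym η₀*2))

    module Two (p : ℕ) (pr : Prime p) (p∣m : p ℕD.∣ m) (p≡2 : p ≡ 2) (x : Exceptional) where
      open Part p pr p∣m
      open Half x

      k : ℕ
      k = ν ℕ.∸ 1

      ν≡ : ν ≡ suc k
      ν≡ = sym (ℕP.m+[n∸m]≡n (ν>0 p∣m))

      2^k : ℕ
      2^k = p ℕ.^ k

      π≡2^k : πp 2 m ≡ 2^k ℕ.* 2
      π≡2^k = trans (cong (λ q → πp q m) (sym p≡2)) (trans π≡ (trans (cong (p ℕ.^_) ν≡) (trans (cong (ℕ._* 2^k) p≡2) (ℕP.*-comm 2 2^k))))

      div-2 : πp 2 m div 2 ≡ 2^k
      div-2 = trans (cong (ℕ._/ 2) π≡2^k) (ℕM.m*n/n≡m 2^k 2)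

      2^k∣π : + 2^k ∣ + πp p m
      2^k∣π = ∣ℕ⇒∣ℤ (ℕD.divides 2 (trans (cong (λ q → πp q m) p≡2) (trans π≡2^k (ℕP.*-comm 2^k 2))))

      top*2^k : ∀ {v} → v ℕ.* πp p m ≡ m → v ℕ.* 2^k ≡ η₀
      top*2^k {v} eq = half-value (trans (ℕP.*-assoc v 2^k 2) (trans (cong (v ℕ.*_) (trans (sym π≡2^k) (cong (λ q → πp q m) (sym p≡2)))) eq))

      2^k∣η₀ : + 2^k ∣ + η₀
      2^k∣η₀ = ∣ℕ⇒∣ℤ (ℕD.divides (rep (proj₁ top)) (sym (top*2^k {rep (proj₁ top)} (proj₂ top))))

      cancel-top : ∀ {v} → v ℕ.* πp p m ≡ m → ∀ a → + 2^k ∣ a * + v → + 2^k ∣ a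
      cancel-top {v} eq a h = subst (_∣ a) (sym (pos-^ p k)) (cancel-unit k (+ v) a (p∤top eq)
        (subst₂ _∣_ (pos-^ p k) (ℤP.*-comm a (+ v)) h))

    N₀∣m : ∀ x? → + N₀ x? ∣ + m
    N₀∣m (yes x) = ∣ℕ⇒∣ℤ (ℕD.divides 2 (trans (sym (Half.η₀*2 x)) (ℕP.*-comm (Half.η₀ x) 2)))
    N₀∣m (no _)  = ∣-refl

    κ∣P : ∀ i {c} (e : Exponent (rep i) c) → + κ e ∣ P i
    κ∣P i (regular (p , pr , p∣m , eq) _) = subst (_∣ P i) (sym π≡ℤ) (cancel-unit ν (+ rep i) (P i) (p∤top eq)
        (∣-trans π∣m (∣-resp (ℤP.*-comm (P i) (+ rep i)) (O.closed i))))
      where open Part p pr p∣m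
    κ∣P i (exceptional (p , pr , p∣m , eq) p≡2 x) = subst (λ z → + z ∣ P i) (sym div-2) (cancel-top {rep i} eq (P i)
        (∣-trans 2^k∣π (∣-trans π∣m′ (O.closed i))))
      where open Part p pr p∣m
            open Two p pr p∣m p≡2 x
    κ∣P i (half _ _ _)  = 1∣ _
    κ∣P i (generic _ _) = 1∣ _

    κ≢0 : ∀ {v c} (e : Exponent v c) → ℤ.NonZero (+ κ e)
    κ≢0 (regular (p , pr , p∣m , eq) _) = subst ℕ.NonZero (sym π≡) (ℕP.m^n≢0 p ν {{prime⇒nonZero pr}})
      where open Part p pr p∣m
    κ≢0 (exceptional (p , pr , p∣m , eq) p≡2 x) = subst ℕ.NonZero (sym div-2) (ℕP.m^n≢0 p k {{prime⇒nonZero pr}})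
      where open Two p pr p∣m p≡2 x
    κ≢0 (half _ _ _)  = _
    κ≢0 (generic _ _) = _

    κ-mem : ∀ i x? {c} (e : Exponent (rep i) c) → + N₀ x? ∣ + κ e * Ψ i
    κ-mem i x? (regular tv@(p , pr , p∣m , eq) _) = ∣-trans (N₀∣m x?) (∣-reflexive (trans (cong +_ (trans (sym eq) (ℕP.*-comm (rep i) (πp p m))))
      (trans (ℤP.pos-* (πp p m) (rep i)) (cong (+ πp p m *_) (sym (Ψ-top i tv))))))
    κ-mem i (yes _) (exceptional tv@(p , pr , p∣m , eq) p≡2 x) = ∣-reflexive (trans (cong +_ (trans (sym (top*2^k {rep i} eq)) (ℕP.*-comm (rep i) 2^k)))
        (trans (ℤP.pos-* 2^k (rep i)) (cong₂ (λ a b → + a * b) (sym div-2) (sym (Ψ-top i tv)))))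
      where open Two p pr p∣m p≡2 x
    κ-mem i (no ¬x) (exceptional _ _ x) = ⊥-elim (¬x x)
    κ-mem i (yes _) (half _ x eq) = ∣-reflexive (trans (cong +_ (sym (Half.half-value x {rep i} eq))) (trans (sym (Ψ-half i x eq)) (sym (ℤP.*-identityˡ (Ψ i)))))
    κ-mem i (no ¬x) (half _ x eq) = ⊥-elim (¬x x)
    κ-mem i x? (generic ¬t ¬x) = ∣-resp (sym (ℤP.*-identityˡ (Ψ i))) (∣-trans (N₀∣m x?) (Ψ-generic i ¬t ¬x))

    isolate : ∀ {k} (a : ⟦ PU ⟧ → ℤ) i → k ∣ sumU PU (λ j → a j * Ψ j) → (∀ j → j ≢ i → View (rep j) → k ∣ Ψ j) → k ∣ a i * Ψ i
    isolate a i h off = ∣-diff′ (sumU-single PU (λ j → a j * Ψ j) i (λ j ne → ∣n⇒∣m*n (a j) (off j ne (view j)))) h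

    -- Modulo `κ e`, a power of p, all weights other than that of i vanish, while the weight of i is
    -- prime to p and can be cancelled. For p = 2 in the exceptional case only half of π_2(m) is
    -- used, so that the weight m/2 vanishes too.
    κ-critical : ∀ x? (a : ⟦ PU ⟧ → ℤ) → + N₀ x? ∣ sumU PU (λ j → a j * Ψ j) → ∀ i {c} (e : Exponent (rep i) c) → + κ e ∣ a i
    κ-critical x? a h i (regular tv@(p , pr , p∣m , eq) ok) = subst (_∣ a i) (sym π≡ℤ) (cancel-unit ν (+ rep i) (a i) (p∤top eq)
        (subst₂ _∣_ π≡ℤ (trans (cong (a i *_) (Ψ-top i tv)) (ℤP.*-comm (a i) (+ rep i))) (isolate a i (∣-trans (π∣N₀ x? ok) h) off)))
      where
      open Part p pr p∣m
      π∣N₀ : ∀ x? → p ≢ 2 ⊎ ¬ Exceptional → + πp p m ∣ + N₀ x?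
      π∣N₀ (no _)  _ = π∣m′
      π∣N₀ (yes x) (inj₂ ¬x) = ⊥-elim (¬x x)
      π∣N₀ (yes x) (inj₁ ne) = other-half (Half.η₀*2 x) ne
      half-∣ : ∀ j → Exceptional → rep j ℕ.* 2 ≡ m → p ≢ 2 ⊎ ¬ Exceptional → + πp p m ∣ Ψ j
      half-∣ j x eq (inj₁ ne) = ∣-resp (sym (Ψ-half j x eq)) (other-half eq ne)
      half-∣ j x eq (inj₂ ¬x) = ⊥-elim (¬x x)
      off : ∀ j → j ≢ i → View (rep j) → + πp p m ∣ Ψ j
      off j ne (isTop t′@(q , _ , _ , eq′)) = ∣-resp (sym (Ψ-top j t′)) (other-top t′ λ q≡p → ne
        (top-unique j i (subst (λ z → rep j ℕ.* πp z m ≡ m) q≡p eq′) eq))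
      off j ne (isHalf _ x eq′)  = half-∣ j x eq′ ok
      off j ne (isGeneric ¬t ¬x) = ∣-trans π∣m′ (Ψ-generic j ¬t ¬x)
    κ-critical (no ¬x) a h i (exceptional _ _ x) = ⊥-elim (¬x x)
    κ-critical (yes _) a h i (exceptional tv@(p , pr , p∣m , eq) p≡2 x) = subst (λ z → + z ∣ a i) (sym div-2) (cancel-top {rep i} eq (a i)
        (∣-resp (cong (a i *_) (Ψ-top i tv)) (isolate a i (∣-trans 2^k∣η₀ h) off)))
      where
      open Part p pr p∣m
      open Two p pr p∣m p≡2 x
      off : ∀ j → j ≢ i → View (rep j) → + 2^k ∣ Ψ j
      off j ne (isTop t′@(q , _ , _ , eq′)) = ∣-resp (sym (Ψ-top j t′)) (∣-trans 2^k∣π (other-top t′ λ q≡p → ne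
        (top-unique j i (subst (λ z → rep j ℕ.* πp z m ≡ m) q≡p eq′) eq)))
      off j ne (isHalf _ x eq′)  = ∣-resp (trans (cong +_ (sym (Half.half-value x {rep j} eq′))) (sym (Ψ-half j x eq′))) 2^k∣η₀
      off j ne (isGeneric ¬t ¬x) = ∣-trans 2^k∣π (∣-trans π∣m′ (Ψ-generic j ¬t ¬x))
    κ-critical x? a h i (half _ _ _)  = 1∣ _
    κ-critical x? a h i (generic _ _) = 1∣ _

  private
    c : ⟦ PU ⟧ → ℕ
    c i = cOf m d (rep i)

    ex : ∀ i → Exponent (rep i) (c i)
    ex i = exponent (rep i)

    M₀ : ⟦ PU ⟧ → ℤ
    M₀ i = quotient (κ∣P i (ex i))

    P-split : ∀ i → P i ≡ + κ (ex i) * M₀ i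
    P-split i = trans (_∣_.equality (κ∣P i (ex i))) (ℤP.*-comm (M₀ i) (+ κ (ex i)))

    G₀ : ⟦ PU ⟧ → T
    G₀ i = (+ κ (ex i)) • changed periodicBasis A changed-two-step changed-order i

    restricted : ∀ x? → Basis m (+ N₀ x?) PU G₀ M₀
    restricted x? = restrictBasis changedBasis (λ i → + κ (ex i)) M₀ P-split (λ i → κ≢0 (ex i)) (N₀∣m x?) (1∣ _)
      (λ i → κ-mem i x? (ex i)) (λ a h i → κ-critical x? a h i (ex i))

  KernelBasis : Set
  KernelBasis = Σ (⟦ PU ⟧ → T) λ H → Σ (⟦ PU ⟧ → ℤ) λ PS → Basis m (+ m) PU H PS × (∀ i → P i ≡ + cOf m d (rep i) * PS i)

  private
    unexceptional : ¬ Exceptional → KernelBasis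
    unexceptional ¬x = G₀ , M₀ , restricted (no ¬x) , λ i → trans (P-split i) (cong (λ z → + z * M₀ i) (κ≡c (ex i)))
      where
      κ≡c : ∀ {v c} (e : Exponent v c) → κ e ≡ c
      κ≡c (regular _ _)       = refl
      κ≡c (exceptional _ _ _) = refl
      κ≡c (half _ x _)        = ⊥-elim (¬x x)
      κ≡c (generic _ _)       = refl

    module _ (x : Exceptional) where
      open Half x

      two : Σ ⟦ PU ⟧ λ τ → rep τ ℕ.* πp 2 m ≡ m
      two = Part.top 2 prime[2] 2∣m

      τ : ⟦ PU ⟧
      τ = proj₁ two

      η-half : Σ ⟦ PU ⟧ λ η → rep η ℕ.* 2 ≡ m
      η-half = member 2 1 prime[2] 2∣m ℕP.≤-refl 2∣m

      η : ⟦ PU ⟧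
      η = proj₁ η-half

      τ-top : Top (rep τ)
      τ-top = 2 , prime[2] , 2∣m , proj₂ two

      η-not-top : ¬ Top (rep η)
      η-not-top = half-not-top (1≤rep η) x (proj₂ η-half)

      τ≢η : τ ≢ η
      τ≢η eq = η-not-top (subst (λ i → Top (rep i)) eq τ-top)

      open Two 2 prime[2] 2∣m refl x

      κτ : ∀ {c} (e : Exponent (rep τ) c) → κ e ≡ 2^k
      κτ (regular t ok) = ⊥-elim (go ok)
        where
        go : proj₁ t ≢ 2 ⊎ ¬ Exceptional → ⊥
        go (inj₁ ne) = ne (top-prime-unique (1≤rep τ) t τ-top)
        go (inj₂ ¬x) = ¬x x
      κτ (exceptional _ _ _) = div-2
      κτ (half ¬t _ _)       = ⊥-elim (¬t τ-top)
      κτ (generic ¬t _)      = ⊥-elim (¬t τ-top)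

      κη : ∀ {c} (e : Exponent (rep η) c) → κ e ≡ 1 × c ≡ 2
      κη (regular t _)       = ⊥-elim (η-not-top t)
      κη (exceptional t _ _) = ⊥-elim (η-not-top t)
      κη (half _ _ _)        = refl , refl
      κη (generic _ ¬x)      = ⊥-elim (¬x (x , proj₂ η-half))

      κ≢η : ∀ i → i ≢ η → ∀ {c} (e : Exponent (rep i) c) → κ e ≡ c
      κ≢η i ne (regular _ _)       = refl
      κ≢η i ne (exceptional _ _ _) = refl
      κ≢η i ne (half _ _ eq)       = ⊥-elim (ne (rep-injective i η (trans (half-value {rep i} eq) (sym (half-value {rep η} (proj₂ η-half))))))
      κ≢η i ne (generic _ _)       = refl

      w : ℤ
      w = quotient (∣ᵤ⇒∣ {+ 4} {d - + 3} (proj₂ x))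

      -- The odd number (d - 1) / 2. With this choice the twist respects orders: `M₀ η` divides 2 u
      -- and `M₀ τ` is even, so `M₀ τ` kills u times the generator at η.
      u : ℤ
      u = + 1 + + 2 * w

      d-1 : d - + 1 ≡ + 2 * u
      d-1 = trans (lem₁ d) (trans (cong (_+ + 2) (_∣_.equality (∣ᵤ⇒∣ {+ 4} {d - + 3} (proj₂ x)))) (lem₂ w))
        where lem₁ : ∀ d → d - + 1 ≡ (d - + 3) + + 2
              lem₁ = solve-∀
              lem₂ : ∀ w → w * + 4 + + 2 ≡ + 2 * (+ 1 + + 2 * w)
              lem₂ = solve-∀

      -- since u is odd, adding u times the half generator to the generator at τ kills its weight modulo m
      twist : ∀ {i j} → Dec (i ≡ τ) → Dec (j ≡ η) → ℤ
      twist (yes _) (yes _) = - u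
      twist (yes _) (no _)  = + 0
      twist (no _)  _       = + 0

      A₂ : ⟦ PU ⟧ → ⟦ PU ⟧ → ℤ
      A₂ i j = twist (i Fin.≟ τ) (j Fin.≟ η)

      twist-column : ∀ {i j} (a : Dec (i ≡ τ)) (b : Dec (j ≡ η)) → j ≢ η → twist a b ≡ + 0
      twist-column (yes _) (yes eq) ne = ⊥-elim (ne eq)
      twist-column (yes _) (no _)   ne = refl
      twist-column (no _)  _        ne = refl

      twist-row : ∀ {i j} (a : Dec (i ≡ τ)) (b : Dec (j ≡ η)) → i ≢ τ → twist a b ≡ + 0
      twist-row (yes eq) _ ne = ⊥-elim (ne eq)
      twist-row (no _)   _ ne = refl

      two-step₂ : ∀ j → (∀ i → A₂ i j ≡ + 0) ⊎ (∀ l → A₂ j l ≡ + 0)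
      two-step₂ j = go (j Fin.≟ η)
        where
        go : Dec (j ≡ η) → (∀ i → A₂ i j ≡ + 0) ⊎ (∀ l → A₂ j l ≡ + 0)
        go (no ne)  = inj₁ λ i → twist-column (i Fin.≟ τ) (j Fin.≟ η) ne
        go (yes eq) = inj₂ λ l → twist-row (j Fin.≟ τ) (l Fin.≟ η) (λ j≡τ → τ≢η (trans (sym j≡τ) eq))

      Pη∣2u : P η ∣ + 2 * u
      Pη∣2u = ∣-resp d-1 (half-order-d x η (proj₂ η-half))

      M₀η : M₀ η ≡ P η
      M₀η = trans (sym (ℤP.*-identityˡ (M₀ η))) (trans (cong (λ z → + z * M₀ η) (sym (proj₁ (κη (ex η))))) (sym (P-split η)))

      -- All of π_2(m) divides `P τ`, but only half of it was split off.
      2∣M₀τ : + 2 ∣ M₀ τ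
      2∣M₀τ = *-cancelˡ-∣ (+ 2^k) {{2^k≢0}} (subst₂ _∣_ (trans (cong +_ π≡2^k) (ℤP.pos-* 2^k 2))
          (trans (P-split τ) (cong (λ z → + z * M₀ τ) (κτ (ex τ)))) π∣Pτ)
        where
        2^k≢0 : ℤ.NonZero (+ 2^k)
        2^k≢0 = ℕP.m^n≢0 2 k
        open Part 2 prime[2] 2∣m
        π∣Pτ : + πp 2 m ∣ P τ
        π∣Pτ = subst (_∣ P τ) (sym π≡ℤ) (cancel-unit ν (+ rep τ) (P τ) (p∤top (proj₂ two))
          (∣-trans π∣m (∣-resp (ℤP.*-comm (P τ) (+ rep τ)) (O.closed τ))))

      order₂ : ∀ i j → M₀ j ∣ M₀ i * A₂ i j
      order₂ i j = go i j (i Fin.≟ τ) (j Fin.≟ η)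
        where
        zero-case : ∀ i j → M₀ j ∣ M₀ i * + 0
        zero-case i j = ∣-resp (sym (ℤP.*-zeroʳ (M₀ i))) ∣-zero
        go : ∀ i j (a : Dec (i ≡ τ)) (b : Dec (j ≡ η)) → M₀ j ∣ M₀ i * twist a b
        go i j (yes refl) (yes refl) = finish 2∣M₀τ
          where
          lem : ∀ q u → (- q) * (+ 2 * u) ≡ q * + 2 * (- u)
          lem = solve-∀
          finish : + 2 ∣ M₀ τ → M₀ η ∣ M₀ τ * - u
          finish (divides q eq) = ∣-resp (trans (lem q u) (cong (_* - u) (sym eq))) (∣n⇒∣m*n (- q) (subst (_∣ + 2 * u) (sym M₀η) Pη∣2u))
        go i j (yes _) (no _) = zero-case i j
        go i j (no _)  _      = zero-case i j

      B₁ : Basis m (+ η₀) PU G₀ M₀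
      B₁ = restricted (yes x)

      G₁ : ⟦ PU ⟧ → T
      G₁ = changed B₁ A₂ two-step₂ order₂

      Ψ₁ : ∀ i → ψ (G₁ i) ≡ ψ (G₀ i) + (- + 1) * sumU PU (λ j → A₂ i j * ψ (G₀ j))
      Ψ₁ i = cong (λ z → ψ (G₀ i) + (- + 1) * z) (ev-lin id PU (A₂ i) G₀)

      Ψ₁-untwisted : ∀ i → i ≢ τ → ψ (G₁ i) ≡ ψ (G₀ i)
      Ψ₁-untwisted i ne = trans (Ψ₁ i) (trans (cong (λ z → ψ (G₀ i) + (- + 1) * z)
        (sumU-zero PU _ λ j → cong (_* ψ (G₀ j)) (twist-row (i Fin.≟ τ) (j Fin.≟ η) ne))) (ℤP.+-identityʳ (ψ (G₀ i))))

      ψG₀τ : ψ (G₀ τ) ≡ + η₀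
      ψG₀τ = trans (cong₂ (λ a b → + a * b) (κτ (ex τ)) (Ψ-top τ τ-top))
        (trans (sym (ℤP.pos-* 2^k (rep τ))) (cong +_ (trans (ℕP.*-comm 2^k (rep τ)) (top*2^k {rep τ} (proj₂ two)))))

      ψG₀η : ψ (G₀ η) ≡ + η₀
      ψG₀η = trans (cong₂ (λ a b → + a * b) (proj₁ (κη (ex η))) (Ψ-half η x (proj₂ η-half)))
        (trans (ℤP.*-identityˡ (+ rep η)) (cong +_ (half-value {rep η} (proj₂ η-half))))

      mℤ : + η₀ * + 2 ≡ + m
      mℤ = trans (sym (ℤP.pos-* η₀ 2)) (cong +_ η₀*2)

      Ψ₁-τ : + m ∣ ψ (G₁ τ)
      Ψ₁-τ = ∣-resp (sym (trans (Ψ₁ τ) (cong₂ (λ a s → a + (- + 1) * s) ψG₀τ row)))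
          (subst (_∣ + η₀ + (- + 1) * (- u * + η₀)) mℤ (∣-by (+ 1 + w) (lem (+ η₀) w)))
        where
        entry-τη : A₂ τ η ≡ - u
        entry-τη = go (τ Fin.≟ τ) (η Fin.≟ η)
          where
          go : (a : Dec (τ ≡ τ)) (b : Dec (η ≡ η)) → twist a b ≡ - u
          go (yes _) (yes _) = refl
          go (no ne) _       = ⊥-elim (ne refl)
          go (yes _) (no ne) = ⊥-elim (ne refl)
        row : sumU PU (λ j → A₂ τ j * ψ (G₀ j)) ≡ - u * + η₀
        row = trans (ℤP.i-j≡0⇒i≡j _ _ (0∣⇒≡0 (sumU-single PU (λ j → A₂ τ j * ψ (G₀ j)) η
            (λ j ne → ∣-reflexive (sym (cong (_* ψ (G₀ j)) (twist-column (τ Fin.≟ τ) (j Fin.≟ η) ne)))))))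
          (cong₂ _*_ entry-τη ψG₀η)
        lem : ∀ h w → h + (- + 1) * (- (+ 1 + + 2 * w) * h) ≡ (+ 1 + w) * (h * + 2)
        lem = solve-∀

      ordinary : ∀ i → i ≢ η → + m ∣ ψ (G₁ i)
      ordinary i ne = go (i Fin.≟ τ) (ex i)
        where
        weight : i ≢ τ → ∀ {c} (e : Exponent (rep i) c) → + m ∣ + κ e * Ψ i
        weight _ (regular tv@(p , pr , p∣m , eq) _) = ∣-reflexive (trans (cong +_ (trans (sym eq) (ℕP.*-comm (rep i) (πp p m))))
          (trans (ℤP.pos-* (πp p m) (rep i)) (cong (+ πp p m *_) (sym (Ψ-top i tv)))))
        weight i≢τ (exceptional (p , pr , p∣m , eq) p≡2 _) = ⊥-elim (i≢τ
          (Part.top-unique 2 prime[2] 2∣m i τ (subst (λ z → rep i ℕ.* πp z m ≡ m) p≡2 eq) (proj₂ two)))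
        weight _ (half _ _ eq) = ⊥-elim (ne (rep-injective i η (trans (half-value {rep i} eq) (sym (half-value {rep η} (proj₂ η-half))))))
        weight _ (generic ¬t ¬x) = ∣-resp (sym (ℤP.*-identityˡ (Ψ i))) (Ψ-generic i ¬t ¬x)
        go : Dec (i ≡ τ) → Exponent (rep i) (c i) → + m ∣ ψ (G₁ i)
        go (yes refl) _ = Ψ₁-τ
        go (no i≢τ) _   = ∣-resp (sym (Ψ₁-untwisted i i≢τ)) (weight i≢τ (ex i))

      Ψ₁-η : ψ (G₁ η) ≡ + η₀
      Ψ₁-η = trans (Ψ₁-untwisted η (τ≢η ∘ sym)) ψG₀η

      η₀∣m : + η₀ ∣ + m
      η₀∣m = N₀∣m (yes x)

      B₂ : Basis m (+ η₀) PU G₁ M₀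
      B₂ = changeBasis B₁ A₂ two-step₂ order₂ mem₁
        where
        mem₁ : ∀ i → + η₀ ∣ ψ (G₁ i)
        mem₁ i = go (i Fin.≟ η)
          where
          go : Dec (i ≡ η) → + η₀ ∣ ψ (G₁ i)
          go (yes refl) = ∣-reflexive (sym Ψ₁-η)
          go (no ne)    = ∣-trans η₀∣m (ordinary i ne)

      -- After the twist the generator at η alone has nonzero weight modulo m, namely m/2, so it
      -- alone is doubled.
      double : ∀ {i} → Dec (i ≡ η) → ℕ
      double (yes _) = 2
      double (no _)  = 1

      c₂ : ⟦ PU ⟧ → ℕ
      c₂ i = double (i Fin.≟ η)

      double∣M₀ : ∀ i (i? : Dec (i ≡ η)) → + double i? ∣ M₀ i
      double∣M₀ i (no _)     = 1∣ _
      double∣M₀ i (yes refl) = subst (+ 2 ∣_) (sym M₀η) (*-cancelˡ-∣ (+ rep η) {{ℕ.>-nonZero (1≤rep η)}}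
        (subst₂ _∣_ (trans (cong +_ (sym (proj₂ η-half))) (ℤP.pos-* (rep η) 2)) (ℤP.*-comm (P η) (+ rep η)) (O.closed η)))

      M₁ : ⟦ PU ⟧ → ℤ
      M₁ i = quotient (double∣M₀ i (i Fin.≟ η))

      M₀-split : ∀ i → M₀ i ≡ + c₂ i * M₁ i
      M₀-split i = trans (_∣_.equality (double∣M₀ i (i Fin.≟ η))) (ℤP.*-comm (M₁ i) (+ c₂ i))

      double≢0 : ∀ {i} (i? : Dec (i ≡ η)) → ℤ.NonZero (+ double i?)
      double≢0 (yes _) = _
      double≢0 (no _)  = _

      double-mem : ∀ i (i? : Dec (i ≡ η)) → + m ∣ + double i? * ψ (G₁ i)
      double-mem i (no ne)    = ∣-resp (sym (ℤP.*-identityˡ (ψ (G₁ i)))) (ordinary i ne)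
      double-mem i (yes refl) = ∣-reflexive (sym (trans (cong (+ 2 *_) Ψ₁-η) (trans (ℤP.*-comm (+ 2) (+ η₀)) mℤ)))

      η₀≢0 : ℤ.NonZero (+ η₀)
      η₀≢0 = ℕ.≢-nonZero λ z → ℕ.≢-nonZero⁻¹ m (trans (sym η₀*2) (cong (ℕ._* 2) z))

      double-critical : ∀ (a : ⟦ PU ⟧ → ℤ) → + m ∣ sumU PU (λ i → a i * ψ (G₁ i)) → ∀ i (i? : Dec (i ≡ η)) → + double i? ∣ a i
      double-critical a h i (no _)     = 1∣ _
      double-critical a h i (yes refl) = *-cancelˡ-∣ (+ η₀) {{η₀≢0}} (subst₂ _∣_ (sym mℤ)
        (trans (cong (a η *_) Ψ₁-η) (ℤP.*-comm (a η) (+ η₀)))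
        (∣-diff′ (sumU-single PU (λ i → a i * ψ (G₁ i)) η (λ j ne → ∣n⇒∣m*n (a j) (ordinary j ne))) h))

      B₃ : Basis m (+ m) PU (λ i → (+ c₂ i) • G₁ i) M₁
      B₃ = restrictBasis B₂ (λ i → + c₂ i) M₁ M₀-split (λ i → double≢0 (i Fin.≟ η)) ∣-refl η₀∣m
        (λ i → double-mem i (i Fin.≟ η)) (λ a h i → double-critical a h i (i Fin.≟ η))

      exponents-agree : ∀ i (i? : Dec (i ≡ η)) → κ (ex i) ℕ.* double i? ≡ c i
      exponents-agree i (no ne)    = trans (ℕP.*-identityʳ (κ (ex i))) (κ≢η i ne (ex i))
      exponents-agree i (yes refl) = trans (cong (ℕ._* 2) (proj₁ (κη (ex η)))) (sym (proj₂ (κη (ex η))))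

      withException : KernelBasis
      withException = (λ i → (+ c₂ i) • G₁ i) , M₁ , B₃ , λ i →
        trans (P-split i) (trans (cong (+ κ (ex i) *_) (M₀-split i)) (trans (sym (ℤP.*-assoc (+ κ (ex i)) (+ c₂ i) (M₁ i)))
          (cong (_* M₁ i) (trans (sym (ℤP.pos-* (κ (ex i)) (c₂ i))) (cong +_ (exponents-agree i (i Fin.≟ η)))))))

  kernelBasisAtM : KernelBasis
  kernelBasisAtM = go exceptional?
    where
    go : Dec Exceptional → KernelBasis
    go (yes x) = withException x
    go (no ¬x) = unexceptional ¬x

-- The groups of the statement

flat : (u : U) → (⟦ u ⟧ → ℕ) → List ℕ
flat (fin n)  f = List.tabulate f
flat (u ⊎ᵤ w) f = flat u (f ∘ inj₁) ++ flat w (f ∘ inj₂)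

-- A bijection between the nested index type and the positions in its list of moduli, through which
-- `CyclicSum` receives coordinates.
record Indexing (u : U) (f : ⟦ u ⟧ → ℕ) : Set where
  field
    pos    : Fin (length (flat u f)) → ⟦ u ⟧
    ix     : ⟦ u ⟧ → Fin (length (flat u f))
    pos-ix : ∀ i → pos (ix i) ≡ i
    ix-pos : ∀ k → ix (pos k) ≡ k
    lookup-pos : ∀ k → List.lookup (flat u f) k ≡ f (pos k)

private
  record Splitting (xs ys : List ℕ) : Set where
    field
      split  : Fin (length (xs ++ ys)) → Fin (length xs) ⊎ Fin (length ys)
      join   : Fin (length xs) ⊎ Fin (length ys) → Fin (length (xs ++ ys))
      split-join : ∀ i → split (join i) ≡ i
      join-split : ∀ k → join (split k) ≡ k
      lookup-split : ∀ k → List.lookup (xs ++ ys) k ≡ [ List.lookup xs , List.lookup ys ] (split k)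

  splitting : ∀ xs ys → Splitting xs ys
  splitting List.[] ys = record
    { split = inj₂ ; join = λ { (inj₂ k) → k } ; split-join = λ { (inj₂ k) → refl } ; join-split = λ k → refl ; lookup-split = λ k → refl }
  splitting (x List.∷ xs) ys = record { split = split′ ; join = join′ ; split-join = split-join′ ; join-split = join-split′ ; lookup-split = lookup-split′ }
    where
    open Splitting (splitting xs ys)
    shift : Fin (length xs) ⊎ Fin (length ys) → Fin (suc (length xs)) ⊎ Fin (length ys)
    shift (inj₁ k) = inj₁ (Fin.suc k)
    shift (inj₂ k) = inj₂ k
    split′ : Fin (suc (length (xs ++ ys))) → Fin (suc (length xs)) ⊎ Fin (length ys)
    split′ Fin.zero    = inj₁ Fin.zero
    split′ (Fin.suc k) = shift (split k)
    join′ : Fin (suc (length xs)) ⊎ Fin (length ys) → Fin (suc (length (xs ++ ys)))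
    join′ (inj₁ Fin.zero)    = Fin.zero
    join′ (inj₁ (Fin.suc k)) = Fin.suc (join (inj₁ k))
    join′ (inj₂ k)           = Fin.suc (join (inj₂ k))
    split-join′ : ∀ i → split′ (join′ i) ≡ i
    split-join′ (inj₁ Fin.zero)    = refl
    split-join′ (inj₁ (Fin.suc k)) = cong shift (split-join (inj₁ k))
    split-join′ (inj₂ k)           = cong shift (split-join (inj₂ k))
    join-shift : ∀ i → join′ (shift i) ≡ Fin.suc (join i)
    join-shift (inj₁ _) = refl
    join-shift (inj₂ _) = refl
    join-split′ : ∀ k → join′ (split′ k) ≡ k
    join-split′ Fin.zero    = refl
    join-split′ (Fin.suc k) = trans (join-shift (split k)) (cong Fin.suc (join-split k))
    lookup-shift : ∀ i → [ List.lookup xs , List.lookup ys ] i ≡ [ List.lookup (x List.∷ xs) , List.lookup ys ] (shift i)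
    lookup-shift (inj₁ _) = refl
    lookup-shift (inj₂ _) = refl
    lookup-split′ : ∀ k → List.lookup (x List.∷ xs ++ ys) k ≡ [ List.lookup (x List.∷ xs) , List.lookup ys ] (split′ k)
    lookup-split′ Fin.zero    = refl
    lookup-split′ (Fin.suc k) = trans (lookup-split k) (lookup-shift (split k))

private
  sucIndexing : ∀ {n} (f : Fin (suc n) → ℕ) → Indexing (fin n) (f ∘ Fin.suc) → Indexing (fin (suc n)) f
  sucIndexing {n} f I = record { pos = pos′ ; ix = ix′ ; pos-ix = pos-ix′ ; ix-pos = ix-pos′ ; lookup-pos = lookup-pos′ }
    where
    open Indexing I
    pos′ : Fin (suc (length (List.tabulate (f ∘ Fin.suc)))) → Fin (suc n)
    pos′ Fin.zero    = Fin.zero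
    pos′ (Fin.suc k) = Fin.suc (pos k)
    ix′ : Fin (suc n) → Fin (suc (length (List.tabulate (f ∘ Fin.suc))))
    ix′ Fin.zero    = Fin.zero
    ix′ (Fin.suc k) = Fin.suc (ix k)
    pos-ix′ : ∀ i → pos′ (ix′ i) ≡ i
    pos-ix′ Fin.zero    = refl
    pos-ix′ (Fin.suc k) = cong Fin.suc (pos-ix k)
    ix-pos′ : ∀ k → ix′ (pos′ k) ≡ k
    ix-pos′ Fin.zero    = refl
    ix-pos′ (Fin.suc k) = cong Fin.suc (ix-pos k)
    lookup-pos′ : ∀ k → List.lookup (f Fin.zero List.∷ List.tabulate (f ∘ Fin.suc)) k ≡ f (pos′ k)
    lookup-pos′ Fin.zero    = refl
    lookup-pos′ (Fin.suc k) = lookup-pos k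

  sumIndexing : ∀ {u w} (f : ⟦ u ⊎ᵤ w ⟧ → ℕ) → Indexing u (f ∘ inj₁) → Indexing w (f ∘ inj₂) → Indexing (u ⊎ᵤ w) f
  sumIndexing {u} {w} f II JJ = record { pos = pos′ ∘ split ; ix = ix′ ; pos-ix = pos-ix′ ; ix-pos = λ k → trans (ix-pos′ (split k)) (join-split k) ; lookup-pos = λ k → trans (lookup-split k) (lookup-pos′ (split k)) }
    where
    module I = Indexing II
    module J = Indexing JJ
    open Splitting (splitting (flat u (f ∘ inj₁)) (flat w (f ∘ inj₂)))
    pos′ : Fin (length (flat u (f ∘ inj₁))) ⊎ Fin (length (flat w (f ∘ inj₂))) → ⟦ u ⟧ ⊎ ⟦ w ⟧
    pos′ (inj₁ k) = inj₁ (I.pos k)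
    pos′ (inj₂ k) = inj₂ (J.pos k)
    ix′ : ⟦ u ⟧ ⊎ ⟦ w ⟧ → Fin (length (flat u (f ∘ inj₁) ++ flat w (f ∘ inj₂)))
    ix′ (inj₁ i) = join (inj₁ (I.ix i))
    ix′ (inj₂ i) = join (inj₂ (J.ix i))
    pos-ix′ : ∀ i → pos′ (split (ix′ i)) ≡ i
    pos-ix′ (inj₁ i) = trans (cong pos′ (split-join (inj₁ (I.ix i)))) (cong inj₁ (I.pos-ix i))
    pos-ix′ (inj₂ i) = trans (cong pos′ (split-join (inj₂ (J.ix i)))) (cong inj₂ (J.pos-ix i))
    ix-pos′ : ∀ k → ix′ (pos′ k) ≡ join k
    ix-pos′ (inj₁ k) = cong (join ∘ inj₁) (I.ix-pos k)
    ix-pos′ (inj₂ k) = cong (join ∘ inj₂) (J.ix-pos k)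
    lookup-pos′ : ∀ k → [ List.lookup (flat u (f ∘ inj₁)) , List.lookup (flat w (f ∘ inj₂)) ] k ≡ f (pos′ k)
    lookup-pos′ (inj₁ k) = I.lookup-pos k
    lookup-pos′ (inj₂ k) = J.lookup-pos k

indexing : ∀ u f → Indexing u f
indexing (fin zero)    f = record { pos = λ () ; ix = λ () ; pos-ix = λ () ; ix-pos = λ () ; lookup-pos = λ () }
indexing (fin (suc n)) f = sucIndexing f (indexing (fin n) (f ∘ Fin.suc))
indexing (u ⊎ᵤ w)      f = sumIndexing f (indexing u (f ∘ inj₁)) (indexing w (f ∘ inj₂))

-- Spans, coefficient vectors and their realization in Σ(n,d)

spanSubgroup : ∀ {N} r (g : Fin r → Vecℤ N) → Subgroup (Fin N)
sumFin-sumU : ∀ {N} r (g : Fin r → Vecℤ N) (c : Fin r → ℤ) j → sumFin r (λ i → c i · g i) j ≡ sumU (fin r) (λ i → c i * g i j)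
sumFin-sumU zero    g c j = refl
sumFin-sumU (suc r) g c j = cong (λ s → c Fin.zero * g Fin.zero j + s) (sumFin-sumU r (g ∘ Fin.suc) (c ∘ Fin.suc) j)

span-intro : ∀ {N} r (g : Fin r → Vecℤ N) (c : Fin r → ℤ) {x : Vecℤ N} → (∀ j → x j ≡ sumU (fin r) (λ i → c i * g i j)) → InSpan r g x
span-intro r g c p = c , λ j → trans (p j) (sym (sumFin-sumU r g c j))

span-elim : ∀ {N} r (g : Fin r → Vecℤ N) {x} → ((c , _) : InSpan r g x) → ∀ j → x j ≡ sumU (fin r) (λ i → c i * g i j)
span-elim r g (c , p) j = trans (p j) (sumFin-sumU r g c j)

spanSubgroup r g = record
  { Mem    = InSpan r g
  ; ext    = λ eq (c , p) → c , λ j → trans (sym (eq j)) (p j)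
  ; zero∈  = span-intro r g (λ _ → + 0) (λ j → sym (sumU-zero (fin r) _ λ i → refl))
  ; add∈   = λ {x} {y} p@(c , _) q@(c′ , _) → span-intro r g (λ i → c i + c′ i) λ j →
      trans (cong₂ _+_ (span-elim r g p j) (span-elim r g q j))
        (trans (sym (sumU-add (fin r) (λ i → c i * g i j) (λ i → c′ i * g i j)))
          (sumU-cong (fin r) (λ i → sym (ℤP.*-distribʳ-+ (g i j) (c i) (c′ i)))))
  ; scale∈ = λ a {x} p@(c , _) → span-intro r g (λ i → a * c i) λ j →
      trans (cong (a *_) (span-elim r g p j)) (trans (sym (sumU-scale (fin r) a (λ i → c i * g i j)))
        (sumU-cong (fin r) (λ i → sym (ℤP.*-assoc a (c i) (g i j)))))
  }

module _ {N} (B : Subgroup (Fin N)) where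
  open Subgroup B

  sumU-mem : ∀ r (g : Fin r → Vecℤ N) (c : Fin r → ℤ) → (∀ i → Mem (g i)) → Mem (λ j → sumU (fin r) (λ i → c i * g i j))
  sumU-mem zero    g c p = zero∈
  sumU-mem (suc r) g c p = add∈ (scale∈ (c Fin.zero) (p Fin.zero)) (sumU-mem r (g ∘ Fin.suc) (c ∘ Fin.suc) (p ∘ Fin.suc))

  span-⊆ : ∀ r (g : Fin r → Vecℤ N) → (∀ i → Mem (g i)) → ∀ {x} → InSpan r g x → Mem x
  span-⊆ r g p {x} q@(c , _) = ext (λ j → sym (span-elim r g q j)) (sumU-mem r g c p)

δ-refl : ∀ {u} (i : ⟦ u ⟧) → δ {u} i i ≡ + 1
δ-refl {u} i with _≟ᵤ_ {u} i i
... | yes _ = refl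
... | no ne = ⊥-elim (ne refl)

δ-≢ : ∀ {u} {i j : ⟦ u ⟧} → j ≢ i → δ {u} i j ≡ + 0
δ-≢ {u} {i} {j} ne with _≟ᵤ_ {u} j i
... | yes eq = ⊥-elim (ne eq)
... | no _ = refl

sumU-only : ∀ u f (j : ⟦ u ⟧) → (∀ i → i ≢ j → f i ≡ + 0) → sumU u f ≡ f j
sumU-only u f j p = ℤP.i-j≡0⇒i≡j (sumU u f) (f j) (0∣⇒≡0 (sumU-single u f j λ i ne → ∣-reflexive (sym (p i ne))))

generator∈span : ∀ {N} r (g : Fin r → Vecℤ N) i → InSpan r g (g i)
generator∈span r g i = span-intro r g (δ {fin r} i) λ j → sym (trans (sumU-only (fin r) (λ k → δ {fin r} i k * g k j) i
    (λ k ne → cong (_* g k j) (δ-≢ {fin r} ne)))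
  (trans (cong (_* g i j) (δ-refl {fin r} i)) (ℤP.*-identityˡ (g i j))))

module Monomials (n : ℕ) .{{n≢0 : ℕ.NonZero n}} where

  private
    indicatorᵇ : ∀ {P : Set} → Dec P → ℤ
    indicatorᵇ p? = if ⌊ p? ⌋ then + 1 else + 0

    indicatorᵇ-indicator : ∀ {P : Set} (p? : Dec P) → indicatorᵇ p? ≡ indicator p?
    indicatorᵇ-indicator (yes _) = refl
    indicatorᵇ-indicator (no _)  = refl

  mono-1 : ∀ a j → + n ∣ a - + toℕ j → mono n a j ≡ + 1
  mono-1 a j p = trans (indicatorᵇ-indicator (n ℕD.∣? ∣ a - + toℕ j ∣)) (indicator-yes (n ℕD.∣? ∣ a - + toℕ j ∣) (∣⇒∣ᵤ p))

  mono-0 : ∀ a j → ¬ + n ∣ a - + toℕ j → mono n a j ≡ + 0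
  mono-0 a j p = trans (indicatorᵇ-indicator (n ℕD.∣? ∣ a - + toℕ j ∣)) (indicator-no (n ℕD.∣? ∣ a - + toℕ j ∣) (p ∘ ∣ᵤ⇒∣))

  mono-cong : ∀ a b → + n ∣ a - b → ∀ j → mono n a j ≡ mono n b j
  mono-cong a b p j = go (+ n ∣? b - + toℕ j)
    where
    go : Dec (+ n ∣ b - + toℕ j) → mono n a j ≡ mono n b j
    go (yes q) = trans (mono-1 a j (∣-chain a b (+ toℕ j) p q)) (sym (mono-1 b j q))
    go (no ¬q) = trans (mono-0 a j (λ q → ¬q (∣-chain b a (+ toℕ j) (∣-flip a b p) q))) (sym (mono-0 b j ¬q))

  mono-index : ∀ (i j : Fin n) → mono n (+ toℕ i) j ≡ δ {fin n} j i
  mono-index i j = go (i Fin.≟ j)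
    where
    go : Dec (i ≡ j) → mono n (+ toℕ i) j ≡ δ {fin n} j i
    go (yes refl) = trans (mono-1 (+ toℕ i) i (∣-resp (sym (ℤP.+-inverseʳ (+ toℕ i))) ∣-zero)) (sym (δ-refl {fin n} i))
    go (no ne) = trans (mono-0 (+ toℕ i) j (λ p → ne (toℕ-injective (residue-unique (toℕ<n i) (toℕ<n j) p)))) (sym (δ-≢ {fin n} ne))

  residue : ℤ → Fin n
  residue a = fromℕ< (n%ℕd<d a n)

  residue-≡ : ∀ a → + n ∣ a - + toℕ (residue a)
  residue-≡ a = subst (λ k → + n ∣ a - + k) (sym (toℕ-fromℕ< (n%ℕd<d a n))) (residue-∣ n a)

  mono-δ : ∀ a j → mono n a j ≡ δ {fin n} (residue a) j
  mono-δ a j = trans (mono-cong a (+ toℕ (residue a)) (residue-≡ a) j) (trans (mono-index (residue a) j) (δ-sym (residue a) j))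
    where
    δ-sym : ∀ i j → δ {fin n} j i ≡ δ {fin n} i j
    δ-sym i j = go (i Fin.≟ j)
      where
      go : Dec (i ≡ j) → δ {fin n} j i ≡ δ {fin n} i j
      go (yes refl) = refl
      go (no ne) = trans (δ-≢ {fin n} ne) (sym (δ-≢ {fin n} (ne ∘ sym)))

  expand : ∀ (x : Vecℤ n) j → sumU (fin n) (λ i → x i * mono n (+ toℕ i) j) ≡ x j
  expand x j = trans (sumU-only (fin n) (λ i → x i * mono n (+ toℕ i) j) j (λ i ne →
      trans (cong (x i *_) (trans (mono-index i j) (δ-≢ {fin n} ne))) (ℤP.*-zeroʳ (x i))))
    (trans (cong (x j *_) (trans (mono-index j j) (δ-refl {fin n} j))) (ℤP.*-identityʳ (x j)))

  aug : Vecℤ n → ℤ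
  aug = sumU (fin n)

  aug-mono : ∀ a → aug (mono n a) ≡ + 1
  aug-mono a = trans (sumU-only (fin n) (mono n a) (residue a) (λ j ne → trans (mono-δ a j) (δ-≢ {fin n} ne)))
    (trans (mono-δ a (residue a)) (δ-refl {fin n} (residue a)))

  augZero : Subgroup (Fin n)
  augZero = record
    { Mem    = λ x → aug x ≡ + 0
    ; ext    = λ eq p → trans (sumU-cong (fin n) (λ j → sym (eq j))) p
    ; zero∈  = sumU-zero (fin n) _ (λ _ → refl)
    ; add∈   = λ {x} {y} p q → trans (sumU-add (fin n) x y) (cong₂ _+_ p q)
    ; scale∈ = λ a {x} p → trans (sumU-scale (fin n) a x) (trans (cong (a *_) p) (ℤP.*-zeroʳ a))
    }

  aug-⊖ : ∀ x y → aug (x ⊖ y) ≡ aug x - aug y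
  aug-⊖ x y = trans (sumU-cong (fin n) (λ j → lem (x j) (y j))) (trans (sumU-add (fin n) x _)
      (trans (cong (λ z → aug x + z) (sumU-scale (fin n) (- + 1) y)) (sym (lem (aug x) (aug y)))))
    where lem : ∀ a b → a - b ≡ a + (- + 1) * b
          lem = solve-∀

  InZ⇒aug : ∀ {x} → InZ n x → aug x ≡ + 0
  InZ⇒aug = span-⊆ augZero (n ℕ.∸ 1) _ λ i → trans (aug-⊖ _ _) (cong₂ _-_ (aug-mono (idx {n} i)) (aug-mono (+ 0)))

-- The coefficients of x, ..., x^(n-1) serve as coordinates; that of 1 is then forced, since the sum
-- of all coefficients is 0.
aug⇒InZ : ∀ n .{{_ : ℕ.NonZero n}} x → Monomials.aug n x ≡ + 0 → InZ n x
aug⇒InZ (suc n) x p = span-intro n (λ i → eV (suc n) (idx {suc n} i)) (x ∘ Fin.suc) λ j →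
    trans (sym (expand x j)) (trans (lem (x Fin.zero) (mono (suc n) (+ 0) j) (S j) s p) (sym (trans (sumU-cong (fin n)
      (λ i → ℤP.*-distribˡ-+ (x (Fin.suc i)) (mono (suc n) (idx {suc n} i) j) (- mono (suc n) (+ 0) j)))
      (trans (sumU-add (fin n) (λ i → x (Fin.suc i) * mono (suc n) (idx {suc n} i) j) _)
        (cong (λ z → S j + z) (trans (sumU-cong (fin n) (λ i → ℤP.*-comm (x (Fin.suc i)) (- mono (suc n) (+ 0) j)))
          (sumU-scale (fin n) (- mono (suc n) (+ 0) j) (x ∘ Fin.suc))))))))
  where
  open Monomials (suc n)
  s = sumU (fin n) (x ∘ Fin.suc)
  S : Fin (suc n) → ℤ
  S j = sumU (fin n) (λ i → x (Fin.suc i) * mono (suc n) (idx {suc n} i) j)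
  lem : ∀ a m S s → a + s ≡ + 0 → a * m + S ≡ S + (- m) * s
  lem a m S s eq = trans (lem₁ a m S s) (trans (cong (λ z → z * m + (S + (- m) * s)) eq) (ℤP.+-identityˡ _))
    where lem₁ : ∀ a m S s → a * m + S ≡ (a + s) * m + (S + (- m) * s)
          lem₁ = solve-∀

module Realization (d : ℤ) where
  open Dune d
  open Bases d
  open Towers d

  -- An isomorphism, on the level of representatives, from a concrete subquotient to the part of
  -- Σ(n,d) where N divides ψ. Together with a basis of that part it yields the cyclic
  -- decomposition.
  record Realizes (G : SubQuot) (n : ℕ) (N : ℤ) : Set where
    open SubQuot G
    field
      τ       : Vecℤ dim → T
      weight  : ∀ x → inA x → N ∣ ψ (τ x)
      sound   : ∀ x y → inA x → inA y → inB (x ⊖ y) → n ⊢ τ x ≈ τ y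
      exact   : ∀ x y → inA x → inA y → n ⊢ τ x ≈ τ y → inB (x ⊖ y)
      additive : ∀ x y → n ⊢ τ (x ⊕ y) ≈ τ x ⊞ τ y
      onto    : ∀ y → N ∣ ψ y → Σ (Vecℤ dim) λ x → inA x × n ⊢ τ x ≈ y

  module _ {G n N u g M} (R : Realizes G n N) (B : Basis n N u g M) where
    open SubQuot G
    open Realizes R
    open Basis B
    open ModuleSolver n

    private
      f : ⟦ u ⟧ → ℕ
      f i = ∣ M i ∣
      open Indexing (indexing u f)

      lin-injective′ : ∀ a b → n ⊢ lin u a g ≈ lin u b g → ∀ i → M i ∣ a i - b i
      lin-injective′ a b p i = ∣-resp (lem (a i) (b i)) (ind _ (≈trans (lin-add u a _ g)
          (≈trans (⊞-cong p (lin-scale u (- + 1) b g))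
            (≈trans (solveT 1 (e 0F ⊟ e 0F) ((+ 0) • e 0F) (lookup (lin u b g ∷ [])) (λ f → lem₀ (f 0F))) (•-zero _)))) i)
        where
        lem : ∀ a b → a + (- + 1) * b ≡ a - b
        lem = solve-∀
        lem₀ : ∀ x → x + (- + 1) * x ≡ + 0 * x
        lem₀ = solve-∀

      lin-≈ : ∀ a b → (∀ i → M i ∣ a i - b i) → n ⊢ lin u a g ≈ lin u b g
      lin-≈ a b p = ≈trans (lin-coeff u g (λ i → lem (a i) (b i))) (≈trans (lin-add u _ b g)
          (≈trans (⊞-cong (lin-zero u _ g (λ i → ∣•-vanish (p i) (ord i))) ≈refl) (⊞-idˡ _)))
        where lem : ∀ a b → a ≡ (a - b) + b
              lem = solve-∀

      coords : ∀ x → inA x → ⟦ u ⟧ → ℤ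
      coords x p = proj₁ (gen (τ x) (weight x p))

      coords-eq : ∀ x p → n ⊢ τ x ≈ lin u (coords x p) g
      coords-eq x p = proj₂ (gen (τ x) (weight x p))

      at-pos : ∀ (z : ⟦ u ⟧ → ℤ) → (∀ i → M i ∣ z i) → ∀ k → List.lookup (flat u f) k ℕD.∣ ∣ z (pos k) ∣
      at-pos z h k = subst (ℕD._∣ ∣ z (pos k) ∣) (sym (lookup-pos k)) (∣⇒∣ᵤ (h (pos k)))

      from-pos : ∀ (z : ⟦ u ⟧ → ℤ) → (∀ k → List.lookup (flat u f) k ℕD.∣ ∣ z (pos k) ∣) → ∀ i → M i ∣ z i
      from-pos z h i = subst (λ j → M j ∣ z j) (pos-ix i) (∣ᵤ⇒∣ (subst (ℕD._∣ ∣ z (pos (ix i)) ∣) (lookup-pos (ix i)) (h (ix i))))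

    basis⇒≅ : G ≅ CyclicSum (flat u f)
    basis⇒≅ = record
      { φ    = λ x p k → coords x p (pos k)
      ; into = λ _ _ → tt
      ; wd   = λ x y p q b → at-pos (λ i → coords x p i - coords y q i) (lin-injective′ _ _
          (≈trans (≈sym (coords-eq x p)) (≈trans (sound x y p q b) (coords-eq y q))))
      ; hom  = λ x y p q r → at-pos (λ i → coords (x ⊕ y) r i - (coords x p i + coords y q i)) (lin-injective′ _ _
          (≈trans (≈sym (coords-eq (x ⊕ y) r)) (≈trans (additive x y)
            (≈trans (⊞-cong (coords-eq x p) (coords-eq y q)) (≈sym (lin-add u _ _ g))))))
      ; inj  = λ x y p q h → exact x y p q (≈trans (coords-eq x p)
          (≈trans (lin-≈ _ _ (from-pos (λ i → coords x p i - coords y q i) h)) (≈sym (coords-eq y q))))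
      ; surj = λ y _ → let (x , p , eq) = onto (lin u (y ∘ ix) g) (ψ-lin-∣ u (y ∘ ix) g mem) in
          x , p , surjective y x p eq
      }
      where
      surjective : ∀ (y : Fin (length (flat u f)) → ℤ) x p → n ⊢ τ x ≈ lin u (y ∘ ix) g →
                   ∀ k → List.lookup (flat u f) k ℕD.∣ ∣ coords x p (pos k) - y k ∣
      surjective y x p eq k = subst (λ l → List.lookup (flat u f) k ℕD.∣ ∣ coords x p (pos k) - y l ∣) (ix-pos k)
        (at-pos (λ i → coords x p i - y (ix i)) (lin-injective′ _ _ (≈trans (≈sym (coords-eq x p)) eq)) k)

  private
    -1-scale : ∀ a b → a - b ≡ a + (- + 1) * b
    -1-scale = solve-∀

  module SandDuneRealization (n : ℕ) .{{n≢0 : ℕ.NonZero n}} where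
    open Monomials n
    open ModuleSolver n

    position : Fin n → T
    position j = e (+ toℕ j)

    -- Sending x^v to `e v` amounts to sending x^v - 1 there, because the symbol of 0 vanishes.
    ⟨_⟩ : Vecℤ n → T
    ⟨ x ⟩ = lin (fin n) x position

    ⟨⟩-mono : ∀ a → n ⊢ ⟨ mono n a ⟩ ≈ e a
    ⟨⟩-mono a = ≈trans (lin-coeff (fin n) position (mono-δ a)) (≈trans (lin-δ (fin n) (residue a) position)
      (≈sym (periodic a (+ toℕ (residue a)) (residue-≡ a))))

    lin-⊖ : ∀ x y (g : Fin n → T) → n ⊢ lin (fin n) (x ⊖ y) g ≈ lin (fin n) x g ⊟ lin (fin n) y g
    lin-⊖ x y g = ≈trans (lin-coeff (fin n) g (λ j → -1-scale (x j) (y j)))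
      (≈trans (lin-add (fin n) x _ g) (⊞-cong ≈refl (lin-scale (fin n) (- + 1) y g)))

    ⟨⟩-eV : ∀ a → n ⊢ ⟨ eV n a ⟩ ≈ e a
    ⟨⟩-eV a = ≈trans (lin-⊖ (mono n a) (mono n (+ 0)) position)
      (≈trans (⊞-cong (⟨⟩-mono a) (•-cong (- + 1) (≈trans (⟨⟩-mono (+ 0)) e-zero))) (≈trans (⊞-cong ≈refl (•-𝟘 _)) (⊞-idʳ _)))

    vanishing : (g : Fin n → T) → Subgroup (Fin n)
    vanishing g = record
      { Mem    = λ x → n ⊢ lin (fin n) x g ≈ 𝟘
      ; ext    = λ eq p → ≈trans (lin-coeff (fin n) g (λ j → sym (eq j))) p
      ; zero∈  = lin-zero (fin n) _ g λ _ → •-zero _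
      ; add∈   = λ {x} {y} p q → ≈trans (lin-add (fin n) x y g) (≈trans (⊞-cong p q) (⊞-idˡ 𝟘))
      ; scale∈ = λ a {x} p → ≈trans (lin-scale (fin n) a x g) (≈trans (•-cong a p) (•-𝟘 a))
      }

    ⊟-≈ : ∀ {x y} → n ⊢ x ⊟ y ≈ 𝟘 → n ⊢ x ≈ y
    ⊟-≈ {x} {y} p = ≈trans (solveT 2 (e 0F) ((e 0F ⊟ e 1F) ⊞ e 1F) (lookup (x ∷ y ∷ [])) (λ f → lem (f 0F) (f 1F)))
        (≈trans (⊞-cong p ≈refl) (⊞-idˡ y))
      where lem : ∀ a b → a ≡ (a + (- + 1) * b) + b
            lem = solve-∀

    ≈-⊟ : ∀ {x y} → n ⊢ x ≈ y → n ⊢ x ⊟ y ≈ 𝟘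
    ≈-⊟ {x} {y} p = ≈trans (⊞-cong p ≈refl) (≈trans (solveT 1 (e 0F ⊟ e 0F) ((+ 0) • e 0F) (lookup (y ∷ [])) (λ f → lem (f 0F))) (•-zero y))
      where lem : ∀ a → a + (- + 1) * a ≡ + 0 * a
            lem = solve-∀

    from-index : ∀ {Q : ℤ → Set} → Q (+ 0) → (∀ (i : Fin (n ℕ.∸ 1)) → Q (idx {n} i)) → ∀ k → k < n → Q (+ k)
    from-index q₀ q zero    lt = q₀
    from-index {Q} q₀ q (suc k) lt = subst (λ k → Q (+ suc k)) (toℕ-fromℕ< lt′) (q (fromℕ< lt′))
      where lt′ : k < n ℕ.∸ 1
            lt′ = ℕP.∸-monoˡ-≤ 1 lt

    private
      E : Subgroup (Fin n)
      E = spanSubgroup (n ℕ.∸ 1) (λ i → εV n d (idx {n} i))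
      open Subgroup E

      ε-vanishes : ∀ v → n ⊢ ⟨ εV n d v ⟩ ≈ 𝟘
      ε-vanishes v = ≈trans (lin-⊖ (d · eV n v) (eV n (d * v)) position)
        (≈-⊟ (≈trans (lin-scale (fin n) d (eV n v) position) (≈trans (•-cong d (⟨⟩-eV v)) (≈trans (e-scale v) (≈sym (⟨⟩-eV (d * v)))))))

      eV-cong : ∀ a b → + n ∣ a - b → ∀ j → eV n a j ≡ eV n b j
      eV-cong a b p j = cong (_- mono n (+ 0) j) (mono-cong a b p j)

      εV-cong : ∀ a b → + n ∣ a - b → ∀ j → εV n d a j ≡ εV n d b j
      εV-cong a b p j = cong₂ (λ y z → d * y - z) (eV-cong a b p j) (eV-cong (d * a) (d * b) (∣-product d p) j)

      εV-zero : ∀ j → εV n d (+ 0) j ≡ + 0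
      εV-zero j = trans (cong (λ v → d * eV n (+ 0) j - eV n v j) (ℤP.*-zeroʳ d))
          (trans (cong (λ z → d * z - z) (ℤP.+-inverseʳ (mono n (+ 0) j))) (lem d))
        where lem : ∀ d → d * + 0 - + 0 ≡ + 0
              lem = solve-∀

      ε∈ : ∀ v → Mem (εV n d v)
      ε∈ v = ext (λ j → sym (εV-cong v (+ (v %ℕ n)) (residue-∣ n v) j))
        (from-index {λ w → Mem (εV n d w)} (ext (λ j → sym (εV-zero j)) zero∈) (generator∈span (n ℕ.∸ 1) _) (v %ℕ n) (n%ℕd<d v n))

      back : T → Vecℤ n
      back y j = ev (λ v → eV n v j) y

      back-⟨⟩ : ∀ x → aug x ≡ + 0 → ∀ j → back ⟨ x ⟩ j ≡ x j
      back-⟨⟩ x p j = trans (ev-lin (λ v → eV n v j) (fin n) x position)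
          (trans (sumU-cong (fin n) (λ i → lem (x i) (mono n (+ toℕ i) j) (mono n (+ 0) j)))
          (trans (sumU-add (fin n) (λ i → x i * mono n (+ toℕ i) j) _)
          (trans (cong₂ _+_ (expand x j) (trans (sumU-scale (fin n) (- mono n (+ 0) j) x) (trans (cong (- mono n (+ 0) j *_) p) (ℤP.*-zeroʳ (- mono n (+ 0) j)))))
          (ℤP.+-identityʳ (x j)))))
        where lem : ∀ x a b → x * (a - b) ≡ x * a + (- b) * x
              lem = solve-∀

      back-cong : ∀ {x y} → n ⊢ x ≈ y → Mem (back x ⊖ back y)
      back-cong = Evaluate.ev-cong E n (λ v → eV n v)
        (λ v w p → ext (λ j → sym (ℤP.i≡j⇒i-j≡0 (eV-cong v w p j))) zero∈)
        (ext (λ j → sym (ℤP.+-inverseʳ (mono n (+ 0) j))) zero∈) ε∈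

      back-aug : ∀ y → aug (back y) ≡ + 0
      back-aug = Tm-ind (λ y → aug (back y) ≡ + 0)
        (λ v → trans (aug-⊖ (mono n v) (mono n (+ 0))) (cong₂ _-_ (aug-mono v) (aug-mono (+ 0))))
        (Subgroup.zero∈ augZero) (λ x y → Subgroup.add∈ augZero {back x} {back y}) (λ a x → Subgroup.scale∈ augZero a {back x})

      ⟨⟩-back : ∀ y → n ⊢ ⟨ back y ⟩ ≈ y
      ⟨⟩-back = Tm-ind (λ y → n ⊢ ⟨ back y ⟩ ≈ y) ⟨⟩-eV (lin-zero (fin n) _ position λ _ → •-zero _)
        (λ x y p q → ≈trans (lin-add (fin n) (back x) (back y) position) (⊞-cong p q))
        (λ a x p → ≈trans (lin-scale (fin n) a (back x) position) (•-cong a p))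

    sandDune : Realizes (SandDune n d) n (+ 1)
    sandDune = record
      { τ = ⟨_⟩
      ; weight = λ _ _ → 1∣ _
      ; sound = λ x y _ _ b → ⊟-≈ (≈trans (≈sym (lin-⊖ x y position)) (span-⊆ (vanishing position) (n ℕ.∸ 1) _ (λ i → ε-vanishes (idx {n} i)) b))
      ; exact = λ x y p q h → ext (λ j → cong₂ _-_ (back-⟨⟩ x (InZ⇒aug p) j) (back-⟨⟩ y (InZ⇒aug q) j)) (back-cong h)
      ; additive = λ x y → lin-add (fin n) x y position
      ; onto = λ y _ → back y , aug⇒InZ n (back y) (back-aug y) , ⟨⟩-back y
      }

-- Division by x - 1 and the group S(n,d)

ℤ-ind : ∀ (Q : ℤ → Set) → Q (+ 0) → (∀ v → Q v → Q (ℤ.suc v)) → (∀ v → Q (ℤ.suc v) → Q v) → ∀ v → Q v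
ℤ-ind Q q₀ up down (+ zero)      = q₀
ℤ-ind Q q₀ up down (+ suc k)     = up (+ k) (ℤ-ind Q q₀ up down (+ k))
ℤ-ind Q q₀ up down -[1+ zero ]   = down -[1+ 0 ] q₀
ℤ-ind Q q₀ up down -[1+ suc k ]  = down -[1+ suc k ] (ℤ-ind Q q₀ up down -[1+ k ])

private
  chain-difference : ∀ a b c → (b - a) + (c - b) ≡ c - a
  chain-difference = solve-∀

telescope : ∀ n (q : ℕ → ℤ) → sumU (fin n) (λ i → q (suc (toℕ i)) - q (toℕ i)) ≡ q n - q 0
telescope zero    q = sym (ℤP.+-inverseʳ (q 0))
telescope (suc n) q = trans (cong (λ z → (q 1 - q 0) + z) (telescope n (q ∘ suc))) (chain-difference (q 0) (q 1) (q (suc n)))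

telescopeList : ∀ {N} k (h : ℕ → Vecℤ N) (q : ℕ → ℤ) j → (∀ i → h i j ≡ q (suc i) - q i) → sumList (applyUpTo h k) j ≡ q k - q 0
telescopeList zero    h q j p = sym (ℤP.+-inverseʳ (q 0))
telescopeList (suc k) h q j p = trans (cong₂ _+_ (p 0) (telescopeList k (h ∘ suc) (q ∘ suc) j (p ∘ suc)))
  (chain-difference (q 0) (q 1) (q (suc k)))

sumU-punchIn : ∀ n (h : Fin (suc n) → ℤ) v → sumU (fin (suc n)) h ≡ h v + sumU (fin n) (h ∘ Fin.punchIn v)
sumU-punchIn n       h Fin.zero    = refl
sumU-punchIn (suc n) h (Fin.suc v) = trans (cong (λ z → h Fin.zero + z) (sumU-punchIn n (h ∘ Fin.suc) v))
    (lem (h Fin.zero) (h (Fin.suc v)) (sumU (fin n) (h ∘ Fin.suc ∘ Fin.punchIn v)))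
  where lem : ∀ a b c → a + (b + c) ≡ b + (a + c)
        lem = solve-∀

missing∈span : ∀ {n N} (F : Fin (suc n) → Vecℤ N) v → (∀ j → sumU (fin (suc n)) (λ u → F u j) ≡ + 0) →
               InSpan n (F ∘ Fin.punchIn v) (F v)
missing∈span {n} F v p = span-intro n (F ∘ Fin.punchIn v) (λ _ → - + 1) λ j →
    trans (lem (F v j) (S j) (trans (sym (sumU-punchIn n (λ u → F u j) v)) (p j))) (sym (sumU-scale (fin n) (- + 1) _))
  where
  S : Fin _ → ℤ
  S j = sumU (fin n) (λ i → F (Fin.punchIn v i) j)
  lem : ∀ a s → a + s ≡ + 0 → a ≡ (- + 1) * s
  lem a s eq = trans (lem₁ a s) (trans (cong (λ z → z + (- + 1) * s) eq) (ℤP.+-identityˡ _))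
    where lem₁ : ∀ a s → a ≡ (a + s) + (- + 1) * s
          lem₁ = solve-∀

first∈span : ∀ n .{{_ : ℕ.NonZero n}} (F : ℤ → Vecℤ n) → (∀ j → sumU (fin n) (λ i → F (+ toℕ i) j) ≡ + 0) →
             InSpan (n ℕ.∸ 1) (λ i → F (idx {n} i)) (F (+ 0))
first∈span (suc n) F p = missing∈span (λ u → F (+ toℕ u)) Fin.zero p

-- Here geo v = 1 + x + ... + x^(v-1), extended to negative v, is (x^v - 1) / (x - 1) up to multiples of the norm.
module Geometric (n : ℕ) .{{n≢0 : ℕ.NonZero n}} where
  open Monomials n

  geo : ℤ → Vecℤ n
  geo (+ zero)      j = + 0
  geo (+ suc k)     j = geo (+ k) j + mono n (+ k) j
  geo -[1+ zero ]   j = - mono n -[1+ 0 ] j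
  geo -[1+ suc k ]  j = geo -[1+ k ] j - mono n -[1+ suc k ] j

  geo-suc : ∀ v j → geo (ℤ.suc v) j ≡ geo v j + mono n v j
  geo-suc (+ k)         j = refl
  geo-suc -[1+ zero ]   j = sym (ℤP.+-inverseˡ (mono n -[1+ 0 ] j))
  geo-suc -[1+ suc k ]  j = lem (geo -[1+ k ] j) (mono n -[1+ suc k ] j)
    where lem : ∀ a b → a ≡ (a - b) + b
          lem = solve-∀

  private
    cancelʳ : ∀ {a b c} → a + c ≡ b + c → a ≡ b
    cancelʳ {a} {b} {c} eq = trans (lem a c) (trans (cong (_- c) eq) (sym (lem b c)))
      where lem : ∀ a c → a ≡ (a + c) - c
            lem = solve-∀

  aug-geo : ∀ v → aug (geo v) ≡ v
  aug-geo = ℤ-ind (λ v → aug (geo v) ≡ v) (Subgroup.zero∈ augZero)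
      (λ v p → trans (step v) (trans (cong (_+ + 1) p) (ℤP.+-comm v (+ 1))))
      (λ v p → cancelʳ {aug (geo v)} {v} {+ 1} (trans (sym (step v)) (trans p (ℤP.+-comm (+ 1) v))))
    where
    step : ∀ v → aug (geo (ℤ.suc v)) ≡ aug (geo v) + + 1
    step v = trans (sumU-cong (fin n) (geo-suc v)) (trans (sumU-add (fin n) (geo v) (mono n v)) (cong (λ z → aug (geo v) + z) (aug-mono v)))

  geo-n : ∀ j → geo (+ n) j ≡ + 1
  geo-n j = trans (sym (ℤP.+-identityʳ (geo (+ n) j))) (trans (sym (telescope n (λ k → geo (+ k) j)))
      (trans (sumU-cong (fin n) (λ i → lem (geo (+ toℕ i) j) (mono n (+ toℕ i) j))) (expand (λ _ → + 1) j)))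
    where lem : ∀ a b → (a + b) - a ≡ + 1 * b
          lem = solve-∀

  geo-shift : ∀ v j → geo (v + + n) j ≡ geo v j + + 1
  geo-shift v j = ℤ-ind (λ v → geo (v + + n) j ≡ geo v j + + 1) (trans (geo-n j) refl)
      (λ v p → trans (step v) (trans (cong (_+ mono n v j) p) (trans (swap (geo v j) (mono n v j)) (cong (_+ + 1) (sym (geo-suc v j))))))
      (λ v p → cancelʳ {geo (v + + n) j} {geo v j + + 1} {mono n v j}
        (trans (sym (step v)) (trans p (trans (cong (_+ + 1) (geo-suc v j)) (sym (swap (geo v j) (mono n v j))))))) v
    where
    swap : ∀ a b → (a + + 1) + b ≡ (a + b) + + 1
    swap = solve-∀
    cancel-v : ∀ v n → (v + n) - v ≡ + 1 * n
    cancel-v = solve-∀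
    step : ∀ v → geo (ℤ.suc v + + n) j ≡ geo (v + + n) j + mono n v j
    step v = trans (cong (λ w → geo w j) (ℤP.+-assoc (+ 1) v (+ n))) (trans (geo-suc (v + + n) j)
      (cong (λ z → geo (v + + n) j + z) (mono-cong (v + + n) v (∣-by (+ 1) (cancel-v v (+ n))) j)))

  geo-shifts : ∀ q v j → geo (v + q * + n) j ≡ geo v j + q
  geo-shifts q v j = ℤ-ind (λ q → geo (v + q * + n) j ≡ geo v j + q)
      (trans (cong (λ w → geo w j) (ℤP.+-identityʳ v)) (sym (ℤP.+-identityʳ (geo v j))))
      (λ q p → trans (step q) (trans (cong (_+ + 1) p) (assoc (geo v j) q)))
      (λ q p → cancelʳ {geo (v + q * + n) j} {geo v j + q} {+ 1} (trans (sym (step q)) (trans p (sym (assoc (geo v j) q))))) q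
    where
    assoc : ∀ a q → (a + q) + + 1 ≡ a + (+ 1 + q)
    assoc = solve-∀
    next : ∀ v q n → v + (+ 1 + q) * n ≡ (v + q * n) + n
    next = solve-∀
    step : ∀ q → geo (v + ℤ.suc q * + n) j ≡ geo (v + q * + n) j + + 1
    step q = trans (cong (λ w → geo w j) (next v q (+ n))) (geo-shift (v + q * + n) j)

  geo-sum : ∀ a k j → sumList (applyUpTo (λ i → mono n (a + + i)) k) j ≡ geo (a + + k) j - geo a j
  geo-sum a k j = trans (telescopeList k (λ i → mono n (a + + i)) (λ i → geo (a + + i) j) j
        (λ i → trans (lem (geo (a + + i) j) (mono n (a + + i) j)) (cong (_- geo (a + + i) j) (trans (sym (geo-suc (a + + i) j)) (cong (λ w → geo w j) (swap a (+ i)))))))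
      (cong (λ w → geo (a + + k) j - geo w j) (ℤP.+-identityʳ a))
    where lem : ∀ a b → b ≡ (a + b) - a
          lem = solve-∀
          swap : ∀ a i → + 1 + (a + i) ≡ a + (+ 1 + i)
          swap = solve-∀

  -- A sum of monomials over an interval of exponents is a difference of values of `geo`, so the two
  -- sign cases of f_v become one formula.
  fV-geo : ∀ d v j → fV n d v j ≡ d * mono n v j - (geo (d * v + d) j - geo (d * v) j)
  fV-geo (+ D) v j = cong (λ z → + D * mono n v j - z) (geo-sum (+ D * v) D j)
  fV-geo d@(-[1+ D ]) v j = trans (cong (λ z → d * mono n v j + z) (trans (geo-sum (d * (v + + 1)) (suc D) j)
        (cong₂ (λ a b → geo a j - geo b j) (top (+ suc D) v) (bottom d v))))
      (lem (d * mono n v j) (geo (d * v) j) (geo (d * v + d) j))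
    where lem : ∀ m a b → m + (a - b) ≡ m - (b - a)
          lem = solve-∀
          top : ∀ D v → (- D) * (v + + 1) + D ≡ (- D) * v
          top = solve-∀
          bottom : ∀ d v → d * (v + + 1) ≡ d * v + d
          bottom = solve-∀

  module _ (d : ℤ) where
    private
      unwrap : ∀ {a b q} → a - b ≡ q * + n → a ≡ b + q * + n
      unwrap {a} {b} eq = trans (lem a b) (cong (λ z → b + z) eq)
        where lem : ∀ a b → a ≡ b + (a - b)
              lem = solve-∀

      geo-d-shift : ∀ {v w q} c → v - w ≡ q * + n → ∀ j → geo (d * v + c) j ≡ geo (d * w + c) j + d * q
      geo-d-shift {v} {w} {q} c eq j = trans (cong (λ u → geo u j) (trans (cong (λ u → d * u + c) (unwrap {v} {w} {q} eq)) (lem d w q c (+ n)))) (geo-shifts (d * q) (d * w + c) j)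
        where lem : ∀ d w q c n → d * (w + q * n) + c ≡ (d * w + c) + (d * q) * n
              lem = solve-∀

    fV-cong : ∀ v w → + n ∣ v - w → ∀ j → fV n d v j ≡ fV n d w j
    fV-cong v w p@(divides q eq) j = trans (fV-geo d v j) (trans (cong₂ (λ m z → d * m - z) (mono-cong v w p j)
        (trans (cong₂ _-_ (geo-d-shift {v} {w} {q} d eq j) (trans (cong (λ u → geo u j) (sym (ℤP.+-identityʳ (d * v))))
          (trans (geo-d-shift {v} {w} {q} (+ 0) eq j) (cong (λ u → geo u j + d * q) (ℤP.+-identityʳ (d * w))))))
          (lem (geo (d * w + d) j) (geo (d * w) j) (d * q)))) (sym (fV-geo d w j)))
      where lem : ∀ a b q → (a + q) - (b + q) ≡ a - b
            lem = solve-∀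

    -- A preimage of ε_v under multiplication by x - 1; consecutive ones differ by f_v.
    defect : ℤ → Vecℤ n
    defect v j = d * geo v j - geo (d * v) j

    defect-suc : ∀ v j → defect (ℤ.suc v) j ≡ defect v j + fV n d v j
    defect-suc v j = trans (cong₂ (λ a b → d * a - geo b j) (geo-suc v j) (lem₁ d v))
        (trans (lem₂ d (geo v j) (mono n v j) (geo (d * v + d) j) (geo (d * v) j)) (cong (λ z → defect v j + z) (sym (fV-geo d v j))))
      where lem₁ : ∀ d v → d * (+ 1 + v) ≡ d * v + d
            lem₁ = solve-∀
            lem₂ : ∀ d g m a b → d * (g + m) - a ≡ (d * g - b) + (d * m - (a - b))
            lem₂ = solve-∀

    -- The sum telescopes to the defect at n, which is d - d = 0 because a shift by n adds the norm
    -- 1 + x + ... + x^(n-1). Hence any single f_v may be dropped from a full set of generators: f_0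
    -- in the definition of S(n,d), and the row of the deleted vertex in the Laplacian.
    fV-sum : ∀ j → sumU (fin n) (λ i → fV n d (+ toℕ i) j) ≡ + 0
    fV-sum j = trans (sumU-cong (fin n) (λ i → trans (lem (defect (+ toℕ i) j) (fV n d (+ toℕ i) j)) (cong (_- defect (+ toℕ i) j) (sym (defect-suc (+ toℕ i) j)))))
        (trans (telescope n (λ k → defect (+ k) j)) (trans (cong₂ _-_ at-n at-0) refl))
      where
      lem : ∀ a b → b ≡ (a + b) - a
      lem = solve-∀
      at-0 : defect (+ 0) j ≡ + 0
      at-0 = trans (cong (λ w → d * + 0 - geo w j) (ℤP.*-zeroʳ d)) (trans (ℤP.+-identityʳ (d * + 0)) (ℤP.*-zeroʳ d))
      at-n : defect (+ n) j ≡ + 0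
      at-n = trans (cong₂ (λ a b → d * a - b) (geo-n j) (trans (cong (λ w → geo w j) (sym (ℤP.+-identityˡ (d * + n)))) (geo-shifts d (+ 0) j)))
          (lem₂ d)
        where lem₂ : ∀ d → d * + 1 - (+ 0 + d) ≡ + 0
              lem₂ = solve-∀

    fV-aug : ∀ v → aug (fV n d v) ≡ + 0
    fV-aug v = trans (sumU-cong (fin n) (fV-geo d v)) (trans (aug-⊖ (d · mono n v) (geo (d * v + d) ⊖ geo (d * v)))
        (trans (cong₂ _-_ (trans (sumU-scale (fin n) d (mono n v)) (cong (d *_) (aug-mono v)))
          (trans (aug-⊖ (geo (d * v + d)) (geo (d * v))) (cong₂ _-_ (aug-geo (d * v + d)) (aug-geo (d * v))))) (lem d (d * v))))
      where lem : ∀ d a → d * + 1 - ((a + d) - a) ≡ + 0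
            lem = solve-∀

module SandpileRealization (d : ℤ) (n : ℕ) .{{n≢0 : ℕ.NonZero n}} where
  open Dune d
  open Bases d
  open Realization d
  open SandDuneRealization n using (vanishing; lin-⊖; ⊟-≈; ≈-⊟; from-index)
  open Monomials n
  open Geometric n
  open ModuleSolver n

  edge : Fin n → T
  edge j = e (+ toℕ j + + 1) ⊟ e (+ toℕ j)

  -- multiplication by x - 1, which carries f_v to ε_(v+1) - ε_v
  ∇ : Vecℤ n → T
  ∇ x = lin (fin n) x edge

  F : Subgroup (Fin n)
  F = spanSubgroup (n ℕ.∸ 1) (λ i → fV n d (idx {n} i))
  open Subgroup F

  fV∈ : ∀ v → Mem (fV n d v)
  fV∈ v = ext (λ j → sym (fV-cong d v (+ (v %ℕ n)) (residue-∣ n v) j))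
    (from-index {λ w → Mem (fV n d w)} (first∈span n (fV n d) (fV-sum d)) (generator∈span (n ℕ.∸ 1) _) (v %ℕ n) (n%ℕd<d v n))

  span⇒aug : ∀ {x} → Mem x → aug x ≡ + 0
  span⇒aug = span-⊆ augZero (n ℕ.∸ 1) _ (λ i → fV-aug d (idx {n} i))

  private
    ∇-mono : ∀ a → n ⊢ ∇ (mono n a) ≈ e (a + + 1) ⊟ e a
    ∇-mono a = ≈trans (lin-coeff (fin n) edge (mono-δ a)) (≈trans (lin-δ (fin n) (residue a) edge)
        (⊞-cong (periodic (r + + 1) (a + + 1) (∣-resp (lem r a) r≡a)) (•-cong _ (periodic r a r≡a))))
      where
      r = + toℕ (residue a)
      r≡a = ∣-flip a r (residue-≡ a)
      lem : ∀ r a → r - a ≡ (r + + 1) - (a + + 1)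
      lem = solve-∀

    ∇-geo : ∀ v → n ⊢ ∇ (geo v) ≈ e v
    ∇-geo = ℤ-ind (λ v → n ⊢ ∇ (geo v) ≈ e v)
        (≈trans (lin-zero (fin n) _ edge λ _ → •-zero _) (≈sym e-zero))
        (λ v p → ≈trans (step v) (≈trans (⊞-cong p ≈refl)
          (solveT 2 (e 0F ⊞ (e 1F ⊟ e 0F)) (e 1F) (lookup (e v ∷ e (ℤ.suc v) ∷ [])) (λ f → lem (f 0F) (f 1F)))))
        (λ v p → ≈trans (solveT 3 (e 0F) ((e 0F ⊞ (e 1F ⊟ e 2F)) ⊞ (e 2F ⊟ e 1F)) (lookup (∇ (geo v) ∷ e (ℤ.suc v) ∷ e v ∷ []))
            (λ f → lem₂ (f 0F) (f 1F) (f 2F)))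
          (≈trans (⊞-cong (≈trans (≈sym (step v)) p) ≈refl)
            (solveT 2 (e 1F ⊞ (e 0F ⊟ e 1F)) (e 0F) (lookup (e v ∷ e (ℤ.suc v) ∷ [])) (λ f → lem (f 1F) (f 0F)))))
      where
      lem : ∀ a b → a + (b + (- + 1) * a) ≡ b
      lem = solve-∀
      lem₂ : ∀ x a b → x ≡ (x + (a + (- + 1) * b)) + (b + (- + 1) * a)
      lem₂ = solve-∀
      step : ∀ v → n ⊢ ∇ (geo (ℤ.suc v)) ≈ ∇ (geo v) ⊞ (e (ℤ.suc v) ⊟ e v)
      step v = ≈trans (lin-coeff (fin n) edge (geo-suc v)) (≈trans (lin-add (fin n) (geo v) (mono n v) edge)
        (⊞-cong ≈refl (≈trans (∇-mono v) (⊞-cong (≡⇒≈ (cong e (ℤP.+-comm v (+ 1)))) ≈refl))))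

    ∇-fV : ∀ v → n ⊢ ∇ (fV n d v) ≈ 𝟘
    ∇-fV v = ≈trans (lin-coeff (fin n) edge (fV-geo d v))
        (≈trans (lin-⊖ (d · mono n v) (geo (d * v + d) ⊖ geo (d * v)) edge)
        (≈trans (⊞-cong (≈trans (lin-scale (fin n) d (mono n v) edge) (•-cong d (∇-mono v)))
                        (•-cong (- + 1) (≈trans (lin-⊖ (geo (d * v + d)) (geo (d * v)) edge) (⊞-cong (∇-geo (d * v + d)) (•-cong (- + 1) (∇-geo (d * v)))))))
        (≈trans (⊞-cong (≈trans (solveT 2 (d • (e 0F ⊟ e 1F)) (d • e 0F ⊟ d • e 1F) (lookup (e (v + + 1) ∷ e v ∷ [])) (λ f → lem d (f 0F) (f 1F)))
                          (⊞-cong (≈trans (e-scale (v + + 1)) (≡⇒≈ (cong e (lem₂ d v)))) (•-cong (- + 1) (e-scale v)))) ≈refl)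
        (≈-⊟ ≈refl))))
      where
      lem : ∀ d a b → d * (a + (- + 1) * b) ≡ d * a + (- + 1) * (d * b)
      lem = solve-∀
      lem₂ : ∀ d v → d * (v + + 1) ≡ d * v + d
      lem₂ = solve-∀

    -- `geo` has period n only up to multiples of the norm, so the inverse `back` of `∇` respects
    -- the relations only modulo the norm as well.
    modNorm : Subgroup (Fin n)
    modNorm = record
      { Mem    = λ x → Σ ℤ λ c → Mem (λ j → x j - c)
      ; ext    = λ eq (c , p) → c , ext (λ j → cong (_- c) (eq j)) p
      ; zero∈  = + 0 , zero∈
      ; add∈   = λ {x} {y} (c , p) (c′ , q) → c + c′ , ext (λ j → lem (x j) c (y j) c′) (add∈ p q)
      ; scale∈ = λ a {x} (c , p) → a * c , ext (λ j → lem₂ a (x j) c) (scale∈ a p)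
      }
      where
      lem : ∀ x c y c′ → (x - c) + (y - c′) ≡ (x + y) - (c + c′)
      lem = solve-∀
      lem₂ : ∀ a x c → a * (x - c) ≡ a * x - a * c
      lem₂ = solve-∀

    back : T → Vecℤ n
    back y j = ev (λ v → geo v j) y

    constant : ∀ {x} q → (∀ j → x j ≡ q) → Subgroup.Mem modNorm x
    constant q p = q , ext (λ j → sym (ℤP.i≡j⇒i-j≡0 (p j))) zero∈

    defect∈ : ∀ v → Mem (defect d v)
    defect∈ = ℤ-ind (λ v → Mem (defect d v))
      (ext (λ j → sym (trans (cong (λ w → d * + 0 - geo w j) (ℤP.*-zeroʳ d)) (trans (ℤP.+-identityʳ (d * + 0)) (ℤP.*-zeroʳ d)))) zero∈)
      (λ v p → ext (λ j → sym (defect-suc d v j)) (add∈ p (fV∈ v)))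
      (λ v p → ext (λ j → trans (cong (_+ (- + 1) * fV n d v j) (defect-suc d v j)) (lem (defect d v j) (fV n d v j))) (add∈ p (scale∈ (- + 1) (fV∈ v))))
      where lem : ∀ a b → (a + b) + (- + 1) * b ≡ a
            lem = solve-∀

    back-cong : ∀ {x y} → n ⊢ x ≈ y → Subgroup.Mem modNorm (back x ⊖ back y)
    back-cong = Evaluate.ev-cong modNorm n geo
      (λ v w (divides q eq) → constant q λ j → trans (cong (λ u → geo u j - geo w j) (unwrap v w q eq)) (trans (cong (_- geo w j) (geo-shifts q w j)) (lem (geo w j) q)))
      (constant (+ 0) λ _ → refl)
      (λ v → + 0 , ext (λ j → sym (ℤP.+-identityʳ (defect d v j))) (defect∈ v))
      where
      lem : ∀ a q → (a + q) - a ≡ q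
      lem = solve-∀
      lem₂ : ∀ a b → a ≡ b + (a - b)
      lem₂ = solve-∀
      unwrap : ∀ v w q → v - w ≡ q * + n → v ≡ w + q * + n
      unwrap v w q eq = trans (lem₂ v w) (cong (λ z → w + z) eq)

    back-∇ : ∀ x j → back (∇ x) j ≡ x j
    back-∇ x j = trans (ev-lin (λ v → geo v j) (fin n) x edge) (trans (sumU-cong (fin n) (λ i → cong (x i *_) (increment i))) (expand x j))
      where
      lem : ∀ a b → (a + b) + (- + 1) * a ≡ b
      lem = solve-∀
      increment : ∀ i → geo (+ toℕ i + + 1) j + (- + 1) * geo (+ toℕ i) j ≡ mono n (+ toℕ i) j
      increment i = trans (cong (λ w → geo w j + (- + 1) * geo (+ toℕ i) j) (ℤP.+-comm (+ toℕ i) (+ 1)))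
        (lem (geo (+ toℕ i) j) (mono n (+ toℕ i) j))

    aug-const : ∀ c → aug (λ _ → c) ≡ c * + n
    aug-const c = trans (sumU-cong (fin n) (λ j → trans (sym (ℤP.*-identityʳ c)) (cong (c *_) (sym (geo-n j)))))
      (trans (sumU-scale (fin n) c (geo (+ n))) (cong (c *_) (aug-geo (+ n))))

    -- The argument through `back` leaves a multiple c of the norm undetermined. Comparing
    -- coefficient sums, which are 0 on `F` and on x but c n on that multiple, gives c = 0.
    ∇-faithful : ∀ x → aug x ≡ + 0 → n ⊢ ∇ x ≈ 𝟘 → Mem x
    ∇-faithful x p h = strip (back-cong h)
      where
      strip : (Σ ℤ λ c → Mem (λ j → (back (∇ x) j - + 0) - c)) → Mem x
      strip (c , q) = ext (λ j → trans (cong (λ z → (back (∇ x) j - + 0) - z) c≡0) (trans (ℤP.+-identityʳ _) (trans (ℤP.+-identityʳ _) (back-∇ x j)))) q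
        where
        cn≡0 : c * + n ≡ + 0 * + n
        cn≡0 = trans (lem (c * + n)) (trans (cong (λ z → - (z - c * + n)) (sym p)) (cong -_ (trans (cong (λ z → aug x - z) (sym (aug-const c)))
            (trans (sym (aug-⊖ x (λ _ → c))) (trans (sumU-cong (fin n) (λ j → cong (_- c) (sym (trans (ℤP.+-identityʳ _) (back-∇ x j))))) (span⇒aug q))))))
          where lem : ∀ a → a ≡ - (+ 0 - a)
                lem = solve-∀
        c≡0 : c ≡ + 0
        c≡0 = ℤP.*-cancelʳ-≡ c (+ 0) (+ n) cn≡0

    ψ-∇ : ∀ x → ψ (∇ x) ≡ aug x
    ψ-∇ x = trans (ev-lin id (fin n) x edge) (sumU-cong (fin n) (λ i → lem (x i) (+ toℕ i)))
      where lem : ∀ x i → x * ((i + + 1) + (- + 1) * i) ≡ x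
            lem = solve-∀

    aug-back : ∀ y → aug (back y) ≡ ψ y
    aug-back = Tm-ind (λ y → aug (back y) ≡ ψ y) aug-geo (Subgroup.zero∈ augZero)
      (λ x y p q → trans (sumU-add (fin n) (back x) (back y)) (cong₂ _+_ p q))
      (λ a x p → trans (sumU-scale (fin n) a (back x)) (cong (a *_) p))

    ∇-back : ∀ y → n ⊢ ∇ (back y) ≈ y
    ∇-back = Tm-ind (λ y → n ⊢ ∇ (back y) ≈ y) ∇-geo (lin-zero (fin n) _ edge λ _ → •-zero _)
      (λ x y p q → ≈trans (lin-add (fin n) (back x) (back y) edge) (⊞-cong p q))
      (λ a x p → ≈trans (lin-scale (fin n) a (back x) edge) (•-cong a p))

    ∇-norm : n ⊢ ∇ (λ _ → + 1) ≈ 𝟘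
    ∇-norm = ≈trans (lin-coeff (fin n) edge (λ j → sym (geo-n j))) (≈trans (∇-geo (+ n)) (≈trans (periodic (+ n) (+ 0) (∣-resp (sym (ℤP.+-identityʳ (+ n))) ∣-refl)) e-zero))

    onto : ∀ y → + n ∣ ψ y → Σ (Vecℤ n) λ x → InZ n x × n ⊢ ∇ x ≈ y
    onto y (divides q eq) = x , aug⇒InZ n x aug-x , ≈trans (lin-⊖ (back y) (λ _ → q) edge)
        (≈trans (⊞-cong (∇-back y) (•-cong (- + 1) (≈trans (lin-coeff (fin n) edge (λ j → sym (ℤP.*-identityʳ q)))
          (≈trans (lin-scale (fin n) q (λ _ → + 1) edge) (≈trans (•-cong q ∇-norm) (•-𝟘 q)))))) (≈trans (⊞-cong ≈refl (•-𝟘 _)) (⊞-idʳ y)))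
      where
      -- Subtracting q times the norm, which `∇` kills, brings the coefficient sum from q n down to
      -- 0.
      x : Vecℤ n
      x = back y ⊖ (λ _ → q)
      aug-x : aug x ≡ + 0
      aug-x = trans (aug-⊖ (back y) (λ _ → q)) (ℤP.i≡j⇒i-j≡0 (trans (aug-back y) (trans eq (sym (aug-const q)))))

  sandpile : Realizes (SGroup n d) n (+ n)
  sandpile = record
    { τ = ∇
    ; weight = λ x p → ∣-resp (sym (trans (ψ-∇ x) (InZ⇒aug p))) ∣-zero
    ; sound = λ x y _ _ b → ⊟-≈ (≈trans (≈sym (lin-⊖ x y edge)) (span-⊆ (vanishing edge) (n ℕ.∸ 1) _ (λ i → ∇-fV (idx {n} i)) b))
    ; exact = λ x y p q h → ∇-faithful (x ⊖ y) (trans (aug-⊖ x y) (cong₂ _-_ (InZ⇒aug p) (InZ⇒aug q))) (≈trans (lin-⊖ x y edge) (≈-⊟ h))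
    ; additive = λ x y → lin-add (fin n) x y edge
    ; onto = onto
    }

-- Torsion and the reduced Laplacian

module Annihilator (d : ℤ) where
  open Dune d
  open Bases d
  open Towers d using (∣•-vanish)

  multiple : (u : U) (M : ⟦ u ⟧ → ℤ) → (∀ i → M i ≢ + 0) → Σ ℕ λ c → 1 ≤ c × (∀ i → M i ∣ + c)
  multiple (fin zero)    M p = 1 , ℕP.≤-refl , λ ()
  multiple (fin (suc k)) M p = extend (multiple (fin k) (M ∘ Fin.suc) (p ∘ Fin.suc))
    where
    extend : (Σ ℕ λ c → 1 ≤ c × (∀ i → M (Fin.suc i) ∣ + c)) → Σ ℕ λ c → 1 ≤ c × (∀ i → M i ∣ + c)
    extend (c , h , q) = ∣ M 0F ∣ ℕ.* c , ℕP.*-mono-≤ {1} {∣ M 0F ∣} (ℕP.n≢0⇒n>0 (λ z → p 0F (ℤP.∣i∣≡0⇒i≡0 z))) h ,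
      λ { 0F → ∣ᵤ⇒∣ (ℕD.m∣m*n {∣ M 0F ∣} c) ; (Fin.suc i) → ∣-trans (q i) (∣ᵤ⇒∣ (ℕD.n∣m*n (∣ M 0F ∣) {c})) }
  multiple (u ⊎ᵤ w) M p = merge (multiple u (M ∘ inj₁) (p ∘ inj₁)) (multiple w (M ∘ inj₂) (p ∘ inj₂))
    where
    merge : (Σ ℕ λ c → 1 ≤ c × (∀ i → M (inj₁ i) ∣ + c)) → (Σ ℕ λ c → 1 ≤ c × (∀ i → M (inj₂ i) ∣ + c)) →
            Σ ℕ λ c → 1 ≤ c × (∀ i → M i ∣ + c)
    merge (c , h , q) (c′ , h′ , q′) = c ℕ.* c′ , ℕP.*-mono-≤ h h′ ,
      λ { (inj₁ i) → ∣-trans (q i) (∣ᵤ⇒∣ (ℕD.m∣m*n {c} c′)) ; (inj₂ i) → ∣-trans (q′ i) (∣ᵤ⇒∣ (ℕD.n∣m*n c {c′})) }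

  -- The orders are nonzero, so they have a positive common multiple. It witnesses that passing to
  -- the torsion subgroup in the sandpile group discards nothing.
  annihilate : ∀ {n N u g M} → Basis n N u g M → (∀ i → M i ≢ + 0) → Σ ℕ λ c → 1 ≤ c × (∀ y → N ∣ ψ y → n ⊢ (+ c) • y ≈ 𝟘)
  annihilate {n} {N} {u} {g} {M} B p = finish (multiple u M p)
    where
    open Basis B
    open ModuleSolver n
    finish : (Σ ℕ λ c → 1 ≤ c × (∀ i → M i ∣ + c)) → Σ ℕ λ c → 1 ≤ c × (∀ y → N ∣ ψ y → n ⊢ (+ c) • y ≈ 𝟘)
    finish (c , h , q) = c , h , λ y r → ≈trans (•-cong (+ c) (proj₂ (gen y r)))
      (≈trans (≈sym (lin-scale u (+ c) (proj₁ (gen y r)) g))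
        (lin-zero u _ g λ i → ∣•-vanish (∣m⇒∣m*n (proj₁ (gen y r) i) (q i)) (ord i)))

module ReducedLaplacian (d : ℤ) (n′ : ℕ) (v : Fin (suc n′)) where
  private n = suc n′
  open Monomials n
  open Geometric n using (fV-sum; fV-aug)
  open SandpileRealization d n using (F; fV∈; span⇒aug)
  open Subgroup F

  row : Fin n → Vecℤ n
  row u = fV n d (+ toℕ u)

  -- The deleted coordinate is restored as the one that makes the coefficient sum 0; on such vectors
  -- deleting it loses no information.
  extend : Vecℤ n′ → Vecℤ n
  extend x w = sumU (fin n′) (λ i → x i * (δ {fin n} (punchIn v i) w - δ {fin n} v w))

  private
    aug-δ : ∀ u → aug (δ {fin n} u) ≡ + 1
    aug-δ u = trans (sumU-only (fin n) (δ {fin n} u) u (λ i ne → δ-≢ {fin n} ne)) (δ-refl {fin n} u)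

  extend-aug : ∀ x → aug (extend x) ≡ + 0
  extend-aug x = sumU-mem augZero n′ (λ i → δ {fin n} (punchIn v i) ⊖ δ {fin n} v) x
    (λ i → trans (aug-⊖ (δ {fin n} (punchIn v i)) (δ {fin n} v)) (cong₂ _-_ (aug-δ (punchIn v i)) (aug-δ v)))

  extend-punchIn : ∀ x k → extend x (punchIn v k) ≡ x k
  extend-punchIn x k = trans (sumU-only (fin n′) (λ i → x i * (δ {fin n} (punchIn v i) (punchIn v k) - δ {fin n} v (punchIn v k))) k
        (λ i ne → trans (cong₂ (λ a b → x i * (a - b)) (δ-≢ {fin n} (λ eq → ne (sym (punchIn-injective v k i eq)))) (δ-≢ {fin n} (punchInᵢ≢i v k))) (ℤP.*-zeroʳ (x i))))
      (trans (cong₂ (λ a b → x k * (a - b)) (δ-refl {fin n} (punchIn v k)) (δ-≢ {fin n} (punchInᵢ≢i v k))) (ℤP.*-identityʳ (x k)))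

  determined : ∀ x y → aug x ≡ + 0 → aug y ≡ + 0 → (∀ k → x (punchIn v k) ≡ y (punchIn v k)) → ∀ w → x w ≡ y w
  determined x y p q h w = go (v Fin.≟ w)
    where
    at-v : x v ≡ y v
    at-v = cancel (x v) (y v) (sumU (fin n′) (x ∘ punchIn v)) (trans (sym (sumU-punchIn n′ x v)) (trans p (trans (sym q)
        (trans (sumU-punchIn n′ y v) (cong (λ z → y v + z) (sumU-cong (fin n′) (λ k → sym (h k))))))))
      where
      cancel : ∀ a b s → a + s ≡ b + s → a ≡ b
      cancel a b s eq = trans (lem a s) (trans (cong (_- s) eq) (sym (lem b s)))
        where lem : ∀ a s → a ≡ (a + s) - s
              lem = solve-∀
    go : Dec (v ≡ w) → x w ≡ y w
    go (yes refl) = at-v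
    go (no ne) = subst (λ u → x u ≡ y u) (punchIn-punchOut ne) (h (punchOut ne))

  private
    additive : ∀ (x y : Vecℤ n′) (h : Fin n′ → ℤ) → sumU (fin n′) (λ i → (x i + y i) * h i) ≡ sumU (fin n′) (λ i → x i * h i) + sumU (fin n′) (λ i → y i * h i)
    additive x y h = trans (sumU-cong (fin n′) (λ i → ℤP.*-distribʳ-+ (h i) (x i) (y i))) (sumU-add (fin n′) (λ i → x i * h i) (λ i → y i * h i))

  extend-⊕ : ∀ x y w → extend (x ⊕ y) w ≡ extend x w + extend y w
  extend-⊕ x y w = additive x y (λ i → δ {fin n} (punchIn v i) w - δ {fin n} v w)

  extend-⊖ : ∀ x y w → extend (x ⊖ y) w ≡ extend x w - extend y w
  extend-⊖ x y w = determined (extend (x ⊖ y)) (extend x ⊖ extend y) (extend-aug (x ⊖ y))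
    (trans (aug-⊖ (extend x) (extend y)) (cong₂ _-_ (extend-aug x) (extend-aug y)))
    (λ k → trans (extend-punchIn (x ⊖ y) k) (sym (cong₂ _-_ (extend-punchIn x k) (extend-punchIn y k)))) w

  restrict : Vecℤ n → Vecℤ n′
  restrict y k = y (punchIn v k)

  extend-restrict : ∀ y → aug y ≡ + 0 → ∀ w → extend (restrict y) w ≡ y w
  extend-restrict y p = determined (extend (restrict y)) y (extend-aug (restrict y)) p (extend-punchIn (restrict y))

  span-without : ∀ {x} → Mem x → InSpan n′ (row ∘ punchIn v) x
  span-without = span-⊆ (spanSubgroup n′ (row ∘ punchIn v)) n′ (λ i → fV n d (idx {n} i)) (λ i → row∈ (Fin.suc i))
    where
    row∈ : ∀ u → InSpan n′ (row ∘ punchIn v) (row u)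
    row∈ u = go (v Fin.≟ u)
      where
      go : Dec (v ≡ u) → InSpan n′ (row ∘ punchIn v) (row u)
      go (yes refl) = missing∈span row v (fV-sum d)
      go (no ne) = subst (λ u → InSpan n′ (row ∘ punchIn v) (row u)) (punchIn-punchOut ne) (generator∈span n′ (row ∘ punchIn v) (punchOut ne))

  module _ (G : Digraph n) (σ : ℤ) (σ²≡1 : σ * σ ≡ + 1) (laplacian : ∀ u w → Laplacian G u w ≡ σ * row u w) where
    private
      Rows : Vecℤ n′ → Set
      Rows = InSpan n′ (λ i j → Laplacian G (punchIn v i) (punchIn v j))

    rows⇒ : ∀ x → Rows x → Mem (extend x)
    rows⇒ x p@(c , _) = ext (determined y (extend x) (span⇒aug y∈) (extend-aug x) agree) y∈
      where
      y : Vecℤ n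
      y w = sumU (fin n′) (λ i → (c i * σ) * row (punchIn v i) w)
      y∈ : Mem y
      y∈ = sumU-mem F n′ (row ∘ punchIn v) (λ i → c i * σ) (λ i → fV∈ (+ toℕ (punchIn v i)))
      agree : ∀ k → y (punchIn v k) ≡ extend x (punchIn v k)
      agree k = trans (sumU-cong (fin n′) (λ i → trans (ℤP.*-assoc (c i) σ (row (punchIn v i) (punchIn v k)))
          (cong (c i *_) (sym (laplacian (punchIn v i) (punchIn v k))))))
        (trans (sym (span-elim n′ (λ i j → Laplacian G (punchIn v i) (punchIn v j)) p k)) (sym (extend-punchIn x k)))

    rows⇐ : ∀ x → Mem (extend x) → Rows x
    rows⇐ x p = finish (span-without p)
      where
      finish : InSpan n′ (row ∘ punchIn v) (extend x) → Rows x
      finish q@(c , _) = span-intro n′ _ (λ i → c i * σ) λ k →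
          trans (sym (extend-punchIn x k)) (trans (span-elim n′ (row ∘ punchIn v) q (punchIn v k))
            (sumU-cong (fin n′) (λ i → sym (trans (cong (c i * σ *_) (laplacian (punchIn v i) (punchIn v k)))
              (trans (lem (c i) σ (row (punchIn v i) (punchIn v k))) (trans (cong (λ z → c i * (z * row (punchIn v i) (punchIn v k))) σ²≡1)
                (cong (c i *_) (ℤP.*-identityˡ (row (punchIn v i) (punchIn v k))))))))))
        where lem : ∀ c s r → c * s * (s * r) ≡ c * (s * s * r)
              lem = solve-∀

    -- The sign σ does not affect spans. The multiplier c is what surjectivity needs: a restricted
    -- vector belongs to the sandpile group only with a proof that it is torsion.
    sandpile≅ : (Σ ℕ λ c → 1 ≤ c × (∀ y → InZ n y → Mem ((+ c) · y))) → Sandpile n G v ≅ SGroup n d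
    sandpile≅ (c , 1≤c , kill) = record
      { φ    = λ x _ → extend x
      ; into = λ x _ → aug⇒InZ n (extend x) (extend-aug x)
      ; wd   = λ x y _ _ p → ext (extend-⊖ x y) (rows⇒ (x ⊖ y) p)
      ; hom  = λ x y _ _ _ → ext (λ w → sym (ℤP.i≡j⇒i-j≡0 (extend-⊕ x y w))) zero∈
      ; inj  = λ x y _ _ p → rows⇐ (x ⊖ y) (ext (λ w → sym (extend-⊖ x y w)) p)
      ; surj = λ y p → restrict y , (c , 1≤c , rows⇐ ((+ c) · restrict y)
            (ext (λ w → sym (extend-restrict ((+ c) · y) (scaled-aug y p) w)) (kill y p))) ,
          ext (λ w → sym (ℤP.i≡j⇒i-j≡0 (extend-restrict y (InZ⇒aug p) w))) zero∈
      }
      where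
      scaled-aug : ∀ y → InZ n y → aug ((+ c) · y) ≡ + 0
      scaled-aug y p = Subgroup.scale∈ augZero (+ c) {y} (InZ⇒aug p)

deBruijn-laplacian : ∀ n D u w → Laplacian (DB n D) u w ≡ + 1 * fV n (+ D) (+ toℕ u) w
deBruijn-laplacian n D u w = trans (cong₂ (λ a b → + a * mono n (+ toℕ u) w - sumList b w)
    (length-applyUpTo (λ i → + D * + toℕ u + + i) D) (map-applyUpTo (λ i → + D * + toℕ u + + i) (mono n) D))
  (sym (ℤP.*-identityˡ _))

kautz-laplacian : ∀ n D u w → Laplacian (Ktz n (suc D)) u w ≡ (- + 1) * fV n -[1+ D ] (+ toℕ u) w
kautz-laplacian n D u w = trans (cong₂ (λ a b → + a * mono n (+ toℕ u) w - sumList b w)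
    (length-applyUpTo f (suc D)) (map-applyUpTo f (mono n) (suc D)))
    (lem (+ suc D) (mono n (+ toℕ u) w) (sumList (applyUpTo (λ i → mono n (f i)) (suc D)) w))
  where
  f : ℕ → ℤ
  f i = - (+ suc D) * (+ toℕ u + + 1) + + i
  lem : ∀ D m s → D * m - s ≡ (- + 1) * ((- D) * m + s)
  lem = solve-∀

-- Matching the moduli and assembling the isomorphisms

div-exact : ∀ a b .{{_ : ℕ.NonZero b}} → b ℕD.∣ a → a ≡ b ℕ.* (a div b)
div-exact a (suc b) p = trans (sym (ℕM.m/n*n≡m p)) (ℕP.*-comm (a ℕ./ suc b) (suc b))

*-div : ∀ b q .{{_ : ℕ.NonZero b}} → (b ℕ.* q) div b ≡ q
*-div (suc b) q = trans (cong (ℕ._/ suc b) (ℕP.*-comm (suc b) q)) (ℕM.m*n/n≡m q (suc b))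

abs-^ : ∀ i k → ∣ i ^ k ∣ ≡ ∣ i ∣ ℕ.^ k
abs-^ i zero    = refl
abs-^ i (suc k) = trans (ℤP.abs-* i (i ^ k)) (cong (∣ i ∣ ℕ.*_) (abs-^ i k))

applyUpTo-cong : ∀ {A : Set} {f g : ℕ → A} → (∀ i → f i ≡ g i) → ∀ k → applyUpTo f k ≡ applyUpTo g k
applyUpTo-cong p zero    = refl
applyUpTo-cong p (suc k) = cong₂ List._∷_ (p 0) (applyUpTo-cong (p ∘ suc) k)

tabulate-const : ∀ {A : Set} n (a : A) → List.tabulate {n = n} (λ _ → a) ≡ replicate n a
tabulate-const zero    a = refl
tabulate-const (suc n) a = cong (a List.∷_) (tabulate-const n a)

tabulate-map : ∀ {A B : Set} (f : A → B) xs → List.tabulate (f ∘ List.lookup xs) ≡ List.map f xs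
tabulate-map f xs = trans (sym (map-tabulate (List.lookup xs) f)) (cong (List.map f) (tabulate-lookup xs))

nSeq-suc : ∀ n D i → nSeq n D (suc i) ≡ nSeq (nSeq n D 1) D i
nSeq-suc n D zero    = refl
nSeq-suc n D (suc i) = cong (λ a → a div gcd a D) (nSeq-suc n D i)

module Assembly (d : ℤ) .{{d≢0 : ℤ.NonZero d}} where
  open Dune d
  open Bases d
  open Towers d
  open Lifting d
  open LiftingKernel d using (kernelOrder; d^suc)

  private D = ∣ d ∣

  -- The offset l counts the levels already passed, which lets the block list of n₁ continue that of
  -- n in the induction over the tower.
  blockΣ blockS : ℕ → ℕ → ℕ → List ℕ
  blockΣ n l i = replicate (nSeq n D i ℕ.+ nSeq n D (suc (suc i)) ℕ.∸ 2 ℕ.* nSeq n D (suc i)) (D ℕ.^ suc (l ℕ.+ i))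
  blockS n l i = (D ℕ.^ suc (l ℕ.+ i)) div dSeq n D i List.∷
    replicate (nSeq n D i ℕ.+ nSeq n D (suc (suc i)) ℕ.∸ (2 ℕ.* nSeq n D (suc i) ℕ.+ 1)) (D ℕ.^ suc (l ℕ.+ i))

  record Built (n m k : ℕ) : Set where
    field
      tower : Tower n m
      listΣ : ∀ l → flat (C tower) (λ i → ∣ order tower l i ∣) ≡ concat (applyUpTo (blockΣ n l) k)
      listS : ∀ l → flat (C tower) (λ i → ∣ kernelOrder tower l i ∣) ≡ concat (applyUpTo (blockS n l) k)

  private
    reindex : ∀ {A : Set} n (block : ℕ → ℕ → ℕ → ℕ → A) l i →
              block (nSeq (nSeq n D 1) D i) (nSeq (nSeq n D 1) D (suc i)) (nSeq (nSeq n D 1) D (suc (suc i))) (suc l ℕ.+ i) ≡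
              block (nSeq n D (suc i)) (nSeq n D (suc (suc i))) (nSeq n D (suc (suc (suc i)))) (l ℕ.+ suc i)
    reindex n block l i = trans (cong₂ (λ a b → block a b (nSeq (nSeq n D 1) D (suc (suc i))) (suc l ℕ.+ i)) (sym (nSeq-suc n D i)) (sym (nSeq-suc n D (suc i))))
      (cong₂ (block (nSeq n D (suc i)) (nSeq n D (suc (suc i)))) (sym (nSeq-suc n D (suc (suc i)))) (sym (ℕP.+-suc l i)))

  buildStep : ∀ n m k → 1 ≤ n → dSeq n D 0 ≢ 1 → Built (nSeq n D 1) m k → Built n m (suc k)
  buildStep n m k 1≤n d₀≢1 B = record { tower = step L t ; listΣ = listΣ′ ; listS = listS′ }
    where
    d₀ = gcd n D
    n₁ = nSeq n D 1
    d₁ = gcd n₁ D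
    n₂ = nSeq n D 2
    instance
      n≢0 : ℕ.NonZero n
      n≢0 = ℕ.>-nonZero 1≤n
      d₀≢0 : ℕ.NonZero d₀
      d₀≢0 = ℕ.≢-nonZero (λ z → ℕ.≢-nonZero⁻¹ n (ℕD.0∣⇒≡0 (subst (ℕD._∣ n) z (gcd[m,n]∣m n D))))
    n≡ : n ≡ d₀ ℕ.* n₁
    n≡ = div-exact n d₀ (gcd[m,n]∣m n D)
    instance
      n₁≢0 : ℕ.NonZero n₁
      n₁≢0 = ℕ.≢-nonZero (λ z → ℕ.≢-nonZero⁻¹ n (trans n≡ (trans (cong (d₀ ℕ.*_) z) (ℕP.*-zeroʳ d₀))))
      d₁≢0 : ℕ.NonZero d₁
      d₁≢0 = ℕ.≢-nonZero (λ z → ℕ.≢-nonZero⁻¹ n₁ (ℕD.0∣⇒≡0 (subst (ℕD._∣ n₁) z (gcd[m,n]∣m n₁ D))))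
    open Construct d n n₁ d₀ d₁ n₂ n≡ (div-exact n₁ d₁ (gcd[m,n]∣m n₁ D)) refl refl d₀≢1 using (level; level-count)
    L = level
    open Built B renaming (tower to t)
    count = Level.count L
    -- Truncated subtraction is exact here, as `level-count` exhibits the minuend as a sum with the
    -- subtrahend as one term.
    countΣ : suc count ≡ n ℕ.+ n₂ ℕ.∸ 2 ℕ.* n₁
    countΣ = trans (sym (ℕP.m+n∸n≡m (suc count) (2 ℕ.* n₁))) (cong (ℕ._∸ 2 ℕ.* n₁) level-count)
    countS : count ≡ n ℕ.+ n₂ ℕ.∸ (2 ℕ.* n₁ ℕ.+ 1)
    countS = trans (cong ℕ.pred countΣ) (trans (ℕP.pred[m∸n]≡m∸[1+n] (n ℕ.+ n₂) (2 ℕ.* n₁)) (cong (n ℕ.+ n₂ ℕ.∸_) (ℕP.+-comm 1 (2 ℕ.* n₁))))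
    abs-power : ∀ l → ∣ d ^ suc l ∣ ≡ D ℕ.^ suc (l ℕ.+ 0)
    abs-power l = trans (abs-^ d (suc l)) (cong (λ a → D ℕ.^ suc a) (sym (ℕP.+-identityʳ l)))
    constant-block : ∀ l c → List.tabulate {n = c} (λ _ → ∣ d ^ suc l ∣) ≡ replicate c (D ℕ.^ suc (l ℕ.+ 0))
    constant-block l c = trans (tabulate-const c _) (cong (replicate c) (abs-power l))
    listΣ′ : ∀ l → flat (C (step L t)) (λ i → ∣ order (step L t) l i ∣) ≡ concat (applyUpTo (blockΣ n l) (suc k))
    listΣ′ l = cong₂ _++_ (trans (constant-block l (suc count)) (cong (λ c → replicate c (D ℕ.^ suc (l ℕ.+ 0))) countΣ))
      (trans (listΣ (suc l)) (cong concat (applyUpTo-cong (reindex n (λ a b c x → replicate (a ℕ.+ c ℕ.∸ 2 ℕ.* b) (D ℕ.^ suc x)) l) k)))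
    special : ∀ l → ∣ Level.d′ L * d ^ l ∣ ≡ (D ℕ.^ suc (l ℕ.+ 0)) div d₀
    special l = trans (sym (*-div d₀ ∣ Level.d′ L * d ^ l ∣)) (cong (_div d₀)
      (trans (sym (ℤP.abs-* (+ d₀) (Level.d′ L * d ^ l))) (trans (cong ∣_∣ (sym (d^suc L l))) (abs-power l))))
    listS′ : ∀ l → flat (C (step L t)) (λ i → ∣ kernelOrder (step L t) l i ∣) ≡ concat (applyUpTo (blockS n l) (suc k))
    listS′ l = cong₂ _++_ (cong₂ List._∷_ (special l) (trans (constant-block l count) (cong (λ c → replicate c (D ℕ.^ suc (l ℕ.+ 0))) countS)))
      (trans (listS (suc l)) (cong concat (applyUpTo-cong (reindex n (λ a b c x → (D ℕ.^ suc x) div gcd a D List.∷ replicate (a ℕ.+ c ℕ.∸ (2 ℕ.* b ℕ.+ 1)) (D ℕ.^ suc x)) l) k)))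

  1≤nSeq₁ : ∀ n → 1 ≤ n → 1 ≤ nSeq n D 1
  1≤nSeq₁ n 1≤n = ℕP.n≢0⇒n>0 λ z → ℕP.<⇒≢ 1≤n (sym (trans (div-exact n (gcd n D) {{d₀≢0}} (gcd[m,n]∣m n D)) (trans (cong (gcd n D ℕ.*_) z) (ℕP.*-zeroʳ (gcd n D)))))
    where
    d₀≢0 : ℕ.NonZero (gcd n D)
    d₀≢0 = ℕ.≢-nonZero (λ z → ℕP.<⇒≢ 1≤n (sym (ℕD.0∣⇒≡0 (subst (ℕD._∣ n) z (gcd[m,n]∣m n D)))))

  build : ∀ k n m → 1 ≤ n → m ≡ nSeq n D k → (∀ i → i < k → dSeq n D i ≢ 1) → Built n m k
  build zero    n m 1≤n refl h = record { tower = base ; listΣ = λ _ → refl ; listS = λ _ → refl }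
  build (suc k) n m 1≤n eq h = buildStep n m k 1≤n (h 0 (ℕ.s≤s ℕ.z≤n))
    (build k (nSeq n D 1) m (1≤nSeq₁ n 1≤n) (trans eq (nSeq-suc n D k))
      (λ i lt eq′ → h (suc i) (ℕ.s≤s lt) (trans (cong (λ a → gcd a D) (nSeq-suc n D i)) eq′)))

  1≤nSeq : ∀ k n → 1 ≤ n → 1 ≤ nSeq n D k
  1≤nSeq zero    n h = h
  1≤nSeq (suc k) n h = subst (1 ≤_) (sym (nSeq-suc n D k)) (1≤nSeq k (nSeq n D 1) (1≤nSeq₁ n h))

  order≢0 : ∀ {n m} (t : Tower n m) l i → order t l i ≢ + 0
  order≢0 (step L t) l (inj₁ i) z = ℕ.≢-nonZero⁻¹ (D ℕ.^ suc l) {{ℕP.m^n≢0 D (suc l)}} (trans (sym (abs-^ d (suc l))) (cong ∣_∣ z))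
  order≢0 (step L t) l (inj₂ c) z = order≢0 t (suc l) c z

  -- r s is the idempotent of ℤ/n that is 1 modulo m and 0 modulo n / m.
  unit : ∀ {n m} → Tower n m → ∀ x → + m ∣ + 1 - d * x → Σ ℤ λ r → Σ ℤ λ s → + n ≡ r * + m × + m ∣ + 1 - r * s
  unit {m = m} base x h = + 1 , + 1 , sym (ℤP.*-identityˡ (+ m)) , ∣-zero
  unit {n} {m} (step {n₁ = n₁} L t) x h = compose (unit t x h)
    where
    open Level L
    compose : (Σ ℤ λ r → Σ ℤ λ s → + n₁ ≡ r * + m × + m ∣ + 1 - r * s) → Σ ℤ λ r → Σ ℤ λ s → + n ≡ r * + m × + m ∣ + 1 - r * s
    compose (r , s , eq , q) = d₀ * r , (d′ * x) * s , trans n≡ (trans (cong (d₀ *_) eq) (sym (ℤP.*-assoc d₀ r (+ m)))) ,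
        ∣-resp (trans (cong (λ z → (+ 1 - z * x) + (z * x) * (+ 1 - r * s)) d≡) (lem d₀ d′ x r s)) (∣m∣n⇒∣m+n h (∣n⇒∣m*n (d * x) q))
      where lem : ∀ a b x r s → (+ 1 - a * b * x) + (a * b * x) * (+ 1 - r * s) ≡ + 1 - a * r * ((b * x) * s)
            lem = solve-∀

module Conclusion (n : ℕ) (d : ℤ) .{{d≢0 : ℤ.NonZero d}} (1≤n : 1 ≤ n) (2≤D : 2 ≤ ∣ d ∣) (k : ℕ) (d_k≡1 : dSeq n ∣ d ∣ k ≡ 1)
                  (minimal : ∀ i → i < k → dSeq n ∣ d ∣ i ≢ 1) (o : ℕ → ℕ) (𝒱 : List ℕ)
                  (repSet : IsRepSet (nSeq n ∣ d ∣ k) d 𝒱)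
                  (orbitSize : ∀ v → v ∈ 𝒱 → IsOrbitSize (nSeq n ∣ d ∣ k) d v (o v)) where
  open Dune d
  open Bases d
  open Towers d
  open Lifting d
  open LiftingKernel d
  open Assembly d
  open Realization d

  private
    m = nSeq n ∣ d ∣ k
    instance
      m≢0 : ℕ.NonZero m
      m≢0 = ℕ.>-nonZero (1≤nSeq k n 1≤n)
      n≢0 : ℕ.NonZero n
      n≢0 = ℕ.>-nonZero 1≤n
    open Periodic d m d_k≡1 o 𝒱 repSet orbitSize
    open KernelAtM d m d_k≡1 o 𝒱 repSet orbitSize
    open Built (build k n m 1≤n refl minimal) renaming (tower to t)

    x : ℤ
    x = proj₁ (bézout m d)
    m∣1-dx : + m ∣ + 1 - d * x
    m∣1-dx = subst (λ g → + m ∣ + g - d * x) d_k≡1 (proj₂ (bézout m d))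

    r s θ : ℤ
    r = proj₁ (unit t x m∣1-dx)
    s = proj₁ (proj₂ (unit t x m∣1-dx))
    θ = r * s

    θ≡1 : ∀ v → + m ∣ θ * v - v
    θ≡1 v = ∣-resp (lem (r * s) v) (∣n⇒∣m*n (- v) (proj₂ (proj₂ (proj₂ (unit t x m∣1-dx)))))
      where lem : ∀ a v → (- v) * (+ 1 - a) ≡ a * v - v
            lem = solve-∀

    n∣θm : + n ∣ θ * + m
    n∣θm = ∣-by s (trans (lem r s (+ m)) (cong (s *_) (sym (proj₁ (proj₂ (proj₂ (unit t x m∣1-dx)))))))
      where lem : ∀ r s m → r * s * m ≡ s * (r * m)
            lem = solve-∀

    H : ⟦ PU ⟧ → T
    H = proj₁ kernelBasisAtM
    PS : ⟦ PU ⟧ → ℤ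
    PS = proj₁ (proj₂ kernelBasisAtM)
    P≡ : ∀ i → P i ≡ + cOf m d (rep i) * PS i
    P≡ = proj₂ (proj₂ (proj₂ kernelBasisAtM))

    basisΣ : Basis n (+ 1) (C t ⊎ᵤ PU) (gens periodicBasis θ θ≡1 t) (orders periodicBasis θ θ≡1 t)
    basisΣ = towerBasis periodicBasis θ θ≡1 t n∣θm

    basisS : Basis n (+ n) (C t ⊎ᵤ PU) (kernelGens periodicBasis (proj₁ (proj₂ (proj₂ kernelBasisAtM))) θ θ≡1 t)
                   (kernelOrders periodicBasis (proj₁ (proj₂ (proj₂ kernelBasisAtM))) θ θ≡1 t)
    basisS = kernelTowerBasis periodicBasis (proj₁ (proj₂ (proj₂ kernelBasisAtM))) θ θ≡1 t n∣θm

    P≢0 : ∀ i → P i ≢ + 0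
    P≢0 i z = ℕP.<⇒≢ big (sym (trans (sym (abs-^ d (o (rep i)))) (cong ∣_∣ (ℤP.i-j≡0⇒i≡j (d ^ o (rep i)) (+ 1) z))))
      where
      big : 1 < ∣ d ∣ ℕ.^ o (rep i)
      big = ℕP.≤-trans 2≤D (subst (_≤ ∣ d ∣ ℕ.^ o (rep i)) (ℕP.*-identityʳ ∣ d ∣) (ℕP.^-monoʳ-≤ ∣ d ∣ {{ℕ.>-nonZero (ℕP.≤-trans (ℕ.s≤s ℕ.z≤n) 2≤D)}} (O.1≤o i)))

    PS-value : ∀ i → ∣ PS i ∣ ≡ ∣ P i ∣ div cOf m d (rep i)
    PS-value i = sym (trans (cong (_div c) (trans (cong ∣_∣ (P≡ i)) (ℤP.abs-* (+ c) (PS i)))) (*-div c ∣ PS i ∣ {{c≢0}}))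
      where
      c = cOf m d (rep i)
      c≢0 : ℕ.NonZero c
      c≢0 = ℕ.≢-nonZero (λ z → P≢0 i (trans (P≡ i) (cong (λ a → + a * PS i) z)))

    annihilator : Σ ℕ λ c → 1 ≤ c × (∀ y → + 1 ∣ ψ y → n ⊢ (+ c) • y ≈ 𝟘)
    annihilator = Annihilator.annihilate d basisΣ λ { (inj₁ i) → order≢0 t 0 i ; (inj₂ i) → P≢0 i }

  sandDune≅ : SandDune n d ≅ CyclicSum (ΣModuli n d k o 𝒱)
  sandDune≅ = subst (λ ms → SandDune n d ≅ CyclicSum ms)
    (cong₂ _++_ (listΣ 0) (tabulate-map (λ v → ∣ d ^ o v - + 1 ∣) 𝒱))
    (basis⇒≅ (SandDuneRealization.sandDune n) basisΣ)

  sGroup≅ : SGroup n d ≅ CyclicSum (SModuli n d k o 𝒱)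
  sGroup≅ = subst (λ ms → SGroup n d ≅ CyclicSum ms)
    (cong₂ _++_ (listS 0) (trans (tabulate-cong PS-value) (tabulate-map (λ v → ∣ d ^ o v - + 1 ∣ div cOf m d v) 𝒱)))
    (basis⇒≅ (SandpileRealization.sandpile d n) basisS)

  -- S(n,d) sits inside Σ(n,d) as ker ψ, so the number that annihilates Σ(n,d) annihilates it too.
  torsion : Σ ℕ λ c → 1 ≤ c × (∀ y → InZ n y → InSpan (n ℕ.∸ 1) (λ i → fV n d (idx {n} i)) ((+ c) · y))
  torsion = proj₁ annihilator , proj₁ (proj₂ annihilator) , λ y p →
      Subgroup.ext F (λ j → ℤP.+-identityʳ ((+ proj₁ annihilator) * y j))
        (exact ((+ proj₁ annihilator) · y) zeroV (aug⇒InZ n _ (Subgroup.scale∈ augZero (+ proj₁ annihilator) {y} (InZ⇒aug p)))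
          (aug⇒InZ n zeroV (Subgroup.zero∈ augZero))
          (≈trans (lin-scale (fin n) (+ proj₁ annihilator) y edge) (≈trans (proj₂ (proj₂ annihilator) (τ y) (1∣ _))
            (≈sym (lin-zero (fin n) zeroV edge λ _ → •-zero _)))))
    where
    open SandpileRealization d n using (F; edge; sandpile)
    open Realizes sandpile
    open Monomials n
    open ModuleSolver n

deBruijn≅ : ∀ n D v → (Σ ℕ λ c → 1 ≤ c × (∀ y → InZ n y → InSpan (n ℕ.∸ 1) (λ i → fV n (+ D) (idx {n} i)) ((+ c) · y))) →
            Sandpile n (DB n D) v ≅ SGroup n (+ D)
deBruijn≅ (suc n) D v = ReducedLaplacian.sandpile≅ (+ D) n v (DB (suc n) D) (+ 1) refl (deBruijn-laplacian (suc n) D)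

kautz≅ : ∀ n D v → (Σ ℕ λ c → 1 ≤ c × (∀ y → InZ n y → InSpan (n ℕ.∸ 1) (λ i → fV n -[1+ D ] (idx {n} i)) ((+ c) · y))) →
         Sandpile n (Ktz n (suc D)) v ≅ SGroup n -[1+ D ]
kautz≅ (suc n) D v = ReducedLaplacian.sandpile≅ -[1+ D ] n v (Ktz (suc n) (suc D)) (- + 1) refl (kautz-laplacian (suc n) D)

theorem3p1 : (n : ℕ) (d : ℤ) → 1 ≤ n → 2 ≤ ∣ d ∣ →
    (k : ℕ) → dSeq n ∣ d ∣ k ≡ 1 → (∀ i → i < k → dSeq n ∣ d ∣ i ≢ 1) →
    (o : ℕ → ℕ) → (𝒱 : List ℕ) → IsRepSet (nSeq n ∣ d ∣ k) d 𝒱 →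
    (∀ v → v ∈ 𝒱 → IsOrbitSize (nSeq n ∣ d ∣ k) d v (o v)) →
    ((D : ℕ) → d ≡ + D → (v : Fin n) → Sandpile n (DB n D) v ≅ SGroup n d) ×
    ((D : ℕ) → d ≡ - (+ D) → (v : Fin n) → Sandpile n (Ktz n D) v ≅ SGroup n d) ×
    (SandDune n d ≅ CyclicSum (ΣModuli n d k o 𝒱)) ×
    (SGroup n d ≅ CyclicSum (SModuli n d k o 𝒱))
theorem3p1 n d 1≤n 2≤D k d_k≡1 minimal o 𝒱 repSet orbitSize =
    (λ D eq v → deBruijn D eq v torsion) , (λ D eq v → kautz D eq v 2≤D torsion) , sandDune≅ , sGroup≅
  where
  open Conclusion n d {{ℕ.>-nonZero (ℕP.≤-trans (ℕ.s≤s ℕ.z≤n) 2≤D)}} 1≤n 2≤D k d_k≡1 minimal o 𝒱 repSet orbitSize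
  Torsion : ℤ → Set
  Torsion d = Σ ℕ λ c → 1 ≤ c × (∀ y → InZ n y → InSpan (n ℕ.∸ 1) (λ i → fV n d (idx {n} i)) ((+ c) · y))
  deBruijn : ∀ {d} D → d ≡ + D → ∀ v → Torsion d → Sandpile n (DB n D) v ≅ SGroup n d
  deBruijn D refl v h = deBruijn≅ n D v h
  kautz : ∀ {d} D → d ≡ - (+ D) → ∀ v → 2 ≤ ∣ d ∣ → Torsion d → Sandpile n (Ktz n D) v ≅ SGroup n d
  kautz zero    refl v () h
  kautz (suc D) refl v _  h = kautz≅ n D v h
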